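{- Let $\ell\ne p$ be a prime and let $e_i$ be the multiplicity of $\ell^i$ as an elementary divisor of the Laplacian matrix $L'$ of the Grassmann graph $\Gamma'$ on the $2$-dimensional subspaces of $V=\mathbb F_q^n$ ($n\ge4$, $q=p^t$). Put $f=[n]-1$ and $g=\left[\begin{smallmatrix}n\\2\end{smallmatrix}\right]_q-[n]$. In each case below, $e_i=0$ for all $i$ not listed. (A) Suppose $\ell\nmid q+1$. If $\ell\nmid[n]$ and $\ell\nmid[n-1]$, then $\ell\nmid|K(\Gamma')|$. Otherwise $\ell$ divides exactly one of $[n]$, $[n-1]$, and: (i) if $\ell\mid[n]$ and $\ell\nmid[n-1]$, with $a=v_\ell([n])$: $e_a=f-1$, $e_0=g+1$; (ii) if $\ell\nmid[n]$ and $\ell\mid[n-1]$, with $a=v_\ell([n-1])$: $e_a=g-1$, $e_0=f+1$. (B) Suppose $\ell\mid q+1$ and let $a=v_\ell(q+1)$. (i) If $\ell\nmid[n]$, $\ell\mid[n-1]$ (so $n$ is odd) and $\ell\nmid[(n-1)/2]_{q^2}$: $e_{2a}=g$, $e_0=f$. (ii) If $\ell\nmid[n]$, $\ell\mid[n-1]$ and $\ell\mid[(n-1)/2]_{q^2}$, with $b=v_\ell([(n-1)/2]_{q^2})$: $e_{2a+b}=g-1$, $e_{2a}=1$, $e_0=f$. (iii) If $\ell\mid[n]$, $\ell\nmid[n-1]$ (so $n$ is even), $\ell\nmid[n/2]_{q^2}$ and $\ell\nmid\lfloor\frac{n-1}{2}\rfloor$: $e_{2a}=f-1$, $e_a=g-f+2$,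 $e_0=f-1$. (iv) If $\ell\mid[n]$, $\ell\nmid[n-1]$ and $\ell\mid[n/2]_{q^2}$, with $b=v_\ell([n/2]_{q^2})$: $e_{2a+b}=f-1$, $e_a=g-f+2$, $e_0=f-1$. (v) If $\ell\mid[n]$, $\ell\nmid[n-1]$, $\ell\nmid[n/2]_{q^2}$ and $\ell\mid\lfloor\frac{n-1}{2}\rfloor$: $e_{2a}=f-1$, $e_a=g-f+2$, $e_0=f-1$.
   Context: Let $p$ be a prime, $q=p^t$ with $t\ge1$, $n\ge4$, and $V$ an $n$-dimensional vector space over $\mathbb F_q$. Notation: $[m]=\frac{q^m-1}{q-1}$, $[m]_{q^2}=\frac{q^{2m}-1}{q^2-1}$, and $\left[\begin{smallmatrix}m\\k\end{smallmatrix}\right]_q$ is the number of $k$-dimensional subspaces of $\mathbb F_q^m$; $v_\ell$ is the $\ell$-adic valuation. The Grassmann graph $\Gamma'$ has as vertices the $2$-dimensional subspaces of $V$, two distinct ones being adjacent when their intersection is nonzero. If $A'$ is its adjacency matrix and $k'$ its valency, $L'=k'I-A'$. The critical group $K(\Gamma')$ is the torsion subgroup of the cokernel of $L'$ over $\mathbb Z$. The multiplicity of $\ell^i$ as an elementary divisor of an integer matrix is the number of nonzero diagonal entries of its Smith normal form whose $\ell$-adic valuation is exactly $i$ (zero diagonal entries are not counted). -}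

module Defs where

open import Algebra.Bundles using (AbelianGroup; CommutativeRing)
import Algebra.Construct.Pointwise as Pointwise
import Algebra.Properties.AbelianGroup as AbelianGroupProperties
import Algebra.Properties.CommutativeMonoid.Mult as Mult
import Algebra.Properties.Semiring.Sum as Sum
open import Data.Bool.Base using (if_then_else_)
open import Data.Fin.Base using (Fin; zero; suc; toℕ)
open import Data.Fin.Properties using (any?) renaming (_≟_ to _≟ᶠ_)
open import Data.Integer.Base as ℤ using (ℤ; +_; 0ℤ; 1ℤ)
import Data.Integer.Properties as ℤ
open import Data.List.Base using (List; length; filter; allFin)
open import Data.List.Membership.Propositional using (_∉_)
open import Data.Nat.Base as ℕ using (ℕ; zero; suc; 2+; _^_; _∸_; _/_; NonZero)
open import Data.Nat.Divisibility using (_∣_; _∤_; _∣?_)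
open import Data.Nat.Properties using (m*n≢0)
open import Data.Product.Base using (Σ; ∃; _×_; _,_; proj₁; proj₂)
open import Data.Vec.Functional using (Vector; []; _∷_; head; tail)
import Data.Vec.Functional.Relation.Binary.Equality.Setoid as VecEquality
open import Function.Base using (_∘_)
open import Function.Bundles using (Inverse)
open import Level using (Level; _⊔_) renaming (suc to lsuc)
open import Relation.Binary.Bundles using (Setoid)
open import Relation.Binary.Core using (Rel)
open import Relation.Binary.Definitions using (_Respects_)
open import Relation.Binary.PropositionalEquality
  using (_≡_; refl; sym; trans; cong; cong₂; setoid; module ≡-Reasoning)
open import Relation.Nullary.Decidable
  using (Dec; yes; no; map′; ¬?; _×-dec_; decidable-stable; ⌊_⌋)
open import Relation.Nullary.Negation using (¬_)
open import Relation.Unary using (Pred; Decidable; _≐_)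
open import Relation.Unary.Properties using (≐-refl; ≐-sym; ≐-trans)

private
  variable
    a b c r : Level

HasSize : Setoid a b → ℕ → Set (a ⊔ b)
HasSize S m = Inverse (setoid (Fin m)) S

------------------------------------------------------------------------
-- Arithmetic

-- (q ^ m - 1) / (q - 1); the division is exact. Meaningful for q ≥ 2 only,
-- the value at q = 0, 1 is a placeholder.
qNumber : (q m : ℕ) → ℕ
qNumber q@(2+ s) m = (q ^ m ∸ 1) / suc s
qNumber _        _ = 0

-- The ℓ-adic valuation of x is i. It holds for no i when x is 0.
Valuation : (ℓ x i : ℕ) → Set
Valuation ℓ x i = (ℓ ^ i ∣ x) × (ℓ ^ suc i ∤ x)

valuation? : ∀ ℓ x i → Dec (Valuation ℓ x i)
valuation? ℓ x i = (ℓ ^ i ∣? x) ×-dec ¬? (ℓ ^ suc i ∣? x)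

_VanishesOff_ : (ℕ → ℕ) → List ℕ → Set
e VanishesOff is = ∀ i → i ∉ is → e i ≡ 0

------------------------------------------------------------------------
-- Fields and subspaces of F ^ n

-- The standard library's HeytingField carries an apartness relation, which is
-- redundant for finite fields.
record IsField (F : CommutativeRing c r) : Set (c ⊔ r) where
  open CommutativeRing F
  field
    0≉1     : ¬ (0# ≈ 1#)
    inverse : ∀ x → ¬ (x ≈ 0#) → ∃ λ y → x * y ≈ 1#

module LinearAlgebra (F : CommutativeRing c r) where
  open CommutativeRing F
    using (_≈_; _+_; _*_; 0#; semiring; reflexive; *-congʳ)
    renaming (Carrier to K; setoid to K-setoid; refl to ≈-refl; sym to ≈-sym; trans to ≈-trans)
  open Sum semiring using (sum-syntax)
  open VecEquality K-setoid public using (_≋_; ≋-refl; ≋-sym; ≋-trans)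

  𝟎 : ∀ {n} → Vector K n
  𝟎 _ = 0#

  linComb : ∀ {k n} → Vector K k → Vector (Vector K n) k → Vector K n
  linComb {k} x v j = ∑[ i < k ] (x i * v i j)

  record Subspace (n : ℕ) : Set (lsuc (c ⊔ r)) where
    field
      Member   : Pred (Vector K n) (c ⊔ r)
      resp     : Member Respects _≋_
      𝟎-closed : Member 𝟎
      +-closed : ∀ {v w} → Member v → Member w → Member (λ j → v j + w j)
      *-closed : ∀ x {v} → Member v → Member (λ j → x * v j)

  open Subspace public

  LinearlyIndependent : ∀ {k n} → Vector (Vector K n) k → Set (c ⊔ r)
  LinearlyIndependent v = ∀ x → linComb x v ≋ 𝟎 → ∀ i → x i ≈ 0#

  record Basis {n} (W : Subspace n) (k : ℕ) : Set (c ⊔ r) where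
    field
      vectors     : Vector (Vector K n) k
      inside      : ∀ i → Member W (vectors i)
      independent : LinearlyIndependent vectors
      spanning    : ∀ {w} → Member W w → ∃ λ x → linComb x vectors ≋ w

  -- Two subspaces are equal when they have the same members, whatever bases
  -- witness their dimension.
  Subspaces : (k n : ℕ) → Setoid (lsuc (c ⊔ r)) (c ⊔ r)
  Subspaces k n = record
    { Carrier       = Σ (Subspace n) λ W → Basis W k
    ; _≈_           = λ U W → Member (proj₁ U) ≐ Member (proj₁ W)
    ; isEquivalence = record { refl = ≐-refl ; sym = ≐-sym ; trans = ≐-trans }
    }

  Grassmann-Adj : ∀ {k n} → Rel (Setoid.Carrier (Subspaces k n)) (c ⊔ r)
  Grassmann-Adj {k} {n} U@(U′ , _) W@(W′ , _) =
    ¬ (Setoid._≈_ (Subspaces k n) U W) ×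
    ∃ λ v → (Member U′ v × Member W′ v) × ¬ (v ≋ 𝟎)

  module Finite {m : ℕ} (size : HasSize K-setoid m) where
    open Inverse size using (to; from; from-cong; strictlyInverseˡ)

    _≈?_ : ∀ x y → Dec (x ≈ y)
    x ≈? y = map′
      (λ eq → ≈-trans (≈-sym (strictlyInverseˡ x))
               (≈-trans (reflexive (cong to eq)) (strictlyInverseˡ y)))
      from-cong
      (from x ≟ᶠ from y)

    ∃-scalar? : ∀ {P : Pred K a} → P Respects _≈_ → Decidable P → Dec (∃ P)
    ∃-scalar? P-resp P? = map′
      (λ (i , Pi) → to i , Pi)
      (λ (x , Px) → from x , P-resp (≈-sym (strictlyInverseˡ x)) Px)
      (any? (P? ∘ to))

    ∃-vector? : ∀ {n} {P : Pred (Vector K n) a} → P Respects _≋_ → Decidable P → Dec (∃ P)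
    ∃-vector? {n = zero} P-resp P? = map′
      (λ P[] → [] , P[])
      (λ (_ , Pv) → P-resp (λ ()) Pv)
      (P? [])
    ∃-vector? {n = suc n} P-resp P? = map′
      (λ (x , v , Pxv) → (x ∷ v) , Pxv)
      (λ (v , Pv) → head v , tail v , P-resp (λ { zero → ≈-refl ; (suc _) → ≈-refl }) Pv)
      (∃-scalar?
        (λ x≈y (v , Pxv) → v , P-resp (λ { zero → x≈y ; (suc _) → ≈-refl }) Pxv)
        (λ x → ∃-vector?
          (λ v≋w → P-resp (λ { zero → ≈-refl ; (suc i) → v≋w i }))
          (λ v → P? (x ∷ v))))

    _≋?_ : ∀ {n} (v w : Vector K n) → Dec (v ≋ w)
    _≋?_ {zero}  v w = yes λ ()
    _≋?_ {suc n} v w = map′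
      (λ { (h , t) zero → h ; (h , t) (suc i) → t i })
      (λ v≋w → v≋w zero , v≋w ∘ suc)
      ((head v ≈? head w) ×-dec (tail v ≋? tail w))

    module _ {k n : ℕ} where
      private
        linComb-cong : {x y : Vector K k} {v : Vector (Vector K n) k} →
                       x ≋ y → linComb x v ≋ linComb y v
        linComb-cong x≋y j = Sum.sum-cong-≋ semiring (λ i → *-congʳ (x≋y i))

      member? : ((W , _) : Setoid.Carrier (Subspaces k n)) → Decidable (Member W)
      member? (W , B) w = map′
        (λ (x , eq) → resp W eq (combination x))
        spanning
        (∃-vector? (λ x≋y eq → ≋-trans (≋-sym (linComb-cong x≋y)) eq)
                   (λ x → linComb x vectors ≋? w))
        where
        open Basis B
        sums : ∀ {l} (x : Vector K l) (v : Vector (Vector K n) l) →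
               (∀ i → Member W (v i)) → Member W (linComb x v)
        sums {zero}  x v v∈W = 𝟎-closed W
        sums {suc l} x v v∈W =
          +-closed W (*-closed W (x zero) (v∈W zero)) (sums (tail x) (tail v) (v∈W ∘ suc))
        combination : ∀ x → Member W (linComb x vectors)
        combination x = sums x vectors inside

      ⊆? : (U W : Setoid.Carrier (Subspaces k n)) →
           Dec (∀ {v} → Member (proj₁ U) v → Member (proj₁ W) v)
      ⊆? U@(U′ , _) W@(W′ , _) = map′
        (λ none {v} v∈U → decidable-stable (member? W v) (λ v∉W → none (v , v∈U , v∉W)))
        (λ U⊆W (v , v∈U , v∉W) → v∉W (U⊆W v∈U))
        (¬? (∃-vector?
          (λ v≋w (v∈U , v∉W) → resp U′ v≋w v∈U , λ w∈W → v∉W (resp W′ (≋-sym v≋w) w∈W))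
          (λ v → member? U v ×-dec ¬? (member? W v))))

      grassmann-adj? : (U W : Setoid.Carrier (Subspaces k n)) → Dec (Grassmann-Adj U W)
      grassmann-adj? U@(U′ , _) W@(W′ , _) =
        ¬? (⊆? U W ×-dec ⊆? W U) ×-dec
        ∃-vector?
          (λ v≋w ((v∈U , v∈W) , v≢𝟎) →
            (resp U′ v≋w v∈U , resp W′ v≋w v∈W) , λ w≋𝟎 → v≢𝟎 (≋-trans v≋w w≋𝟎))
          (λ v → (member? U v ×-dec member? W v) ×-dec ¬? (v ≋? 𝟎))

------------------------------------------------------------------------
-- Integer matrices

open Sum ℤ.+-*-semiring using (sum; sum-syntax; sum-cong-≗; ∑-distrib-+; *-distribˡ-sum)

Matrix : ℕ → ℕ → Set
Matrix m n = Fin m → Fin n → ℤ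

infixl 7 _⊗_

_⊗_ : ∀ {l m n} → Matrix l m → Matrix m n → Matrix l n
_⊗_ {m = m} A B i j = ∑[ s < m ] (A i s ℤ.* B s j)

diagonal : ∀ {n} → Vector ℤ n → Matrix n n
diagonal d i j = if ⌊ i ≟ᶠ j ⌋ then d i else 0ℤ

𝟙 : ∀ {n} → Matrix n n
𝟙 = diagonal (λ _ → 1ℤ)

infix 4 _≈ᴹ_

_≈ᴹ_ : ∀ {m n} → Rel (Matrix m n) _
A ≈ᴹ B = ∀ i j → A i j ≡ B i j

record SmithNormalForm {n} (M : Matrix n n) : Set where
  field
    P P⁻¹ Q Q⁻¹ : Matrix n n
    P-inverseˡ  : P⁻¹ ⊗ P ≈ᴹ 𝟙
    P-inverseʳ  : P ⊗ P⁻¹ ≈ᴹ 𝟙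
    Q-inverseˡ  : Q⁻¹ ⊗ Q ≈ᴹ 𝟙
    Q-inverseʳ  : Q ⊗ Q⁻¹ ≈ᴹ 𝟙
    d           : Vector ℕ n
    smith       : P ⊗ M ⊗ Q ≈ᴹ diagonal (λ i → + d i)
    divides     : ∀ i j → toℕ i ℕ.≤ toℕ j → d i ∣ d j

-- Zero diagonal entries are not counted, as they have no valuation.
multiplicity : ∀ {n} {M : Matrix n n} → SmithNormalForm M → (ℓ i : ℕ) → ℕ
multiplicity {n} S ℓ i = length (filter (λ j → valuation? ℓ (d j) i) (allFin n))
  where open SmithNormalForm S

------------------------------------------------------------------------
-- Cokernel and torsion subgroup

apply : ∀ {m n} → Matrix m n → Vector ℤ n → Vector ℤ m
apply {n = n} M z i = ∑[ j < n ] (M i j ℤ.* z j)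

module _ {m n : ℕ} (M : Matrix m n) where
  private
    apply-+ : ∀ y z i → apply M (λ j → y j ℤ.+ z j) i ≡ apply M y i ℤ.+ apply M z i
    apply-+ y z i = trans
      (sum-cong-≗ (λ j → ℤ.*-distribˡ-+ (M i j) (y j) (z j)))
      (∑-distrib-+ (λ j → M i j ℤ.* y j) (λ j → M i j ℤ.* z j))

    apply-0 : ∀ i → apply M (λ _ → 0ℤ) i ≡ 0ℤ
    apply-0 i = trans (sum-cong-≗ (λ j → trans (ℤ.*-zeroʳ (M i j)) (sym (ℤ.*-zeroˡ 0ℤ))))
                      (sym (*-distribˡ-sum 0ℤ (λ (_ : Fin n) → 0ℤ)))

    apply-neg : ∀ z i → apply M (λ j → ℤ.- z j) i ≡ ℤ.- apply M z i
    apply-neg z i = trans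
      (sum-cong-≗ (λ j → trans (sym (ℤ.neg-distribʳ-* (M i j) (z j)))
                               (sym (ℤ.-1*i≡-i (M i j ℤ.* z j)))))
      (trans (sym (*-distribˡ-sum ℤ.-1ℤ (λ j → M i j ℤ.* z j))) (ℤ.-1*i≡-i (apply M z i)))

  -- Congruence modulo the image of M.
  Congruent : Rel (Vector ℤ m) _
  Congruent x y = ∃ λ z → ∀ i → x i ≡ y i ℤ.+ apply M z i

  private
    module ℤᵐ = AbelianGroup (Pointwise.abelianGroup (Fin m) ℤ.+-0-abelianGroup)
    open import Algebra.Properties.CommutativeSemigroup ℤ.+-commutativeSemigroup
      using (interchange)

    pointwise : ∀ {x y} → (∀ i → x i ≡ y i) → Congruent x y
    pointwise {y = y} x≗y = (λ _ → 0ℤ) , λ i →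
      trans (x≗y i) (sym (trans (cong (λ w → y i ℤ.+ w) (apply-0 i)) (ℤ.+-identityʳ (y i))))

    congruent-sym : ∀ {x y} → Congruent x y → Congruent y x
    congruent-sym {x} {y} (z , eq) = (λ j → ℤ.- z j) , λ i → begin
      y i                                                        ≡⟨ ℤ.+-identityʳ (y i) ⟨
      y i ℤ.+ 0ℤ                                                 ≡⟨ cong (λ w → y i ℤ.+ w) (ℤ.+-inverseʳ (apply M z i)) ⟨
      y i ℤ.+ (apply M z i ℤ.- apply M z i)                      ≡⟨ ℤ.+-assoc (y i) _ _ ⟨
      y i ℤ.+ apply M z i ℤ.- apply M z i                        ≡⟨ cong₂ ℤ._+_ (eq i) (apply-neg z i) ⟨
      x i ℤ.+ apply M (λ j → ℤ.- z j) i                          ∎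
      where open ≡-Reasoning

    congruent-trans : ∀ {x y w} → Congruent x y → Congruent y w → Congruent x w
    congruent-trans {x} {y} {w} (z , eq) (z′ , eq′) = (λ j → z′ j ℤ.+ z j) , λ i → begin
      x i                                              ≡⟨ eq i ⟩
      y i ℤ.+ apply M z i                              ≡⟨ cong (ℤ._+ apply M z i) (eq′ i) ⟩
      w i ℤ.+ apply M z′ i ℤ.+ apply M z i             ≡⟨ ℤ.+-assoc (w i) _ _ ⟩
      w i ℤ.+ (apply M z′ i ℤ.+ apply M z i)           ≡⟨ cong (λ u → w i ℤ.+ u) (apply-+ z′ z i) ⟨
      w i ℤ.+ apply M (λ j → z′ j ℤ.+ z j) i           ∎
      where open ≡-Reasoning

    congruent-+ : ∀ {x x′ y y′} → Congruent x x′ → Congruent y y′ →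
                  Congruent (λ i → x i ℤ.+ y i) (λ i → x′ i ℤ.+ y′ i)
    congruent-+ {x} {x′} {y} {y′} (z , eq) (z′ , eq′) = (λ j → z j ℤ.+ z′ j) , λ i → trans
      (cong₂ ℤ._+_ (eq i) (eq′ i))
      (trans (interchange (x′ i) _ (y′ i) _) (cong (λ u → x′ i ℤ.+ y′ i ℤ.+ u) (sym (apply-+ z z′ i))))

    congruent-neg : ∀ {x y} → Congruent x y → Congruent (λ i → ℤ.- x i) (λ i → ℤ.- y i)
    congruent-neg {x} {y} (z , eq) = (λ j → ℤ.- z j) , λ i → trans
      (cong ℤ.-_ (eq i))
      (trans (ℤ.neg-distrib-+ (y i) _) (cong (λ u → ℤ.- y i ℤ.+ u) (sym (apply-neg z i))))

  cokernel : AbelianGroup _ _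
  cokernel = record
    { Carrier = Vector ℤ m
    ; _≈_     = Congruent
    ; _∙_     = λ x y i → x i ℤ.+ y i
    ; ε       = λ _ → 0ℤ
    ; _⁻¹     = λ x i → ℤ.- x i
    ; isAbelianGroup = record
      { isGroup = record
        { isMonoid = record
          { isSemigroup = record
            { isMagma = record
              { isEquivalence = record
                { refl  = pointwise (λ _ → refl)
                ; sym   = λ {x} {y} → congruent-sym {x} {y}
                ; trans = λ {x} {y} {w} → congruent-trans {x} {y} {w}
                }
              ; ∙-cong = λ {x} {x′} {y} {y′} → congruent-+ {x} {x′} {y} {y′}
              }
            ; assoc = λ x y z → pointwise (ℤᵐ.assoc x y z)
            }
          ; identity = (λ x → pointwise (ℤᵐ.identityˡ x)) , (λ x → pointwise (ℤᵐ.identityʳ x))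
          }
        ; inverse = (λ x → pointwise (ℤᵐ.inverseˡ x)) , (λ x → pointwise (ℤᵐ.inverseʳ x))
        ; ⁻¹-cong = λ {x} {y} → congruent-neg {x} {y}
        }
      ; comm = λ x y → pointwise (ℤᵐ.comm x y)
      }
    }

module _ (G : AbelianGroup a b) where
  private
    module G = AbelianGroup G
  open G using (_∙_; _⁻¹; ε; _≈_)
  open Mult G.commutativeMonoid using (×-distrib-+; ×-assocˡ; ×-congʳ; ×-congˡ)
    renaming (_×_ to _·_)
  open AbelianGroupProperties G using (⁻¹-∙-comm; ε⁻¹≈ε)

  IsTorsion : Pred G.Carrier b
  IsTorsion x = ∃ λ k → NonZero k × (k · x ≈ ε)

  private
    ·-ε : ∀ k → k · ε ≈ ε
    ·-ε zero    = G.refl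
    ·-ε (suc k) = G.trans (G.identityˡ _) (·-ε k)

    ·-⁻¹ : ∀ k x → k · (x ⁻¹) ≈ (k · x) ⁻¹
    ·-⁻¹ zero    x = G.sym ε⁻¹≈ε
    ·-⁻¹ (suc k) x = G.trans (G.∙-congˡ (·-⁻¹ k x)) (⁻¹-∙-comm x (k · x))

    kill : ∀ k l {x} → l · x ≈ ε → (k ℕ.* l) · x ≈ ε
    kill k l {x} eq = G.trans (G.sym (×-assocˡ x k l)) (G.trans (×-congʳ k eq) (·-ε k))

    ε-torsion : IsTorsion ε
    ε-torsion = 1 , _ , ·-ε 1

    ∙-torsion : ∀ {x y} → IsTorsion x → IsTorsion y → IsTorsion (x ∙ y)
    ∙-torsion {x} {y} (k , k≢0 , kx) (l , l≢0 , ly) =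
      k ℕ.* l , m*n≢0 k l {{k≢0}} {{l≢0}} ,
      G.trans (×-distrib-+ x y (k ℕ.* l))
        (G.trans (G.∙-cong (G.trans (×-congˡ (ℕ-comm k l)) (kill l k kx)) (kill k l ly))
                 (G.identityˡ ε))
      where open import Data.Nat.Properties using () renaming (*-comm to ℕ-comm)

    ⁻¹-torsion : ∀ {x} → IsTorsion x → IsTorsion (x ⁻¹)
    ⁻¹-torsion {x} (k , k≢0 , kx) =
      k , k≢0 , G.trans (·-⁻¹ k x) (G.trans (G.⁻¹-cong kx) ε⁻¹≈ε)

  -- The equality is that of G and ignores the torsion witnesses.
  torsionSubgroup : AbelianGroup (a ⊔ b) b
  torsionSubgroup = record
    { Carrier = Σ G.Carrier IsTorsion
    ; _≈_     = λ x y → proj₁ x ≈ proj₁ y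
    ; _∙_     = λ (x , tx) (y , ty) → x ∙ y , ∙-torsion tx ty
    ; ε       = ε , ε-torsion
    ; _⁻¹     = λ (x , tx) → x ⁻¹ , ⁻¹-torsion tx
    ; isAbelianGroup = record
      { isGroup = record
        { isMonoid = record
          { isSemigroup = record
            { isMagma = record
              { isEquivalence = record { refl = G.refl ; sym = G.sym ; trans = G.trans }
              ; ∙-cong = G.∙-cong
              }
            ; assoc = λ x y z → G.assoc (proj₁ x) (proj₁ y) (proj₁ z)
            }
          ; identity = (λ x → G.identityˡ (proj₁ x)) , (λ x → G.identityʳ (proj₁ x))
          }
        ; inverse = (λ x → G.inverseˡ (proj₁ x)) , (λ x → G.inverseʳ (proj₁ x))
        ; ⁻¹-cong = G.⁻¹-cong
        }
      ; comm = λ x y → G.comm (proj₁ x) (proj₁ y)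
      }
    }

-- For the Laplacian matrix of a graph.
criticalGroup : ∀ {n} → Matrix n n → AbelianGroup _ _
criticalGroup L = torsionSubgroup (cokernel L)

------------------------------------------------------------------------
-- The Grassmann graph on the 2-dimensional subspaces of F ^ n

-- The enumeration of the vertices fixes the row and column order of the
-- matrices; N is the Gaussian binomial coefficient [n choose 2] at q = |F|.
module GrassmannGraph
  (F : CommutativeRing c r) {m : ℕ} (size : HasSize (CommutativeRing.setoid F) m)
  (n : ℕ) {N : ℕ} (vertices : HasSize (LinearAlgebra.Subspaces F 2 n) N)
  where

  open LinearAlgebra F
  open Finite size
  open Inverse vertices using (to)

  Adj : Rel (Fin N) _
  Adj i j = Grassmann-Adj (to i) (to j)

  adj? : ∀ i j → Dec (Adj i j)
  adj? i j = grassmann-adj? (to i) (to j)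

  adjacencyMatrix : Matrix N N
  adjacencyMatrix i j = if ⌊ adj? i j ⌋ then 1ℤ else 0ℤ

  IsValency : ℕ → Set
  IsValency k = ∀ i → length (filter (adj? i) (allFin N)) ≡ k

  -- k I - A; this is the Laplacian of the graph when k is its valency.
  laplacian : ℕ → Matrix N N
  laplacian k i j = + k ℤ.* 𝟙 i j ℤ.- adjacencyMatrix i j

{-# OPTIONS --safe #-}

-- Let W be the line-point incidence matrix of the projective space, with
-- v = [n] points. Then L = s - W Wᵀ with s = (q + 1) [n-1], while
-- Wᵀ W = c + J with c + v = s, and W, Wᵀ have constant row sums. Hence
-- L W y = v W y on vectors y of sum zero, and L (v + s - L) = v s on vectors
-- of sum zero.
--
-- The multiplicities are the jumps of rank i, the number of elementary divisors
-- not divisible by ℓ^(i+1). An integer system with fewer equations than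
-- unknowns has a solution that is not divisible by ℓ. So if some linear Y into
-- ℤᴺ and l extra equations force every solution of L Y y ≡ 0 mod ℓ^(i+1) to be
-- divisible by ℓ, then rank i + l is at least the number of unknowns; upper bounds
-- for rank i arise dually. All the required Y are built from W, except when ℓ
-- divides both q + 1 and [n]: then Wᵀ W ≡ J mod ℓ, and one uses a matrix X with
-- X W = q (1 - 𝟏 e₀ᵀ). Its rows are differences of two pencils of lines in a
-- plane, with centres at two given points.
--
-- The critical group is killed by v s, and the order of a finite abelian group
-- divides a power of its exponent.

module Submission where

open import Defs
open import Algebra.Bundles using (AbelianGroup; CommutativeRing)
open import Data.Fin.Base using (Fin; zero; suc)
open import Data.Fin.Properties using (all?; ¬∀⟶∃¬) renaming (_≟_ to _≟ᶠ_)
open import Data.Nat.Base as ℕ using (ℕ; zero; suc; _≤_; _<_; _^_; s<s⁻¹; z<s)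
open import Data.Nat.Primality using (Prime; euclidsLemma; prime⇒nonZero; prime⇒nonTrivial)
open import Data.Product.Base using (Σ; ∃; ∃₂; _×_; _,_; proj₁; proj₂)
open import Data.Sum.Base using (_⊎_; inj₁; inj₂)
open import Data.Vec.Functional using (Vector)
open import Function.Base using (_∘_; id)
open import Function.Bundles using (Inverse)
open import Relation.Binary.Bundles using (Setoid)
open import Relation.Binary.PropositionalEquality as ≡ using (_≡_; _≢_; _≗_; cong; cong₂; subst; subst₂)
open import Relation.Nullary.Decidable using (Dec; yes; no; ¬?; _×-dec_; ⌊_⌋)
open import Relation.Nullary.Negation using (¬_; contradiction)

-- `L` has the eigenvalues 0, v, s with multiplicities 1, v - 1, N - v. Eigenvalues that agree
-- modulo ℓ can keep the eigenlattices from splitting the lattice at ℓ, so their valuations alone do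
-- not give the elementary divisors: already 0 and v are mixed when ℓ divides v, which shifts the
-- counts by one. Hence the detour through ranks, each pinned by a matching pair of bounds.
--
-- As a function of i the rank is a staircase. With G = N - v its plateaus are G + 1, N - 1 if ℓ
-- divides v but not q + 1; v, N - 1 if ℓ divides [n-1] but not q + 1; v - 1, then v (only if ℓ
-- divides [(n-1)/2] at q²), then N - 1 if ℓ divides q + 1 and [n-1]; v - 2, G + 1, N - 1 if ℓ
-- divides q + 1 and v. The steps sit at the valuations of v; of s; of (q + 1)² and s; of s and v s,
-- respectively. The top N - 1 is the rational rank, the constants being the kernel. In the last
-- family the valuation b of [n/2] at q² enters only through that of v, and b = 0 is allowed, so
-- that three cases of the theorem become one computation.

module IntegerMatrices where

  import Algebra.Properties.CommutativeMonoid.Mult as Mult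
  open import Data.Bool.Base using (if_then_else_)
  open import Data.Fin.Base using (toℕ; inject₁; fromℕ)
  import Data.Fin.Properties as Fin
  open import Data.Fin.Permutation using (Permutation; permutation)
  open import Data.Integer.Base hiding (_≤_; _<_; _^_; suc)
  open import Data.Integer.Divisibility.Signed
  open import Data.Integer.Properties
  open import Data.Integer.Tactic.RingSolver using (solve-∀)
  open import Algebra.Properties.Semiring.Sum +-*-semiring
    using (sum; sum-syntax; sum-cong-≗; ∑-distrib-+; *-distribˡ-sum; *-distribʳ-sum; ∑-comm;
           sum-replicate-zero; sum-init-last; sum-permute)
  open import Data.List.Base as List using (List; []; _∷_; _++_; length; filter; allFin)
  import Data.List.Properties as List
  open import Data.List.Membership.Propositional using (_∈_)
  open import Data.List.Membership.Propositional.Properties using (∈-filter⁺; ∈-allFin; ∈-tabulate⁺)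
  open import Data.List.Relation.Unary.All as All using (All; []; _∷_)
  import Data.List.Relation.Unary.All.Properties as All
  open import Data.List.Relation.Unary.Any using (here; there)
  import Data.Nat.Divisibility as ℕ
  import Data.Nat.Induction as ℕ
  import Data.Nat.Properties as ℕ
  import Data.Vec.Functional as Vec
  open import Induction.WellFounded using (Acc; acc)
  open import Relation.Binary.Definitions using (tri<; tri≈; tri>)
  open import Relation.Binary.PropositionalEquality using (refl; sym; trans; module ≡-Reasoning)
  open import Level using (Level)
  open import Relation.Unary using (Pred; Decidable)

  -- Homogeneous integer systems and their primitive solutions

  record IsLinear {m} (φ : Vector ℤ m → ℤ) : Set where
    field
      ≗-cong : ∀ {x y} → x ≗ y → φ x ≡ φ y
      +-homo : ∀ x y → φ (λ j → x j + y j) ≡ φ x + φ y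
      *-homo : ∀ a x → φ (λ j → a * x j) ≡ a * φ x

  open IsLinear public

  -- Kept as a function with a linearity proof instead of a coefficient vector, so that composites
  -- such as a coordinate of `Q⁻¹` after `Y` are functionals without any matrix being computed.
  Functional : ℕ → Set
  Functional m = Σ (Vector ℤ m → ℤ) IsLinear

  Kills : ∀ {m} → Vector ℤ m → Functional m → Set
  Kills y (φ , _) = φ y ≡ 0ℤ

  IsLinearMap : ∀ {m n} → (Vector ℤ m → Vector ℤ n) → Set
  IsLinearMap f = ∀ i → IsLinear (λ x → f x i)

  projection : ∀ {m} j → IsLinear {m} (λ x → x j)
  projection j = record { ≗-cong = λ eq → eq j ; +-homo = λ _ _ → refl ; *-homo = λ _ _ → refl }

  id-linear : ∀ {m} → IsLinearMap {m} id
  id-linear = projection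

  module _ {m} {φ ψ : Vector ℤ m → ℤ} (φ-lin : IsLinear φ) (ψ-lin : IsLinear ψ) where

    +-linear : IsLinear (λ x → φ x + ψ x)
    +-linear = record
      { ≗-cong = λ eq → cong₂ _+_ (φ-lin .≗-cong eq) (ψ-lin .≗-cong eq)
      ; +-homo = λ x y → trans (cong₂ _+_ (φ-lin .+-homo x y) (ψ-lin .+-homo x y)) (lemma (φ x) (φ y) (ψ x) (ψ y))
      ; *-homo = λ a x → trans (cong₂ _+_ (φ-lin .*-homo a x) (ψ-lin .*-homo a x)) (sym (*-distribˡ-+ a (φ x) (ψ x)))
      }
      where
      lemma : ∀ a b c d → (a + b) + (c + d) ≡ (a + c) + (b + d)
      lemma = solve-∀

  module _ {m} {φ : Vector ℤ m → ℤ} (φ-lin : IsLinear φ) where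

    *-linear : ∀ k → IsLinear (λ x → k * φ x)
    *-linear k = record
      { ≗-cong = λ eq → cong (k *_) (φ-lin .≗-cong eq)
      ; +-homo = λ x y → trans (cong (k *_) (φ-lin .+-homo x y)) (*-distribˡ-+ k (φ x) (φ y))
      ; *-homo = λ a x → trans (cong (k *_) (φ-lin .*-homo a x)) (lemma k a (φ x))
      }
      where
      lemma : ∀ k a b → k * (a * b) ≡ a * (k * b)
      lemma = solve-∀

    ∘-linear : ∀ {l} {f : Vector ℤ l → Vector ℤ m} → IsLinearMap f → IsLinear (φ ∘ f)
    ∘-linear f-lin = record
      { ≗-cong = λ eq → φ-lin .≗-cong (λ i → f-lin i .≗-cong eq)
      ; +-homo = λ x y → trans (φ-lin .≗-cong (λ i → f-lin i .+-homo x y)) (φ-lin .+-homo _ _)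
      ; *-homo = λ a x → trans (φ-lin .≗-cong (λ i → f-lin i .*-homo a x)) (φ-lin .*-homo a _)
      }

    neg-linear : IsLinear (λ x → - φ x)
    neg-linear = record
      { ≗-cong = λ eq → cong -_ (φ-lin .≗-cong eq)
      ; +-homo = λ x y → trans (cong -_ (φ-lin .+-homo x y)) (neg-distrib-+ (φ x) (φ y))
      ; *-homo = λ a x → trans (cong -_ (φ-lin .*-homo a x)) (neg-distribʳ-* a (φ x))
      }

    linear-0 : φ (λ _ → 0ℤ) ≡ 0ℤ
    linear-0 = φ-lin .*-homo 0ℤ (λ _ → 0ℤ)

    linear-∣ : ∀ {k x} → (∀ j → k ∣ x j) → k ∣ φ x
    linear-∣ {k} {x} k∣x = divides (φ (λ j → k∣x j .quotient)) (begin
      φ x                            ≡⟨ φ-lin .≗-cong (λ j → trans (k∣x j ._∣_.equality) (*-comm _ k)) ⟩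
      φ (λ j → k * k∣x j .quotient)  ≡⟨ φ-lin .*-homo k _ ⟩
      k * φ (λ j → k∣x j .quotient)  ≡⟨ *-comm k _ ⟩
      φ (λ j → k∣x j .quotient) * k  ∎)
      where open ≡-Reasoning

  zero-linear : ∀ {m} → IsLinear {m} (λ _ → 0ℤ)
  zero-linear = record { ≗-cong = λ _ → refl ; +-homo = λ _ _ → refl ; *-homo = λ a _ → sym (*-zeroʳ a) }

  sum-linear : ∀ {m} → IsLinear {m} sum
  sum-linear = record
    { ≗-cong = sum-cong-≗ ; +-homo = ∑-distrib-+ ; *-homo = λ a x → sym (*-distribˡ-sum a x) }

  apply-linear : ∀ {m n} (M : Matrix n m) → IsLinearMap (apply M)
  apply-linear M i = ∘-linear sum-linear (λ j → *-linear (projection j) (M i j))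

  private
    -- Pivot search: `φs′` is `φs` with the pivot removed, so the number of equations drops by
    -- exactly one when the pivot is used to eliminate a variable.
    select : ∀ {m} (φs : List (Functional m)) (e : Vector ℤ m) →
             All (Kills e) φs ⊎
             ∃ λ ((φ , _) : Functional m) → ∃ λ φs′ → φ e ≢ 0ℤ × length φs ≡ suc (length φs′) ×
               (∀ y → φ y ≡ 0ℤ → All (Kills y) φs′ → All (Kills y) φs)
    select [] e = inj₁ []
    select (φ ∷ φs) e with proj₁ φ e ≟ 0ℤ | select φs e
    ... | no φe≢0 | _ = inj₂ (φ , φs , φe≢0 , refl , λ _ → _∷_)
    ... | yes φe≡0 | inj₁ φs≡0 = inj₁ (φe≡0 ∷ φs≡0)
    ... | yes φe≡0 | inj₂ (ψ , φs′ , ψe≢0 , eq , sound) = inj₂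
      (ψ , φ ∷ φs′ , ψe≢0 , cong suc eq , λ { y ψy≡0 (φy≡0 ∷ φs′y≡0) → φy≡0 ∷ sound y ψy≡0 φs′y≡0 })

  -- Eliminates the first coordinate by a functional that does not vanish on
  -- the first unit vector.
  kernel : ∀ {m} (φs : List (Functional m)) → length φs < m →
           ∃ λ y → (∃ λ j → y j ≢ 0ℤ) × All (Kills y) φs
  kernel {suc m} φs k<m with select φs (1ℤ Vec.∷ λ _ → 0ℤ)
  ... | inj₁ φs≡0 = (1ℤ Vec.∷ λ _ → 0ℤ) , (zero , λ ()) , φs≡0
  ... | inj₂ ((φ , φ-lin) , φs′ , c≢0 , eq , sound)
    with kernel (List.map (λ (ψ , ψ-lin) → ψ ∘ ι , ∘-linear ψ-lin ι-linear) φs′)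
                (subst (_< m) (sym (List.length-map _ φs′)) (s<s⁻¹ (subst (_< suc m) eq k<m)))
    where
    c = φ (1ℤ Vec.∷ λ _ → 0ℤ)
    0∷-linear : IsLinearMap {m} (0ℤ Vec.∷_)
    0∷-linear zero    = zero-linear
    0∷-linear (suc j) = projection j
    -- Back substitution without fractions: the pivot `φ` vanishes on every `ι w`, and scaling the
    -- tail by `c` replaces the division of the head by `c`.
    ι : Vector ℤ m → Vector ℤ (suc m)
    ι w = - φ (0ℤ Vec.∷ w) Vec.∷ λ j → c * w j
    ι-linear : IsLinearMap ι
    ι-linear zero    = neg-linear (∘-linear φ-lin 0∷-linear)
    ι-linear (suc j) = *-linear (projection j) c
  ... | w , (j , wj≢0) , φs′≡0 = y , (suc j , yj≢0) , sound y φy≡0 (All.map⁻ φs′≡0)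
    where
    c = φ (1ℤ Vec.∷ λ _ → 0ℤ)
    b = φ (0ℤ Vec.∷ w)
    y = - b Vec.∷ λ j → c * w j
    yj≢0 : c * w j ≢ 0ℤ
    yj≢0 eq with i*j≡0⇒i≡0∨j≡0 c eq
    ... | inj₁ c≡0  = c≢0 c≡0
    ... | inj₂ wj≡0 = wj≢0 wj≡0
    decompose : y ≗ λ j → c * (0ℤ Vec.∷ w) j + (- b) * (1ℤ Vec.∷ λ _ → 0ℤ) j
    decompose zero    = lemma b c
      where
      lemma : ∀ b c → - b ≡ c * 0ℤ + (- b) * 1ℤ
      lemma = solve-∀
    decompose (suc j) = lemma b (c * w j)
      where
      lemma : ∀ b x → x ≡ x + (- b) * 0ℤ
      lemma = solve-∀
    φy≡0 : φ y ≡ 0ℤ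
    φy≡0 = begin
      φ y              ≡⟨ φ-lin .≗-cong decompose ⟩
      _                ≡⟨ φ-lin .+-homo _ _ ⟩
      _                ≡⟨ cong₂ _+_ (φ-lin .*-homo c _) (φ-lin .*-homo (- b) _) ⟩
      c * b + - b * c  ≡⟨ lemma c b ⟩
      0ℤ               ∎
      where
      open ≡-Reasoning
      lemma : ∀ c b → c * b + - b * c ≡ 0ℤ
      lemma = solve-∀

  module _ {ℓ : ℕ} (ℓ-prime : Prime ℓ) where
    private
      instance
        ℓ≢0 = prime⇒nonZero ℓ-prime
        ℓ≢1 = prime⇒nonTrivial ℓ-prime

    ∣*⇒∣ : ∀ {a b} → + ℓ ∣ a * b → (+ ℓ ∣ a) ⊎ (+ ℓ ∣ b)
    ∣*⇒∣ {a} {b} ℓ∣ab with euclidsLemma ∣ a ∣ ∣ b ∣ ℓ-prime (subst (ℓ ℕ.∣_) (abs-* a b) (∣⇒∣ᵤ ℓ∣ab))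
    ... | inj₁ ℓ∣a = inj₁ (∣ᵤ⇒∣ ℓ∣a)
    ... | inj₂ ℓ∣b = inj₂ (∣ᵤ⇒∣ ℓ∣b)

    -- Factors ℓ are cancelled from `a` one at a time, each lowering `i`. They run out before `i`
    -- reaches 0, since ℓ^0 divides everything, so at least one factor is left for `b`.
    ^∣*⇒∣ : ∀ i a {b} → + (ℓ ^ i) ∣ a * b → ¬ (+ (ℓ ^ i) ∣ a) → + ℓ ∣ b
    ^∣*⇒∣ zero    a      _     ∤a = contradiction (divides a (sym (*-identityʳ a))) ∤a
    ^∣*⇒∣ (suc i) a {b} ∣ab ∤a with ∣*⇒∣ {a} {b} (∣-trans ℓ∣ℓ^ ∣ab)
      where
      ℓ∣ℓ^ : + ℓ ∣ + (ℓ ^ suc i)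
      ℓ∣ℓ^ = ∣ᵤ⇒∣ (ℕ.m∣m*n (ℓ ^ i))
    ... | inj₂ ℓ∣b = ℓ∣b
    ... | inj₁ (divides a′ refl) = ^∣*⇒∣ i a′ {b}
      (*-cancelˡ-∣ (+ ℓ) (subst₂ _∣_ (pos-* ℓ _) (lemma a′ (+ ℓ) b) ∣ab))
      (λ ∣a′ → ∤a (subst₂ _∣_ (sym (pos-* ℓ _)) (*-comm (+ ℓ) a′) (*-monoʳ-∣ (+ ℓ) ∣a′)))
      where
      lemma : ∀ a l b → a * l * b ≡ l * (a * b)
      lemma = solve-∀

    -- Nonzero modulo ℓ: the kind of nontriviality that a congruence argument can refute.
    Primitive : ∀ {m} → Vector ℤ m → Set
    Primitive y = ¬ (∀ j → + ℓ ∣ y j)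

    -- The equations are homogeneous, so a common factor ℓ can be divided out of a nonzero solution.
    -- This stops, as the absolute value of one fixed nonzero coordinate decreases.
    primitive-kernel : ∀ {m} (φs : List (Functional m)) → length φs < m →
                       ∃ λ y → Primitive y × All (Kills y) φs
    primitive-kernel φs k<m with kernel φs k<m
    ... | y , (j , yj≢0) , φs≡0 = go y yj≢0 φs≡0 (ℕ.<-wellFounded ∣ y j ∣)
      where
      go : ∀ y → y j ≢ 0ℤ → All (Kills y) φs → Acc _<_ ∣ y j ∣ → ∃ λ y → Primitive y × All (Kills y) φs
      go y yj≢0 φs≡0 (acc smaller) with all? (λ i → + ℓ ∣? y i)
      ... | no ∤y = y , ∤y , φs≡0
      ... | yes ℓ∣y = go y′ y′j≢0 (All.map (λ {φ} → kills {φ}) φs≡0) (smaller decreasing)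
        where
        y′ : Vector ℤ _
        y′ i = ℓ∣y i .quotient
        y≡ : ∀ i → y i ≡ + ℓ * y′ i
        y≡ i = trans (ℓ∣y i ._∣_.equality) (*-comm (y′ i) (+ ℓ))
        y′j≢0 : y′ j ≢ 0ℤ
        y′j≢0 eq = yj≢0 (trans (y≡ j) (trans (cong (+ ℓ *_) eq) (*-zeroʳ (+ ℓ))))
        kills : ∀ {φ} → Kills y φ → Kills y′ φ
        kills {φ , φ-lin} φy≡0 = *-cancelˡ-≡ (+ ℓ) _ _ (begin
          + ℓ * φ y′               ≡⟨ φ-lin .*-homo (+ ℓ) y′ ⟨
          φ (λ i → + ℓ * y′ i)     ≡⟨ φ-lin .≗-cong y≡ ⟨
          φ y                      ≡⟨ φy≡0 ⟩
          0ℤ                       ≡⟨ *-zeroʳ (+ ℓ) ⟨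
          + ℓ * 0ℤ                 ∎)
          where open ≡-Reasoning
        decreasing : ∣ y′ j ∣ < ∣ y j ∣
        decreasing = subst (∣ y′ j ∣ <_) (sym (trans (cong ∣_∣ (y≡ j)) (trans (abs-* (+ ℓ) (y′ j)) (ℕ.*-comm ℓ _))))
          (ℕ.m<m*n ∣ y′ j ∣ ℓ {{≢-nonZero y′j≢0}} (ℕ.nonTrivial⇒n>1 ℓ))

  -- Action of matrices on integer vectors, and filtered lengths

  δ : ∀ {n} → Fin n → Vector ℤ n
  δ i j = 𝟙 i j

  diagonal-refl : ∀ {n} (d : Vector ℤ n) i → diagonal d i i ≡ d i
  diagonal-refl d i with i ≟ᶠ i
  ... | yes _  = refl
  ... | no i≢i = contradiction refl i≢i

  diagonal-≢ : ∀ {n} (d : Vector ℤ n) {i j} → i ≢ j → diagonal d i j ≡ 0ℤ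
  diagonal-≢ d {i} {j} i≢j with i ≟ᶠ j
  ... | yes i≡j = contradiction i≡j i≢j
  ... | no _    = refl

  diagonal-suc : ∀ {n} (d : Vector ℤ (suc n)) i j → diagonal d (suc i) (suc j) ≡ diagonal (d ∘ suc) i j
  diagonal-suc d i j with i ≟ᶠ j
  ... | yes _ = refl
  ... | no _  = refl

  apply-diagonal : ∀ {n} (d z : Vector ℤ n) → apply (diagonal d) z ≗ λ i → d i * z i
  apply-diagonal {suc n} d z zero    = begin
    d zero * z zero + ∑[ j < n ] (0ℤ * z (suc j))  ≡⟨ cong (λ x → d zero * z zero + x) (sum-replicate-zero n) ⟩
    d zero * z zero + 0ℤ                           ≡⟨ +-identityʳ _ ⟩
    d zero * z zero                                ∎
    where open ≡-Reasoning
  apply-diagonal {suc n} d z (suc i) = begin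
    0ℤ + ∑[ j < n ] (diagonal d (suc i) (suc j) * z (suc j))       ≡⟨ +-identityˡ _ ⟩
    ∑[ j < n ] (diagonal d (suc i) (suc j) * z (suc j))            ≡⟨ sum-cong-≗ (λ j → cong (_* z (suc j)) (diagonal-suc d i j)) ⟩
    apply (diagonal (d ∘ suc)) (z ∘ suc) i                         ≡⟨ apply-diagonal (d ∘ suc) (z ∘ suc) i ⟩
    d (suc i) * z (suc i)                                          ∎
    where open ≡-Reasoning

  apply-𝟙 : ∀ {n} (z : Vector ℤ n) → apply 𝟙 z ≗ z
  apply-𝟙 z i = trans (apply-diagonal (λ _ → 1ℤ) z i) (*-identityˡ (z i))

  apply-≈ᴹ : ∀ {m n} {A B : Matrix m n} → A ≈ᴹ B → ∀ z → apply A z ≗ apply B z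
  apply-≈ᴹ A≈B z i = sum-cong-≗ (λ j → cong (_* z j) (A≈B i j))

  apply-⊗ : ∀ {l m n} (A : Matrix l m) (B : Matrix m n) z → apply (A ⊗ B) z ≗ apply A (apply B z)
  apply-⊗ {m = m} {n} A B z i = begin
    ∑[ j < n ] ((∑[ s < m ] (A i s * B s j)) * z j)   ≡⟨ sum-cong-≗ (λ j → *-distribʳ-sum (z j) (λ s → A i s * B s j)) ⟩
    ∑[ j < n ] ∑[ s < m ] (A i s * B s j * z j)       ≡⟨ ∑-comm (λ j s → A i s * B s j * z j) ⟩
    ∑[ s < m ] ∑[ j < n ] (A i s * B s j * z j)       ≡⟨ sum-cong-≗ (λ s → sum-cong-≗ (λ j → *-assoc (A i s) (B s j) (z j))) ⟩
    ∑[ s < m ] ∑[ j < n ] (A i s * (B s j * z j))     ≡⟨ sum-cong-≗ (λ s → *-distribˡ-sum (A i s) (λ j → B s j * z j)) ⟨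
    ∑[ s < m ] (A i s * apply B z s)                  ∎
    where open ≡-Reasoning

  module _ {a p : Level} {A : Set a} where

    length-filter-¬ : ∀ {P : Pred A p} (P? : Decidable P) xs →
                      length (filter (¬? ∘ P?) xs) ℕ.+ length (filter P? xs) ≡ length xs
    length-filter-¬ P? [] = refl
    length-filter-¬ P? (x ∷ xs) with P? x
    ... | yes _ = trans (ℕ.+-suc _ _) (cong suc (length-filter-¬ P? xs))
    ... | no _  = cong suc (length-filter-¬ P? xs)

    length-filter-⊎ : ∀ {q r} {P : Pred A p} {Q : Pred A q} {R : Pred A r}
                      (P? : Decidable P) (Q? : Decidable Q) (R? : Decidable R) →
                      (∀ {x} → P x → ¬ Q x) → (∀ {x} → P x → R x) → (∀ {x} → Q x → R x) →
                      (∀ {x} → R x → ¬ Q x → P x) → ∀ xs →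
                      length (filter P? xs) ℕ.+ length (filter Q? xs) ≡ length (filter R? xs)
    length-filter-⊎ P? Q? R? PQ PR QR RP = go
      where
      go : ∀ xs → length (filter P? xs) ℕ.+ length (filter Q? xs) ≡ length (filter R? xs)
      go [] = refl
      go (x ∷ xs) with P? x | Q? x | R? x
      ... | yes p | yes q | _     = contradiction q (PQ p)
      ... | yes p | no _  | yes _ = cong suc (go xs)
      ... | yes p | no _  | no ¬r = contradiction (PR p) ¬r
      ... | no _  | yes q | yes _ = trans (ℕ.+-suc _ _) (cong suc (go xs))
      ... | no _  | yes q | no ¬r = contradiction (QR q) ¬r
      ... | no ¬p | no ¬q | yes r = contradiction (RP r ¬q) ¬p
      ... | no _  | no _  | no _  = go xs

  -- Ranks modulo prime powers, read off a Smith normal form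

  module SmithRank {N} {L : Matrix N N} (S : SmithNormalForm L) {ℓ : ℕ} (ℓ-prime : Prime ℓ) where
    open SmithNormalForm S hiding (divides)

    small? : ∀ i → Decidable (λ j → ¬ (ℓ ^ suc i ℕ.∣ d j))
    small? i j = ¬? (ℓ ^ suc i ℕ.∣? d j)

    large? : ∀ i → Decidable (λ j → ℓ ^ suc i ℕ.∣ d j)
    large? i j = ℓ ^ suc i ℕ.∣? d j

    -- Note the shift: rank i counts the elementary divisors that do not vanish
    -- modulo ℓ^(i+1).
    rank : ℕ → ℕ
    rank i = length (filter (small? i) (allFin N))

    corank : ℕ → ℕ
    corank i = length (filter (large? i) (allFin N))

    rank+corank : ∀ i → rank i ℕ.+ corank i ≡ N
    rank+corank i = trans (length-filter-¬ (large? i) (allFin N)) (List.length-tabulate id)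

    private
      ℓ^∣ℓ^ : ∀ i → ℓ ^ i ℕ.∣ ℓ ^ suc i
      ℓ^∣ℓ^ i = ℕ.n∣m*n ℓ

    multiplicity-zero : multiplicity S ℓ 0 ≡ rank 0
    multiplicity-zero = cong length (List.filter-≐ (λ j → valuation? ℓ (d j) 0) (small? 0)
      (proj₂ , λ ∤d → ℕ.1∣ _ , ∤d) (allFin N))

    multiplicity-suc : ∀ i → multiplicity S ℓ (suc i) ℕ.+ rank i ≡ rank (suc i)
    multiplicity-suc i = length-filter-⊎ (λ j → valuation? ℓ (d j) (suc i)) (small? i) (small? (suc i))
      (λ (∣d , _) ∤d → ∤d ∣d) proj₂ (λ ∤d ∣d → ∤d (ℕ.∣-trans (ℓ^∣ℓ^ (suc i)) ∣d))
      (λ {j} ∤d ¬∤d → decide (large? i j) ¬∤d , ∤d) (allFin N)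
      where
      decide : ∀ {P : Set} → Dec P → ¬ ¬ P → P
      decide (yes p) _   = p
      decide (no ¬p) ¬¬p = contradiction ¬p ¬¬p

    private
      L-linear = apply-linear L

      -- The form in which the Smith normal form is used: in the coordinates `Q⁻¹ x` on the source
      -- and `P` on the target, `L` is diagonal.
      P∘L : ∀ x j → apply P (apply L x) j ≡ + d j * apply Q⁻¹ x j
      P∘L x j = begin
        apply P (apply L x) j                            ≡⟨ apply-⊗ P L x j ⟨
        apply (P ⊗ L) x j                                ≡⟨ apply-linear (P ⊗ L) j .≗-cong (λ i → trans (sym (apply-𝟙 x i)) (sym (apply-≈ᴹ Q-inverseʳ x i))) ⟩
        apply (P ⊗ L) (apply (Q ⊗ Q⁻¹) x) j              ≡⟨ apply-linear (P ⊗ L) j .≗-cong (apply-⊗ Q Q⁻¹ x) ⟩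
        apply (P ⊗ L) (apply Q (apply Q⁻¹ x)) j          ≡⟨ apply-⊗ (P ⊗ L) Q (apply Q⁻¹ x) j ⟨
        apply (P ⊗ L ⊗ Q) (apply Q⁻¹ x) j                ≡⟨ apply-≈ᴹ smith (apply Q⁻¹ x) j ⟩
        apply (diagonal (λ i → + d i)) (apply Q⁻¹ x) j   ≡⟨ apply-diagonal (λ i → + d i) (apply Q⁻¹ x) j ⟩
        + d j * apply Q⁻¹ x j                            ∎
        where open ≡-Reasoning

      invert : ∀ {A A⁻¹ : Matrix N N} → A⁻¹ ⊗ A ≈ᴹ 𝟙 → ∀ x j → apply A⁻¹ (apply A x) j ≡ x j
      invert {A} {A⁻¹} inv x j = trans (sym (apply-⊗ A⁻¹ A x j)) (trans (apply-≈ᴹ inv x j) (apply-𝟙 x j))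

      cancel : ∀ {A A⁻¹ : Matrix N N} → A⁻¹ ⊗ A ≈ᴹ 𝟙 → ∀ {k x} → (∀ j → k ∣ apply A x j) → ∀ j → k ∣ x j
      cancel {A} {A⁻¹} inv {k} {x} k∣Ax j =
        subst (k ∣_) (invert {A} {A⁻¹} inv x j) (linear-∣ (apply-linear A⁻¹ j) k∣Ax)

      member : ∀ {p} {P : Pred (Fin N) p} (P? : Decidable P) {j} → P j → j ∈ filter P? (allFin N)
      member P? Pj = ∈-filter⁺ P? (∈-allFin _) Pj

      functionals : ∀ {m} (f : Fin N → Functional m) {p} {P : Pred (Fin N) p} → Decidable P → List (Functional m)
      functionals f P? = List.map f (filter P? (allFin N))

      length-functionals : ∀ {m} (f : Fin N → Functional m) {p} {P : Pred (Fin N) p} (P? : Decidable P) →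
                           ∀ B → length (functionals f P? ++ B) ≡ length (filter P? (allFin N)) ℕ.+ length B
      length-functionals f P? B = trans (List.length-++ (functionals f P?))
        (cong (ℕ._+ length B) (List.length-map f (filter P? (allFin N))))

      killed : ∀ {m} (f : Fin N → Functional m) {p} {P : Pred (Fin N) p} (P? : Decidable P) {y} B →
               All (Kills y) (functionals f P? ++ B) → (∀ {j} → P j → Kills y (f j)) × All (Kills y) B
      killed f P? B all =
        (λ Pj → All.lookup (All.map⁻ (All.++⁻ˡ (functionals f P?) all)) (member P? Pj)) ,
        All.++⁻ʳ (functionals f P?) all

      ∣zero : ∀ {k x} → x ≡ 0ℤ → k ∣ x
      ∣zero {k} refl = divides 0ℤ refl

    -- The vector is chosen to kill `B` and the coordinates of `Q⁻¹ (Y y)` at which `d j` is not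
    -- divisible; every other coordinate meets a divisible `d j`. It is applied contrapositively: if
    -- no such primitive `y` exists, then `m` is at most `rank i + length B`.
    rank-lower : ∀ i {m} {Y : Vector ℤ m → Vector ℤ N} → IsLinearMap Y → (B : List (Functional m)) →
                 rank i ℕ.+ length B < m →
                 ∃ λ y → Primitive ℓ-prime y × All (Kills y) B × ∀ k → + (ℓ ^ suc i) ∣ apply L (Y y) k
    rank-lower i {m} {Y} Y-linear B k<m =
      let y , y-primitive , zeros = primitive-kernel ℓ-prime (functionals f (small? i) ++ B)
            (subst (_< m) (sym (length-functionals f (small? i) B)) k<m)
          small-zero , B-zero = killed f (small? i) {y} B zeros
      in y , y-primitive , B-zero , cancel {P} {P⁻¹} P-inverseˡ (λ j →
           subst (+ (ℓ ^ suc i) ∣_) (sym (P∘L (Y y) j)) (D∣ j (apply Q⁻¹ (Y y) j) small-zero (large? i j)))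
      where
      f : Fin N → Functional m
      f j = (λ y → apply Q⁻¹ (Y y) j) , ∘-linear (apply-linear Q⁻¹ j) Y-linear
      D∣ : ∀ j z → (¬ (ℓ ^ suc i ℕ.∣ d j) → z ≡ 0ℤ) → Dec (ℓ ^ suc i ℕ.∣ d j) →
           + (ℓ ^ suc i) ∣ + d j * z
      D∣ j z _    (yes ∣d) = ∣m⇒∣m*n {m = + d j} z (∣ᵤ⇒∣ ∣d)
      D∣ j z z≡0 (no ∤d)   = ∣n⇒∣m*n (+ d j) (∣zero (z≡0 ∤d))

    private
      ∣large : ∀ i j z → (ℓ ^ suc i ℕ.∣ d j → z ≡ 0ℤ) → + (ℓ ^ suc i) ∣ + d j * z →
               Dec (ℓ ^ suc i ℕ.∣ d j) → + ℓ ∣ z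
      ∣large i j z z≡0 _   (yes ∣d) = ∣zero (z≡0 ∣d)
      ∣large i j z _   ∣dz (no ∤d)  = ^∣*⇒∣ ℓ-prime (suc i) (+ d j) ∣dz (λ ∣d → ∤d (∣⇒∣ᵤ ∣d))

    -- The opposite choice: the coordinates with divisible `d j` are killed, and at the others the
    -- congruence for `L (K y)` forces divisibility by ℓ. The bound on lengths is
    -- `corank i + length B < m` in disguise; contrapositively, a large family `K` of solutions that
    -- is injective modulo ℓ bounds `rank i` from above. Note that the congruence is required for
    -- every `y`, not only for those killed by `B`.
    corank-lower : ∀ i {m} {K : Vector ℤ m → Vector ℤ N} → IsLinearMap K →
                   (∀ y k → + (ℓ ^ suc i) ∣ apply L (K y) k) → (B : List (Functional m)) →
                   N ℕ.+ length B < m ℕ.+ rank i →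
                   ∃ λ y → Primitive ℓ-prime y × All (Kills y) B × ∀ k → + ℓ ∣ K y k
    corank-lower i {m} {K} K-linear ∣LK B k< =
      let y , y-primitive , zeros = primitive-kernel ℓ-prime (functionals f (large? i) ++ B)
            (subst (_< m) (sym (length-functionals f (large? i) B)) k<m)
          large-zero , B-zero = killed f (large? i) {y} B zeros
      in y , y-primitive , B-zero , cancel {Q⁻¹} {Q} Q-inverseʳ (λ j →
           ∣large i j (apply Q⁻¹ (K y) j) large-zero
             (subst (+ (ℓ ^ suc i) ∣_) (P∘L (K y) j) (linear-∣ (apply-linear P j) (∣LK y))) (large? i j))
      where
      f : Fin N → Functional m
      f j = (λ y → apply Q⁻¹ (K y) j) , ∘-linear (apply-linear Q⁻¹ j) K-linear
      open ℕ.≤-Reasoning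
      k<m : corank i ℕ.+ length B < m
      k<m = ℕ.+-cancelˡ-< (rank i) _ _ (begin-strict
        rank i ℕ.+ (corank i ℕ.+ length B)  ≡⟨ ℕ.+-assoc (rank i) _ _ ⟨
        rank i ℕ.+ corank i ℕ.+ length B    ≡⟨ cong (ℕ._+ length B) (rank+corank i) ⟩
        N ℕ.+ length B                      <⟨ k< ⟩
        m ℕ.+ rank i                        ≡⟨ ℕ.+-comm m (rank i) ⟩
        rank i ℕ.+ m                        ∎)

    -- Take `x = Q η` with `η` primitive, killed by `B` after `Q`, and supported where `d j` is not
    -- divisible. If `L x` vanished modulo ℓ^(i+1), every coordinate of `η` would be divisible by ℓ.
    rank-upper : ∀ i (B : List (Functional N)) → length B < rank i →
                 ∃ λ x → All (Kills x) B × ¬ (∀ k → + (ℓ ^ suc i) ∣ apply L x k)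
    rank-upper i B k< =
      let η , η-primitive , zeros = primitive-kernel ℓ-prime (functionals f (large? i) ++ B∘Q) k<N
          large-zero , B-zero = killed f (large? i) {η} B∘Q zeros
      in apply Q η , All.map⁻ B-zero , λ ∣Lx → η-primitive (λ j →
           ∣large i j (η j) large-zero
             (subst (+ (ℓ ^ suc i) ∣_)
               (trans (P∘L (apply Q η) j) (cong (+ d j *_) (invert {Q} {Q⁻¹} Q-inverseˡ η j)))
               (linear-∣ (apply-linear P j) ∣Lx))
             (large? i j))
      where
      B∘Q = List.map (λ (φ , φ-lin) → φ ∘ apply Q , ∘-linear φ-lin (apply-linear Q)) B
      f : Fin N → Functional N
      f j = (λ η → η j) , projection j
      open ℕ.≤-Reasoning
      k<N : length (functionals f (large? i) ++ B∘Q) < N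
      k<N = begin-strict
        length (functionals f (large? i) ++ B∘Q)  ≡⟨ length-functionals f (large? i) B∘Q ⟩
        corank i ℕ.+ length B∘Q                   ≡⟨ cong (corank i ℕ.+_) (List.length-map _ B) ⟩
        corank i ℕ.+ length B                     <⟨ ℕ.+-monoʳ-< (corank i) k< ⟩
        corank i ℕ.+ rank i                       ≡⟨ ℕ.+-comm (corank i) (rank i) ⟩
        rank i ℕ.+ corank i                       ≡⟨ rank+corank i ⟩
        N                                         ∎

  sum-const : ∀ n k → sum {n} (λ _ → k) ≡ + n * k
  sum-const zero    k = sym (*-zeroˡ k)
  sum-const (suc n) k = trans (cong (λ z → k + z) (sum-const n k)) (lemma k (+ n))
    where
    lemma : ∀ k n → k + n * k ≡ (+ 1 + n) * k
    lemma = solve-∀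

  transpose : ∀ {m n} → Matrix m n → Matrix n m
  transpose M j i = M i j

  sum-apply : ∀ {m n} (M : Matrix m n) z → sum (apply M z) ≡ ∑[ j < n ] ((∑[ i < m ] M i j) * z j)
  sum-apply M z = trans (∑-comm (λ i j → M i j * z j))
    (sum-cong-≗ (λ j → sym (*-distribʳ-sum (z j) (λ i → M i j))))

  sum-δ : ∀ {n} (i : Fin n) → sum (δ i) ≡ 1ℤ
  sum-δ i = trans (sum-cong-≗ (λ j → sym (*-identityʳ (𝟙 i j)))) (apply-𝟙 (λ _ → 1ℤ) i)

  apply-transpose-δ : ∀ {m n} (M : Matrix m n) i → apply (transpose M) (δ i) ≗ M i
  apply-transpose-δ M i j = trans (sum-cong-≗ (λ k → *-comm (M k j) (𝟙 i k))) (apply-𝟙 (λ k → M k j) i)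

  ∣-*-cancelʳ : ∀ {ℓ} (ℓ-prime : Prime ℓ) i a {b} → + (ℓ ^ i) ∣ a * b → ¬ (+ ℓ ∣ b) → + (ℓ ^ i) ∣ a
  ∣-*-cancelʳ {ℓ} ℓ-prime i a ∣ab ℓ∤b with + (ℓ ^ i) ∣? a
  ... | yes ∣a = ∣a
  ... | no ∤a  = contradiction (^∣*⇒∣ ℓ-prime i a ∣ab ∤a) ℓ∤b

  ∣*⇒∣ʳ : ∀ {ℓ} (ℓ-prime : Prime ℓ) a {b} → ¬ (+ ℓ ∣ a) → + ℓ ∣ a * b → + ℓ ∣ b
  ∣*⇒∣ʳ ℓ-prime a {b} ℓ∤a ℓ∣ab with ∣*⇒∣ ℓ-prime {a} {b} ℓ∣ab
  ... | inj₁ ℓ∣a = contradiction ℓ∣a ℓ∤a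
  ... | inj₂ ℓ∣b = ℓ∣b

  -- Abstracts from the lines (N of them) and points (v of them) of a projective
  -- space over 𝔽_q, with m lines through each point.
  record Incidence {N : ℕ} (v : ℕ) (L : Matrix N N) (q m : ℤ) : Set where
    field
      W        : Matrix N v
      WWᵀ      : ∀ i k → (W ⊗ transpose W) i k ≡ (1ℤ + q) * m * 𝟙 i k - L i k
      WᵀW      : ∀ j k → (transpose W ⊗ W) j k ≡ (m - 1ℤ) * 𝟙 j k + 1ℤ
      W-row    : ∀ i → ∑[ j < v ] W i j ≡ 1ℤ + q
      W-column : ∀ j → ∑[ i < N ] W i j ≡ m
      X        : Fin v → Matrix v N
      XW       : ∀ j₀ j k → (X j₀ ⊗ W) j k ≡ q * (𝟙 j k - 𝟙 j₀ k)
      X-row    : ∀ j₀ j → ∑[ i < N ] X j₀ j i ≡ 0ℤ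

  -- The Laplacian of an abstract incidence structure

  module Laplacian
    {N v′ : ℕ} {L : Matrix N N} (i₀ : Fin N) {q m : ℤ} (incidence : Incidence (suc (suc v′)) L q m)
    (c+r≡s : (m - 1ℤ) + (+ suc (suc v′)) ≡ (1ℤ + q) * m) where

    private
      v : ℕ
      v = suc (suc v′)
      r s c : ℤ
      r = + v
      s = (1ℤ + q) * m
      c = m - 1ℤ

    open Incidence incidence hiding (X; XW; X-row)

    private
      X     = Incidence.X incidence zero
      XW    = Incidence.XW incidence zero
      X-row = Incidence.X-row incidence zero

    w : Vector ℤ v → Vector ℤ N
    w = apply W
    wᵀ : Vector ℤ N → Vector ℤ v
    wᵀ = apply (transpose W)
    χ : Vector ℤ N → Vector ℤ v
    χ = apply X
    χᵀ : Vector ℤ v → Vector ℤ N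
    χᵀ = apply (transpose X)

    private
      w-linear  = apply-linear W
      wᵀ-linear = apply-linear (transpose W)
      χ-linear  = apply-linear X
      χᵀ-linear = apply-linear (transpose X)
      L-linear  = apply-linear L

      affine : ∀ {n} (M : Matrix n n) (a b : ℤ) (A : Matrix n n) → (∀ i k → M i k ≡ a * 𝟙 i k + b * A i k) →
               ∀ z i → apply M z i ≡ a * z i + b * apply A z i
      affine {n} M a b A eq z i = begin
        ∑[ k < n ] (M i k * z k)                          ≡⟨ sum-cong-≗ (λ k → trans (cong (_* z k) (eq i k)) (lemma a b (𝟙 i k) (A i k) (z k))) ⟩
        ∑[ k < n ] (a * (𝟙 i k * z k) + b * (A i k * z k))  ≡⟨ ∑-distrib-+ (λ k → a * (𝟙 i k * z k)) (λ k → b * (A i k * z k)) ⟩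
        _                                                 ≡⟨ cong₂ _+_ (*-distribˡ-sum a (λ k → 𝟙 i k * z k)) (*-distribˡ-sum b (λ k → A i k * z k)) ⟨
        a * apply 𝟙 z i + b * apply A z i                 ≡⟨ cong (λ x → a * x + b * apply A z i) (apply-𝟙 z i) ⟩
        a * z i + b * apply A z i                         ∎
        where
        open ≡-Reasoning
        lemma : ∀ a b d x z → (a * d + b * x) * z ≡ a * (d * z) + b * (x * z)
        lemma = solve-∀

    L-apply : ∀ z i → apply L z i ≡ s * z i - w (wᵀ z) i
    L-apply z i = begin
      apply L z i                                 ≡⟨ affine L s (- 1ℤ) (W ⊗ transpose W) entries z i ⟩
      s * z i + (- 1ℤ) * apply (W ⊗ transpose W) z i  ≡⟨ cong (λ x → s * z i + (- 1ℤ) * x) (apply-⊗ W (transpose W) z i) ⟩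
      s * z i + (- 1ℤ) * w (wᵀ z) i               ≡⟨ cong (λ x → s * z i + x) (-1*i≡-i (w (wᵀ z) i)) ⟩
      s * z i - w (wᵀ z) i                        ∎
      where
      open ≡-Reasoning
      lemma : ∀ t l → l ≡ t + (- 1ℤ) * (t - l)
      lemma = solve-∀
      entries : ∀ i k → L i k ≡ s * 𝟙 i k + (- 1ℤ) * (W ⊗ transpose W) i k
      entries i k = trans (lemma (s * 𝟙 i k) (L i k)) (cong (λ x → s * 𝟙 i k + (- 1ℤ) * x) (sym (WWᵀ i k)))

    wᵀ-w : ∀ y j → wᵀ (w y) j ≡ c * y j + sum y
    wᵀ-w y j = begin
      wᵀ (w y) j                                  ≡⟨ apply-⊗ (transpose W) W y j ⟨
      apply (transpose W ⊗ W) y j                 ≡⟨ affine (transpose W ⊗ W) c 1ℤ (λ _ _ → 1ℤ) (λ j k → WᵀW j k) y j ⟩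
      c * y j + 1ℤ * sum (λ k → 1ℤ * y k)         ≡⟨ cong (λ x → c * y j + x) (trans (*-identityˡ _) (sum-cong-≗ (λ k → *-identityˡ (y k)))) ⟩
      c * y j + sum y                             ∎
      where open ≡-Reasoning

    w-const : ∀ k i → w (λ _ → k) i ≡ (1ℤ + q) * k
    w-const k i = trans (sym (*-distribʳ-sum k (W i))) (cong (_* k) (W-row i))

    sum-wᵀ : ∀ z → sum (wᵀ z) ≡ (1ℤ + q) * sum z
    sum-wᵀ z = begin
      sum (wᵀ z)                                     ≡⟨ sum-apply (transpose W) z ⟩
      ∑[ i < N ] ((∑[ j < v ] W i j) * z i)          ≡⟨ sum-cong-≗ (λ i → cong (_* z i) (W-row i)) ⟩
      ∑[ i < N ] ((1ℤ + q) * z i)                    ≡⟨ *-distribˡ-sum (1ℤ + q) z ⟨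
      (1ℤ + q) * sum z                               ∎
      where open ≡-Reasoning

    χ-const : ∀ k j → χ (λ _ → k) j ≡ 0ℤ
    χ-const k j = trans (sym (*-distribʳ-sum k (X j))) (trans (cong (_* k) (X-row j)) (*-zeroˡ k))

    sum-χᵀ : ∀ y → sum (χᵀ y) ≡ 0ℤ
    sum-χᵀ y = begin
      sum (χᵀ y)                                     ≡⟨ sum-apply (transpose X) y ⟩
      ∑[ j < v ] ((∑[ i < N ] X j i) * y j)          ≡⟨ sum-cong-≗ (λ j → trans (cong (_* y j) (X-row j)) (*-zeroˡ (y j))) ⟩
      ∑[ j < v ] 0ℤ                                  ≡⟨ sum-replicate-zero v ⟩
      0ℤ                                             ∎
      where open ≡-Reasoning

    χ-w : ∀ y j → χ (w y) j ≡ q * y j + (- q) * y zero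
    χ-w y j = begin
      χ (w y) j                                      ≡⟨ apply-⊗ X W y j ⟨
      apply (X ⊗ W) y j                              ≡⟨ affine (X ⊗ W) q (- q) (λ _ → 𝟙 zero) (λ j k → trans (XW j k) (lemma q (𝟙 j k) (𝟙 zero k))) y j ⟩
      q * y j + (- q) * apply 𝟙 y zero               ≡⟨ cong (λ x → q * y j + (- q) * x) (apply-𝟙 y zero) ⟩
      q * y j + (- q) * y zero                       ∎
      where
      open ≡-Reasoning
      lemma : ∀ q a b → q * (a - b) ≡ q * a + (- q) * b
      lemma = solve-∀

    𝟙-sym : ∀ {n} (i j : Fin n) → 𝟙 i j ≡ 𝟙 j i
    𝟙-sym i j with i ≟ᶠ j
    ... | yes refl = sym (diagonal-refl _ i)
    ... | no i≢j   = sym (diagonal-≢ _ (i≢j ∘ sym))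

    -- Transposing the relation for `X W` turns its correction term into the sum of `y` placed at
    -- the base point, which drops out here.
    wᵀ-χᵀ : ∀ y → sum y ≡ 0ℤ → ∀ j → wᵀ (χᵀ y) j ≡ q * y j
    wᵀ-χᵀ y σ≡0 j = begin
      wᵀ (χᵀ y) j                                ≡⟨ apply-⊗ (transpose W) (transpose X) y j ⟨
      apply (transpose W ⊗ transpose X) y j      ≡⟨ affine (transpose W ⊗ transpose X) q (- q) (λ j _ → 𝟙 zero j) entries y j ⟩
      q * y j + (- q) * (∑[ k < v ] (𝟙 zero j * y k))  ≡⟨ cong (λ x → q * y j + (- q) * x) (trans (sym (*-distribˡ-sum (𝟙 zero j) y)) (cong (𝟙 zero j *_) σ≡0)) ⟩
      q * y j + (- q) * (𝟙 zero j * 0ℤ)          ≡⟨ lemma q (y j) (𝟙 zero j) ⟩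
      q * y j                                    ∎
      where
      open ≡-Reasoning
      lemma : ∀ q y d → q * y + (- q) * (d * 0ℤ) ≡ q * y
      lemma = solve-∀
      lemma′ : ∀ q a b → q * (a - b) ≡ q * a + (- q) * b
      lemma′ = solve-∀
      entries : ∀ j k → (transpose W ⊗ transpose X) j k ≡ q * 𝟙 j k + (- q) * 𝟙 zero j
      entries j k = begin
        ∑[ i < N ] (W i j * X k i)             ≡⟨ sum-cong-≗ (λ i → *-comm (W i j) (X k i)) ⟩
        (X ⊗ W) k j                            ≡⟨ XW k j ⟩
        q * (𝟙 k j - 𝟙 zero j)                 ≡⟨ cong (λ x → q * (x - 𝟙 zero j)) (𝟙-sym k j) ⟩
        q * (𝟙 j k - 𝟙 zero j)                 ≡⟨ lemma′ q (𝟙 j k) (𝟙 zero j) ⟩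
        q * 𝟙 j k + (- q) * 𝟙 zero j           ∎

    -- The eigenvalue is `s - c`. The correction is `W` applied to the constant vector that the
    -- all-ones part of the Gram matrix leaves.
    L-w : ∀ y k → apply L (w y) k ≡ r * w y k - (1ℤ + q) * sum y
    L-w y k = begin
      apply L (w y) k                                ≡⟨ L-apply (w y) k ⟩
      s * w y k - w (wᵀ (w y)) k                     ≡⟨ cong (λ x → s * w y k - x) w-gram ⟩
      s * w y k - (c * w y k + (1ℤ + q) * sum y)     ≡⟨ cong (λ x → x * w y k - (c * w y k + (1ℤ + q) * sum y)) (sym c+r≡s) ⟩
      (c + r) * w y k - (c * w y k + (1ℤ + q) * sum y)  ≡⟨ lemma c r (w y k) ((1ℤ + q) * sum y) ⟩
      r * w y k - (1ℤ + q) * sum y                   ∎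
      where
      open ≡-Reasoning
      lemma : ∀ c r a b → (c + r) * a - (c * a + b) ≡ r * a - b
      lemma = solve-∀
      w-gram : w (wᵀ (w y)) k ≡ c * w y k + (1ℤ + q) * sum y
      w-gram = begin
        w (wᵀ (w y)) k                               ≡⟨ w-linear k .≗-cong (wᵀ-w y) ⟩
        w (λ j → c * y j + sum y) k                  ≡⟨ w-linear k .+-homo (λ j → c * y j) (λ _ → sum y) ⟩
        w (λ j → c * y j) k + w (λ _ → sum y) k      ≡⟨ cong₂ _+_ (w-linear k .*-homo c y) (w-const (sum y) k) ⟩
        c * w y k + (1ℤ + q) * sum y                 ∎

    -- The argument of `L` is `r z + W Wᵀ z`, and `Wᵀ` preserves sum zero, so `L-w` applies without
    -- its correction. The form is chosen to exhibit a preimage of `r s z` under `L`.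
    L-quadratic : ∀ z → sum z ≡ 0ℤ → ∀ k →
                  apply L (λ i → (r + s) * z i - apply L z i) k ≡ (r * s) * z k
    L-quadratic z σ≡0 k = begin
      apply L (λ i → (r + s) * z i - apply L z i) k  ≡⟨ L-linear k .≗-cong (λ i → trans (cong (λ x → (r + s) * z i - x) (L-apply z i)) (lemma r s (z i) (w a i))) ⟩
      apply L (λ i → r * z i + w a i) k              ≡⟨ L-linear k .+-homo (λ i → r * z i) (w a) ⟩
      apply L (λ i → r * z i) k + apply L (w a) k    ≡⟨ cong₂ _+_ (trans (L-linear k .*-homo r z) (cong (r *_) (L-apply z k))) (L-w a k) ⟩
      r * (s * z k - w a k) + (r * w a k - (1ℤ + q) * sum a)  ≡⟨ cong (λ x → r * (s * z k - w a k) + (r * w a k - (1ℤ + q) * x)) (trans (sum-wᵀ z) (cong ((1ℤ + q) *_) σ≡0)) ⟩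
      r * (s * z k - w a k) + (r * w a k - (1ℤ + q) * ((1ℤ + q) * 0ℤ))  ≡⟨ lemma′ q r s (z k) (w a k) ⟩
      r * s * z k                                    ∎
      where
      open ≡-Reasoning
      a = wᵀ z
      lemma : ∀ r s z b → (r + s) * z - (s * z - b) ≡ r * z + b
      lemma = solve-∀
      lemma′ : ∀ q r s z b → r * (s * z - b) + (r * b - (1ℤ + q) * ((1ℤ + q) * 0ℤ)) ≡ r * s * z
      lemma′ = solve-∀

    L-const : ∀ k i → apply L (λ _ → k) i ≡ 0ℤ
    L-const k i = begin
      apply L (λ _ → k) i                    ≡⟨ L-apply (λ _ → k) i ⟩
      s * k - w (wᵀ (λ _ → k)) i             ≡⟨ cong (λ x → s * k - x) (w-linear i .≗-cong (λ j → trans (sym (*-distribʳ-sum k (λ i → W i j))) (cong (_* k) (W-column j)))) ⟩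
      s * k - w (λ _ → m * k) i              ≡⟨ cong (λ x → s * k - x) (w-const (m * k) i) ⟩
      s * k - (1ℤ + q) * (m * k)             ≡⟨ lemma q m k ⟩
      0ℤ                                     ∎
      where
      open ≡-Reasoning
      lemma : ∀ q m k → (1ℤ + q) * m * k - (1ℤ + q) * (m * k) ≡ 0ℤ
      lemma = solve-∀

    sum-L : ∀ z → sum (apply L z) ≡ 0ℤ
    sum-L z = begin
      sum (apply L z)                                        ≡⟨ sum-cong-≗ (λ i → trans (L-apply z i) (cong (λ x → s * z i + x) (sym (-1*i≡-i (w (wᵀ z) i))))) ⟩
      ∑[ i < N ] (s * z i + (- 1ℤ) * w (wᵀ z) i)             ≡⟨ ∑-distrib-+ (λ i → s * z i) (λ i → (- 1ℤ) * w (wᵀ z) i) ⟩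
      _                                                      ≡⟨ cong₂ _+_ (*-distribˡ-sum s z) (*-distribˡ-sum (- 1ℤ) (w (wᵀ z))) ⟨
      s * sum z + (- 1ℤ) * sum (w (wᵀ z))                    ≡⟨ cong (λ x → s * sum z + (- 1ℤ) * x) (trans (sum-w (wᵀ z)) (cong (m *_) (sum-wᵀ z))) ⟩
      s * sum z + (- 1ℤ) * (m * ((1ℤ + q) * sum z))          ≡⟨ lemma q m (sum z) ⟩
      0ℤ                                                     ∎
      where
      open ≡-Reasoning
      lemma : ∀ q m a → (1ℤ + q) * m * a + (- 1ℤ) * (m * ((1ℤ + q) * a)) ≡ 0ℤ
      lemma = solve-∀
      sum-w : ∀ y → sum (w y) ≡ m * sum y
      sum-w y = trans (sum-apply W y) (trans (sum-cong-≗ (λ j → cong (_* y j) (W-column j))) (sym (*-distribˡ-sum m y)))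

    -- Upper and lower bounds for the ranks

    module Ranks (S : SmithNormalForm L) {ℓ : ℕ} (ℓ-prime : Prime ℓ) where
      open SmithRank S ℓ-prime public

      private
        σ : ∀ {n} → Functional n
        σ = sum , sum-linear

        ∣0 : ∀ {k x} → x ≡ 0ℤ → k ∣ x
        ∣0 refl = divides 0ℤ refl

        infix 4 _≡∣_
        _≡∣_ : ∀ {k x y} → x ≡ y → k ∣ y → k ∣ x
        refl ≡∣ k∣x = k∣x

      ^∣⇒∣ : ∀ i {a} → + (ℓ ^ suc i) ∣ a → + ℓ ∣ a
      ^∣⇒∣ i = ∣-trans (∣ᵤ⇒∣ (ℕ.m∣m*n (ℓ ^ i)))

      -- The constant vectors are killed by `L` and are nonzero modulo ℓ, so some elementary divisor
      -- is divisible by every power of ℓ.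
      rank<N : ∀ i → suc (rank i) ≤ N
      rank<N i = ℕ.≮⇒≥ λ N<1+rank →
        let y , y-primitive , _ , ∣y = corank-lower i {1} {λ y _ → y zero} (λ _ → projection zero)
              (λ y k → ∣0 (L-const (y zero) k)) [] (subst (_< suc (rank i)) (sym (ℕ.+-identityʳ N)) N<1+rank)
        in y-primitive λ { zero → ∣y i₀ }

      -- Substituting `(r + s - L) z` for the unknown makes `L` act as the scalar `r s`, at the cost
      -- of the one equation `sum z = 0`.
      N≤rank+1 : ∀ i → ¬ (+ (ℓ ^ suc i) ∣ r * s) → N ≤ rank i ℕ.+ 1
      N≤rank+1 i ∤rs = ℕ.≮⇒≥ λ k<N →
        let y , y-primitive , zeros , ∣LYy = rank-lower i
              {Y = λ z i → (r + s) * z i - apply L z i}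
              (λ i → +-linear (*-linear (projection i) (r + s)) (neg-linear (L-linear i))) (σ ∷ []) k<N
        in y-primitive λ k → ^∣*⇒∣ ℓ-prime (suc i) (r * s)
             (sym (L-quadratic y (All.head zeros) k) ≡∣ ∣LYy k) ∤rs

      -- Where `Wᵀ z` vanishes, `L` is the scalar `s`. Imposing all v equations would lose one unit
      -- of rank, so the equation at point 1 is left out: when `u = Wᵀ z` vanishes at all other
      -- points, its value there is the sum of `u`, which the congruence for `Wᵀ (L z)` at point 0
      -- makes divisible.
      N<rank+v : ∀ i → ¬ (+ (ℓ ^ suc i) ∣ s) → suc N ≤ rank i ℕ.+ v
      N<rank+v i ∤s = ℕ.≮⇒≥ λ k< →
        let z , z-primitive , zeros , ∣Lz = rank-lower i {Y = id} id-linear (f zero ∷ List.tabulate (λ j → f (suc (suc j))))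
              (subst (λ l → rank i ℕ.+ suc l < N) (sym (List.length-tabulate (λ j → f (suc (suc j)))))
                (s<s⁻¹ (subst (_< suc N) (ℕ.+-suc (rank i) (suc v′)) k<)))
        in z-primitive (go z (All.head zeros) (All.tabulate⁻ {f = λ j → f (suc (suc j))} (All.tail zeros)) ∣Lz)
        where
        f : Fin v → Functional N
        f j = (λ z → wᵀ z j) , wᵀ-linear j
        go : ∀ z → wᵀ z zero ≡ 0ℤ → (∀ j → wᵀ z (suc (suc j)) ≡ 0ℤ) →
             (∀ k → + (ℓ ^ suc i) ∣ apply L z k) → ∀ k → + ℓ ∣ z k
        go z u₀≡0 u≡0 ∣Lz k = ^∣*⇒∣ ℓ-prime (suc i) s (sz≡ ≡∣ ∣m∣n⇒∣m+n (∣Lz k) (linear-∣ (w-linear k) ∣u)) ∤s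
          where
          open ≡-Reasoning
          u = wᵀ z
          σu≡u₁ : sum u ≡ u (suc zero)
          σu≡u₁ = begin
            u zero + (u (suc zero) + ∑[ j < v′ ] u (suc (suc j)))  ≡⟨ cong₂ (λ a b → a + (u (suc zero) + b)) u₀≡0 (trans (sum-cong-≗ u≡0) (sum-replicate-zero v′)) ⟩
            0ℤ + (u (suc zero) + 0ℤ)                               ≡⟨ lemma (u (suc zero)) ⟩
            u (suc zero)                                           ∎
            where
            lemma : ∀ a → 0ℤ + (a + 0ℤ) ≡ a
            lemma = solve-∀
          wᵀL : wᵀ (apply L z) zero ≡ - u (suc zero)
          wᵀL = begin
            wᵀ (apply L z) zero                                       ≡⟨ wᵀ-linear zero .≗-cong (L-apply z) ⟩
            wᵀ (λ i → s * z i - w u i) zero                           ≡⟨ wᵀ-linear zero .≗-cong (λ i → cong (λ x → s * z i + x) (sym (-1*i≡-i (w u i)))) ⟩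
            wᵀ (λ i → s * z i + (- 1ℤ) * w u i) zero                  ≡⟨ wᵀ-linear zero .+-homo (λ i → s * z i) (λ i → (- 1ℤ) * w u i) ⟩
            _                                                         ≡⟨ cong₂ _+_ (wᵀ-linear zero .*-homo s z) (wᵀ-linear zero .*-homo (- 1ℤ) (w u)) ⟩
            s * u zero + (- 1ℤ) * wᵀ (w u) zero                       ≡⟨ cong (λ x → s * u zero + (- 1ℤ) * x) (wᵀ-w u zero) ⟩
            s * u zero + (- 1ℤ) * (c * u zero + sum u)                ≡⟨ cong₂ (λ a b → s * a + (- 1ℤ) * (c * a + b)) u₀≡0 σu≡u₁ ⟩
            s * 0ℤ + (- 1ℤ) * (c * 0ℤ + u (suc zero))                 ≡⟨ lemma s c (u (suc zero)) ⟩
            - u (suc zero)                                            ∎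
            where
            lemma : ∀ s c a → s * 0ℤ + (- 1ℤ) * (c * 0ℤ + a) ≡ - a
            lemma = solve-∀
          ∣u : ∀ j → + (ℓ ^ suc i) ∣ u j
          ∣u zero          = ∣0 u₀≡0
          ∣u (suc zero)    = sym (trans (cong -_ wᵀL) (neg-involutive _)) ≡∣ ∣m⇒∣-m (linear-∣ (wᵀ-linear zero) ∣Lz)
          ∣u (suc (suc j)) = ∣0 (u≡0 j)
          sz≡ : s * z k ≡ apply L z k + w u k
          sz≡ = sym (trans (cong (λ x → x + w u k) (L-apply z k)) (lemma (s * z k) (w u k)))
            where
            lemma : ∀ a b → a - b + b ≡ a
            lemma = solve-∀

      -- Every `W y` with `sum y = 0` solves the congruence, as `L` acts on it by `r`. Modulo ℓ
      -- these solutions stay independent, because `Wᵀ W` acts on such `y` as `c = s - r`, a unit.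
      rank+v≤N+1 : ∀ i → + (ℓ ^ suc i) ∣ r → ¬ (+ ℓ ∣ s) → rank i ℕ.+ v ≤ N ℕ.+ 1
      rank+v≤N+1 i ∣r ℓ∤s = ℕ.≮⇒≥ λ N+1< →
        let y , y-primitive , zeros , ∣Ky = corank-lower i {K = λ y → w (K y)}
              (λ k → ∘-linear (w-linear k) K-linear) ∣LK (σ ∷ []) (subst (N ℕ.+ 1 <_) (ℕ.+-comm (rank i) v) N+1<)
        in y-primitive (go y (All.head zeros) ∣Ky)
        where
        K : Vector ℤ v → Vector ℤ v
        -- All values must be solutions, so `y` is projected to sum zero along the first unit
        -- vector. On the `y` killed by `σ` the projection is the identity.
        K y j = y j - 𝟙 zero j * sum y
        K-linear : IsLinearMap K
        K-linear j = +-linear (projection j) (neg-linear (*-linear sum-linear (𝟙 zero j)))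
        sum-K : ∀ y → sum (K y) ≡ 0ℤ
        sum-K y = begin
          sum (K y)                                                    ≡⟨ sum-cong-≗ (λ j → cong (λ x → y j + x) (lemma (𝟙 zero j) (sum y))) ⟩
          ∑[ j < v ] (y j + (- sum y) * 𝟙 zero j)                      ≡⟨ ∑-distrib-+ y (λ j → (- sum y) * 𝟙 {v} zero j) ⟩
          sum y + ∑[ j < v ] ((- sum y) * 𝟙 zero j)                    ≡⟨ cong (λ x → sum y + x) (sym (*-distribˡ-sum (- sum y) (𝟙 {v} zero))) ⟩
          sum y + (- sum y) * sum (𝟙 {v} zero)                         ≡⟨ cong (λ x → sum y + (- sum y) * x) (sum-δ {v} zero) ⟩
          sum y + (- sum y) * 1ℤ                                       ≡⟨ lemma′ (sum y) ⟩
          0ℤ                                                           ∎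
          where
          open ≡-Reasoning
          lemma : ∀ d a → - (d * a) ≡ (- a) * d
          lemma = solve-∀
          lemma′ : ∀ a → a + (- a) * 1ℤ ≡ 0ℤ
          lemma′ = solve-∀
        ∣LK : ∀ y k → + (ℓ ^ suc i) ∣ apply L (w (K y)) k
        ∣LK y k = trans (L-w (K y) k) (trans (cong (λ x → r * w (K y) k - (1ℤ + q) * x) (sum-K y)) (lemma r q _))
                    ≡∣ ∣m⇒∣m*n (w (K y) k) ∣r
          where
          lemma : ∀ r q a → r * a - (1ℤ + q) * 0ℤ ≡ r * a
          lemma = solve-∀
        ℓ∤c : ¬ (+ ℓ ∣ c)
        ℓ∤c ℓ∣c = ℓ∤s (sym c+r≡s ≡∣ ∣m∣n⇒∣m+n ℓ∣c (^∣⇒∣ i ∣r))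
        go : ∀ y → sum y ≡ 0ℤ → (∀ k → + ℓ ∣ w (K y) k) → ∀ j → + ℓ ∣ y j
        go y σ≡0 ∣Ky j = ∣*⇒∣ʳ ℓ-prime c ℓ∤c (sym wᵀ-w-K ≡∣ linear-∣ (wᵀ-linear j) ∣Ky)
          where
          lemma : ∀ a d → a - d * 0ℤ ≡ a
          lemma = solve-∀
          K≗id : ∀ j → K y j ≡ y j
          K≗id j = trans (cong (λ x → y j - 𝟙 zero j * x) σ≡0) (lemma (y j) (𝟙 zero j))
          wᵀ-w-K : wᵀ (w (K y)) j ≡ c * y j
          wᵀ-w-K = begin
            wᵀ (w (K y)) j    ≡⟨ wᵀ-linear j .≗-cong (λ k → w-linear k .≗-cong K≗id) ⟩
            wᵀ (w y) j        ≡⟨ wᵀ-w y j ⟩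
            c * y j + sum y   ≡⟨ cong (λ x → c * y j + x) σ≡0 ⟩
            c * y j + 0ℤ      ≡⟨ +-identityʳ _ ⟩
            c * y j           ∎
            where open ≡-Reasoning

      -- Once the v equations `Wᵀ x = 0` hold, `L x = s x` vanishes modulo ℓ^(i+1).
      rank≤v : ∀ i → + (ℓ ^ suc i) ∣ s → rank i ≤ v
      rank≤v i ∣s = ℕ.≮⇒≥ λ v< →
        let x , zeros , ∤Lx = rank-upper i (List.tabulate f) (subst (_< rank i) (sym (List.length-tabulate f)) v<)
        in ∤Lx λ k → trans (L-apply x k) (trans (cong (λ a → s * x k - a)
             (trans (w-linear k .≗-cong (All.tabulate⁻ {f = f} zeros)) (linear-0 (w-linear k)))) (+-identityʳ _))
             ≡∣ ∣m⇒∣m*n (x k) ∣s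
        where
        f : Fin v → Functional N
        f j = (λ z → wᵀ z j) , wᵀ-linear j

      -- As ℓ may divide m, inverting wᵀ up to a unit takes δ i₀ besides w and constants.
      v≤rank : ∀ i → + (ℓ ^ suc i) ∣ s → ¬ (+ (ℓ ^ suc i) ∣ (c * (1ℤ + q)) * (c * (1ℤ + q))) → v ≤ rank i
      v≤rank i ∣s ∤ = ℕ.≮⇒≥ λ rank<v →
        let y , y-primitive , _ , ∣LYy = rank-lower i {Y = Y} Y-linear []
              (subst (_< v) (sym (ℕ.+-identityʳ (rank i))) rank<v)
        in y-primitive λ j → ^∣*⇒∣ ℓ-prime (suc i) (c₁ * c₁) (∣y y ∣LYy j) ∤
        where
        c₁ = c * (1ℤ + q)
        Y : Vector ℤ v → Vector ℤ N
        -- The term with `sum y` is there to cancel the all-ones part of the Gram matrix: `Wᵀ` sends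
        -- `c 𝟙 i₀ - w (W i₀)` to the constant `-(1 + q)`. Hence `Wᵀ Y` is the scalar `c (1 + q)`.
        Y y k = (1ℤ + q) * w y k + ((c * 𝟙 i₀ k) * sum y + (- w (W i₀) k) * sum y)
        Y-linear : IsLinearMap Y
        Y-linear k = +-linear (*-linear (w-linear k) (1ℤ + q))
          (+-linear (*-linear sum-linear (c * 𝟙 i₀ k)) (*-linear sum-linear (- w (W i₀) k)))
        wᵀ-Y : ∀ y j → wᵀ (Y y) j ≡ c₁ * y j
        wᵀ-Y y j = begin
          wᵀ (Y y) j  ≡⟨ wᵀ-linear j .≗-cong (λ k → cong (λ x → (1ℤ + q) * w y k + x) (regroup c (𝟙 i₀ k) (sum y) (w (W i₀) k))) ⟩
          wᵀ (λ k → (1ℤ + q) * w y k + (c * sum y * 𝟙 i₀ k + (- sum y) * w (W i₀) k)) j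
                      ≡⟨ wᵀ-linear j .+-homo (λ k → (1ℤ + q) * w y k) (λ k → c * sum y * 𝟙 i₀ k + (- sum y) * w (W i₀) k) ⟩
          _           ≡⟨ cong₂ _+_ (wᵀ-linear j .*-homo (1ℤ + q) (w y)) (wᵀ-linear j .+-homo (λ k → c * sum y * 𝟙 i₀ k) (λ k → (- sum y) * w (W i₀) k)) ⟩
          _           ≡⟨ cong₂ (λ a b → (1ℤ + q) * wᵀ (w y) j + (a + b)) (wᵀ-linear j .*-homo (c * sum y) (𝟙 i₀)) (wᵀ-linear j .*-homo (- sum y) (w (W i₀))) ⟩
          (1ℤ + q) * wᵀ (w y) j + (c * sum y * wᵀ (𝟙 i₀) j + (- sum y) * wᵀ (w (W i₀)) j)
                      ≡⟨ cong₂ (λ a b → (1ℤ + q) * a + b) (wᵀ-w y j) (cong₂ (λ a b → c * sum y * a + (- sum y) * b)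
                           (apply-transpose-δ W i₀ j) (trans (wᵀ-w (W i₀) j) (cong (λ x → c * W i₀ j + x) (W-row i₀)))) ⟩
          (1ℤ + q) * (c * y j + sum y) + (c * sum y * W i₀ j + (- sum y) * (c * W i₀ j + (1ℤ + q)))
                      ≡⟨ lemma q c (y j) (sum y) (W i₀ j) ⟩
          c₁ * y j    ∎
          where
          open ≡-Reasoning
          regroup : ∀ c d a b → c * d * a + (- b) * a ≡ c * a * d + (- a) * b
          regroup = solve-∀
          lemma : ∀ q c y a x → (1ℤ + q) * (c * y + a) + (c * a * x + (- a) * (c * x + (1ℤ + q))) ≡ c * (1ℤ + q) * y
          lemma = solve-∀
        ∣y : ∀ y → (∀ k → + (ℓ ^ suc i) ∣ apply L (Y y) k) → ∀ j → + (ℓ ^ suc i) ∣ c₁ * c₁ * y j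
        ∣y y ∣LY j = lemma₃ c q (y j) (sum y) ≡∣
          ∣m∣n⇒∣m-n (∣n⇒∣m*n (1ℤ + q) (∣wᵀw j)) ∣σ
          where
          ∣w : ∀ k → + (ℓ ^ suc i) ∣ c₁ * w y k
          ∣w k = lemma₁ (c₁ * w y k) (s * Y y k) (apply L (Y y) k)
                   (trans (L-apply (Y y) k) (cong (λ x → s * Y y k - x)
                     (trans (w-linear k .≗-cong (wᵀ-Y y)) (w-linear k .*-homo c₁ y))))
                 ≡∣ ∣m∣n⇒∣m-n (∣m⇒∣m*n (Y y k) ∣s) (∣LY k)
            where
            lemma₁ : ∀ a b l → l ≡ b - a → a ≡ b - l
            lemma₁ a b _ refl = lemma a b
              where
              lemma : ∀ a b → a ≡ b - (b - a)
              lemma = solve-∀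
          ∣wᵀw : ∀ j → + (ℓ ^ suc i) ∣ c₁ * (c * y j + sum y)
          ∣wᵀw j = sym (trans (wᵀ-linear j .*-homo c₁ (w y)) (cong (c₁ *_) (wᵀ-w y j))) ≡∣ linear-∣ (wᵀ-linear j) ∣w
          -- Adding up `∣wᵀw` over the points of the line `i₀` and removing `c` times `∣w` isolates
          -- the sum of `y`, which then separates `y j` in `∣wᵀw`.
          ∣σ : + (ℓ ^ suc i) ∣ c₁ * (1ℤ + q) * sum y
          ∣σ = trans (lemma₂ c₁ c q (w y i₀) (sum y)) (cong (λ a → a - c * (c₁ * w y i₀)) (sym wwᵀw))
                 ≡∣ ∣m∣n⇒∣m-n (linear-∣ (w-linear i₀) ∣wᵀw) (∣n⇒∣m*n c (∣w i₀))
            where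
            lemma₂ : ∀ c₁ c q a b → c₁ * (1ℤ + q) * b ≡ c₁ * (c * a + (1ℤ + q) * b) - c * (c₁ * a)
            lemma₂ = solve-∀
            wwᵀw : w (λ j → c₁ * (c * y j + sum y)) i₀ ≡ c₁ * (c * w y i₀ + (1ℤ + q) * sum y)
            wwᵀw = trans (w-linear i₀ .*-homo c₁ (λ j → c * y j + sum y)) (cong (c₁ *_)
              (trans (w-linear i₀ .+-homo (λ j → c * y j) (λ _ → sum y))
                (cong₂ _+_ (w-linear i₀ .*-homo c y) (w-const (sum y) i₀))))
          lemma₃ : ∀ c q y a → c * (1ℤ + q) * (c * (1ℤ + q)) * y ≡
                   (1ℤ + q) * (c * (1ℤ + q) * (c * y + a)) - c * (1ℤ + q) * (1ℤ + q) * a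
          lemma₃ = solve-∀

      -- On vectors of sum zero `L W = r W` and `Wᵀ W = c`, and both scalars are units modulo ℓ.
      v≤rank+1 : ¬ (+ ℓ ∣ r) → ¬ (+ ℓ ∣ c) → v ≤ rank 0 ℕ.+ 1
      v≤rank+1 ℓ∤r ℓ∤c = ℕ.≮⇒≥ λ k< →
        let y , y-primitive , zeros , ∣Lwy = rank-lower 0 {Y = w} w-linear (σ ∷ []) k<
        in y-primitive (go y (All.head zeros) (λ k → ^∣⇒∣ 0 (∣Lwy k)))
        where
        go : ∀ y → sum y ≡ 0ℤ → (∀ k → + ℓ ∣ apply L (w y) k) → ∀ j → + ℓ ∣ y j
        go y σ≡0 ∣Lwy j = ∣*⇒∣ʳ ℓ-prime c ℓ∤c (sym wᵀwy≡ ≡∣ linear-∣ (wᵀ-linear j) ∣wy)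
          where
          lemma : ∀ r q a → r * a ≡ r * a - (1ℤ + q) * 0ℤ
          lemma = solve-∀
          ∣wy : ∀ k → + ℓ ∣ w y k
          ∣wy k = ∣*⇒∣ʳ ℓ-prime r ℓ∤r (trans (lemma r q (w y k))
            (sym (trans (L-w y k) (cong (λ x → r * w y k - (1ℤ + q) * x) σ≡0))) ≡∣ ∣Lwy k)
          wᵀwy≡ : wᵀ (w y) j ≡ c * y j
          wᵀwy≡ = trans (wᵀ-w y j) (trans (cong (λ x → c * y j + x) σ≡0) (+-identityʳ _))

      -- Only v - 1 equations are imposed; they make `Wᵀ x` a constant `t`, so that
      -- `W Wᵀ x = (1 + q) t`. Counting incidences gives `r t = (1 + q) sum x`, hence `r (1 + q) t`
      -- is a multiple of `(1 + q)²`, and `r` can be cancelled.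
      rank<v : ∀ i → + (ℓ ^ suc i) ∣ (1ℤ + q) * (1ℤ + q) → + (ℓ ^ suc i) ∣ s → ¬ (+ ℓ ∣ r) →
               suc (rank i) ≤ v
      rank<v i ∣q² ∣s ℓ∤r = ℕ.≮⇒≥ λ k< →
        let x , zeros , ∤Lx = rank-upper i (List.tabulate f)
              (subst (_< rank i) (sym (List.length-tabulate f)) (s<s⁻¹ k<))
        in ∤Lx (go x (All.tabulate⁻ {f = f} zeros))
        where
        f : Fin (suc v′) → Functional N
        f j = (λ z → wᵀ z (suc j) - wᵀ z zero) , +-linear (wᵀ-linear (suc j)) (neg-linear (wᵀ-linear zero))
        go : ∀ x → (∀ j → wᵀ x (suc j) - wᵀ x zero ≡ 0ℤ) → ∀ k → + (ℓ ^ suc i) ∣ apply L x k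
        go x constant k = trans (L-apply x k) (cong (λ a → s * x k - a) (trans (w-linear k .≗-cong wᵀx) (w-const t k)))
                            ≡∣ ∣m∣n⇒∣m-n (∣m⇒∣m*n (x k) ∣s) (∣-*-cancelʳ ℓ-prime (suc i) ((1ℤ + q) * t) ∣tr ℓ∤r)
          where
          open ≡-Reasoning
          t = wᵀ x zero
          wᵀx : ∀ j → wᵀ x j ≡ t
          wᵀx zero    = refl
          wᵀx (suc j) = i-j≡0⇒i≡j _ _ (constant j)
          ∣tr : + (ℓ ^ suc i) ∣ (1ℤ + q) * t * r
          ∣tr = (begin
            (1ℤ + q) * t * r                 ≡⟨ *-assoc (1ℤ + q) t r ⟩
            (1ℤ + q) * (t * r)               ≡⟨ cong ((1ℤ + q) *_) (trans (*-comm t r) (sym (sum-const v t))) ⟩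
            (1ℤ + q) * sum {v} (λ _ → t)     ≡⟨ cong ((1ℤ + q) *_) (sum-cong-≗ wᵀx) ⟨
            (1ℤ + q) * sum (wᵀ x)            ≡⟨ cong ((1ℤ + q) *_) (sum-wᵀ x) ⟩
            (1ℤ + q) * ((1ℤ + q) * sum x)    ≡⟨ *-assoc (1ℤ + q) (1ℤ + q) (sum x) ⟨
            (1ℤ + q) * (1ℤ + q) * sum x      ∎) ≡∣ ∣m⇒∣m*n (sum x) ∣q²

      -- Modulo ℓ, `L Xᵀ y = -q W y`, after which `X` recovers `y`. The first of the two equations
      -- makes `Wᵀ Xᵀ` the scalar `q`, the second does the same for `X W`.
      v≤rank+2 : + ℓ ∣ s → ¬ (+ ℓ ∣ q) → v ≤ rank 0 ℕ.+ 2
      v≤rank+2 ℓ∣s ℓ∤q = ℕ.≮⇒≥ λ k< →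
        let y , y-primitive , zeros , ∣Lxy = rank-lower 0 {Y = χᵀ} χᵀ-linear
              (σ ∷ ((λ y → y zero) , projection zero) ∷ []) k<
        in y-primitive (go y (All.head zeros) (All.head (All.tail zeros)) (λ k → ^∣⇒∣ 0 (∣Lxy k)))
        where
        go : ∀ y → sum y ≡ 0ℤ → y zero ≡ 0ℤ → (∀ k → + ℓ ∣ apply L (χᵀ y) k) → ∀ j → + ℓ ∣ y j
        go y σ≡0 y₀≡0 ∣Lχᵀy j = ∣*⇒∣ʳ ℓ-prime q ℓ∤q (sym χwy≡ ≡∣ linear-∣ (χ-linear j) ∣wy)
          where
          lemma : ∀ a b l → l ≡ b - a → a ≡ b - l
          lemma a b _ refl = solved a b
            where
            solved : ∀ a b → a ≡ b - (b - a)
            solved = solve-∀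
          ∣wy : ∀ k → + ℓ ∣ w y k
          ∣wy k = ∣*⇒∣ʳ ℓ-prime q ℓ∤q (lemma (q * w y k) (s * χᵀ y k) (apply L (χᵀ y) k)
            (trans (L-apply (χᵀ y) k) (cong (λ x → s * χᵀ y k - x)
              (trans (w-linear k .≗-cong (wᵀ-χᵀ y σ≡0)) (w-linear k .*-homo q y))))
            ≡∣ ∣m∣n⇒∣m-n (∣m⇒∣m*n (χᵀ y k) ℓ∣s) (∣Lχᵀy k))
          χwy≡ : χ (w y) j ≡ q * y j
          χwy≡ = trans (χ-w y j) (trans (cong (λ x → q * y j + (- q) * x) y₀≡0)
            (trans (cong (λ x → q * y j + x) (*-zeroʳ (- q))) (+-identityʳ _)))

      -- Only v - 2 equations: `u = Wᵀ x` is made equal to `t` except at point 1. There `u - t`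
      -- equals `sum u - r t = (1 + q) sum x - r t`, which is divisible for free. So `u` is constant
      -- modulo ℓ^(i+1), and `W` kills constants modulo `1 + q`.
      rank+2≤v : ∀ i → + (ℓ ^ suc i) ∣ 1ℤ + q → + (ℓ ^ suc i) ∣ s → + (ℓ ^ suc i) ∣ r → rank i ℕ.+ 2 ≤ v
      rank+2≤v i ∣1+q ∣s ∣r = ℕ.≮⇒≥ λ k< →
        let x , zeros , ∤Lx = rank-upper i (List.tabulate f)
              (subst (_< rank i) (sym (List.length-tabulate f))
                (s<s⁻¹ (s<s⁻¹ (subst (v <_) (ℕ.+-comm (rank i) 2) k<))))
        in ∤Lx (go x (All.tabulate⁻ {f = f} zeros))
        where
        f : Fin v′ → Functional N
        f j = (λ z → wᵀ z (suc (suc j)) - wᵀ z zero) , +-linear (wᵀ-linear (suc (suc j))) (neg-linear (wᵀ-linear zero))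
        go : ∀ x → (∀ j → wᵀ x (suc (suc j)) - wᵀ x zero ≡ 0ℤ) → ∀ k → + (ℓ ^ suc i) ∣ apply L x k
        go x constant k = L-apply x k ≡∣ ∣m∣n⇒∣m-n (∣m⇒∣m*n (x k) ∣s) (sym w-u ≡∣
            ∣m∣n⇒∣m+n (linear-∣ (w-linear k) ∣u-t) (w-const t k ≡∣ ∣m⇒∣m*n t ∣1+q))
          where
          open ≡-Reasoning
          u = wᵀ x
          t = u zero
          σu : (1ℤ + q) * sum x - r * t ≡ u (suc zero) - t
          σu = begin
            (1ℤ + q) * sum x - r * t                                        ≡⟨ cong (λ a → a - r * t) (sum-wᵀ x) ⟨
            t + (u (suc zero) + ∑[ j < v′ ] u (suc (suc j))) - r * t        ≡⟨ cong (λ a → t + (u (suc zero) + a) - r * t) (trans (sum-cong-≗ (λ j → i-j≡0⇒i≡j _ _ (constant j))) (sum-const v′ t)) ⟩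
            t + (u (suc zero) + + v′ * t) - r * t                           ≡⟨ lemma t (u (suc zero)) (+ v′) ⟩
            u (suc zero) - t                                                ∎
            where
            lemma : ∀ t a n → t + (a + n * t) - (+ 2 + n) * t ≡ a - t
            lemma = solve-∀
          ∣u-t : ∀ j → + (ℓ ^ suc i) ∣ u j - t
          ∣u-t zero          = ∣0 (+-inverseʳ t)
          ∣u-t (suc zero)    = sym σu ≡∣ ∣m∣n⇒∣m-n (∣m⇒∣m*n (sum x) ∣1+q) (∣m⇒∣m*n t ∣r)
          ∣u-t (suc (suc j)) = ∣0 (constant j)
          w-u : w (λ j → u j - t) k + w (λ _ → t) k ≡ w u k
          w-u = trans (sym (w-linear k .+-homo (λ j → u j - t) (λ _ → t))) (w-linear k .≗-cong (λ j → lemma (u j) t))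
            where
            lemma : ∀ a t → a - t + t ≡ a
            lemma = solve-∀

      -- Here `W` itself does not give enough solutions, as `r` alone need not be divisible by
      -- ℓ^(i+1). By `L-quadratic`, `(r + s - L) z` is a solution for every `z` of sum zero, and all
      -- vectors `Xᵀ y` have sum zero.
      rank+v≤N+1′ : ∀ i → + (ℓ ^ suc i) ∣ r * s → + ℓ ∣ r → + ℓ ∣ 1ℤ + q → ¬ (+ ℓ ∣ q) → rank i ℕ.+ v ≤ N ℕ.+ 1
      rank+v≤N+1′ i ∣rs ℓ∣r ℓ∣1+q ℓ∤q = ℕ.≮⇒≥ λ N+1< →
        let y , y-primitive , zeros , ∣Ky = corank-lower i {K = K}
              K-linear ∣LK (σ ∷ []) (subst (N ℕ.+ 1 <_) (ℕ.+-comm (rank i) v) N+1<)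
        in y-primitive (go y (All.head zeros) ∣Ky)
        where
        K : Vector ℤ v → Vector ℤ N
        -- For `sum y = 0` the bracket is `q W y` modulo ℓ, and it vanishes on constant `y`, since ℓ
        -- divides `1 + q`. Adding the constant vector `y zero`, which `L` kills, restores
        -- injectivity modulo ℓ.
        K y k = ((r + s) * χᵀ y k - apply L (χᵀ y) k) + y zero
        K-linear : IsLinearMap K
        K-linear k = +-linear (+-linear (*-linear (χᵀ-linear k) (r + s)) (neg-linear (∘-linear (L-linear k) χᵀ-linear)))
          (projection zero)
        ∣LK : ∀ y k → + (ℓ ^ suc i) ∣ apply L (K y) k
        ∣LK y k = trans (L-linear k .+-homo (λ k → (r + s) * χᵀ y k - apply L (χᵀ y) k) (λ _ → y zero))
                    (trans (cong₂ _+_ (L-quadratic (χᵀ y) (sum-χᵀ y) k) (L-const (y zero) k)) (+-identityʳ _))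
                  ≡∣ ∣m⇒∣m*n (χᵀ y k) ∣rs
        go : ∀ y → sum y ≡ 0ℤ → (∀ k → + ℓ ∣ K y k) → ∀ j → + ℓ ∣ y j
        go y σ≡0 ∣Ky j = lemma₂ (y j) t ≡∣ ∣m∣n⇒∣m+n (∣y-t j) ∣t
          where
          open ≡-Reasoning
          t = y zero
          lemma₂ : ∀ a t → a ≡ a - t + t
          lemma₂ = solve-∀
          K-rχᵀ : ∀ k → q * w y k + t ≡ K y k - r * χᵀ y k
          K-rχᵀ k = begin
            q * w y k + t                                           ≡⟨ lemma r s (χᵀ y k) (q * w y k) t ⟩
            ((r + s) * χᵀ y k - (s * χᵀ y k - q * w y k)) + t - r * χᵀ y k  ≡⟨ cong (λ a → ((r + s) * χᵀ y k - a) + t - r * χᵀ y k) (sym Lχᵀ) ⟩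
            K y k - r * χᵀ y k                                      ∎
            where
            lemma : ∀ r s a b t → b + t ≡ ((r + s) * a - (s * a - b)) + t - r * a
            lemma = solve-∀
            Lχᵀ : apply L (χᵀ y) k ≡ s * χᵀ y k - q * w y k
            Lχᵀ = trans (L-apply (χᵀ y) k) (cong (λ x → s * χᵀ y k - x)
              (trans (w-linear k .≗-cong (wᵀ-χᵀ y σ≡0)) (w-linear k .*-homo q y)))
          ∣qw+t : ∀ k → + ℓ ∣ q * w y k + t
          ∣qw+t k = K-rχᵀ k ≡∣ ∣m∣n⇒∣m-n (∣Ky k) (∣m⇒∣m*n (χᵀ y k) ℓ∣r)
          ∣y-t : ∀ j → + ℓ ∣ y j - t
          ∣y-t j = ∣*⇒∣ʳ ℓ-prime q ℓ∤q (∣*⇒∣ʳ ℓ-prime q ℓ∤q (χqw ≡∣ linear-∣ (χ-linear j) ∣qw+t))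
            where
            lemma : ∀ q a t → q * (q * (a - t)) ≡ q * (q * a + (- q) * t) + 0ℤ
            lemma = solve-∀
            χqw : q * (q * (y j - t)) ≡ χ (λ k → q * w y k + t) j
            χqw = begin
              q * (q * (y j - t))                             ≡⟨ lemma q (y j) t ⟩
              q * (q * y j + (- q) * t) + 0ℤ                  ≡⟨ cong₂ (λ a b → q * a + b) (χ-w y j) (χ-const t j) ⟨
              q * χ (w y) j + χ (λ _ → t) j                   ≡⟨ cong (λ a → a + χ (λ _ → t) j) (χ-linear j .*-homo q (w y)) ⟨
              χ (λ k → q * w y k) j + χ (λ _ → t) j           ≡⟨ χ-linear j .+-homo (λ k → q * w y k) (λ _ → t) ⟨
              χ (λ k → q * w y k + t) j                       ∎
          ∣w : + ℓ ∣ w y i₀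
          ∣w = sym (trans (sym (w-linear i₀ .+-homo (λ j → y j - t) (λ _ → t)))
                     (w-linear i₀ .≗-cong (λ j → sym (lemma₂ (y j) t))))
               ≡∣ ∣m∣n⇒∣m+n (linear-∣ (w-linear i₀) ∣y-t) (w-const t i₀ ≡∣ ∣m⇒∣m*n t ℓ∣1+q)
          ∣t : + ℓ ∣ t
          ∣t = ∣m+n∣m⇒∣n (∣qw+t i₀) (∣n⇒∣m*n q ∣w)

  -- Counting by sums of indicators

  indicator : ∀ {a} {A : Set a} → Dec A → ℤ
  indicator d = if ⌊ d ⌋ then 1ℤ else 0ℤ

  indicator-yes : ∀ {a} {A : Set a} (d : Dec A) → A → indicator d ≡ 1ℤ
  indicator-yes (yes _) _ = refl
  indicator-yes (no ¬a) a = contradiction a ¬a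

  indicator-no : ∀ {a} {A : Set a} (d : Dec A) → ¬ A → indicator d ≡ 0ℤ
  indicator-no (yes a) ¬a = contradiction a ¬a
  indicator-no (no _)  _  = refl

  indicator-× : ∀ {a b} {A : Set a} {B : Set b} (d : Dec A) (e : Dec B) →
                indicator d * indicator e ≡ indicator (d ×-dec e)
  indicator-× (yes _) (yes _) = refl
  indicator-× (yes _) (no _)  = refl
  indicator-× (no _)  e       = *-zeroˡ (indicator e)

  indicator-idem : ∀ {a} {A : Set a} (d : Dec A) → indicator d * indicator d ≡ indicator d
  indicator-idem (yes _) = refl
  indicator-idem (no _)  = refl

  sum-indicator : ∀ {n m p} {P : Pred (Fin m) p} (P? : Decidable P) (f : Fin n → Fin m) →
                  ∑[ j < n ] indicator (P? (f j)) ≡ + length (filter P? (List.tabulate f))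
  sum-indicator {zero}  P? f = refl
  sum-indicator {suc n} P? f with P? (f zero)
  ... | yes _ = cong (λ x → 1ℤ + x) (sum-indicator P? (f ∘ suc))
  ... | no _  = trans (+-identityˡ _) (sum-indicator P? (f ∘ suc))

  sum-indicator-allFin : ∀ {n p} {P : Pred (Fin n) p} (P? : Decidable P) →
                         ∑[ j < n ] indicator (P? j) ≡ + length (filter P? (allFin n))
  sum-indicator-allFin P? = sum-indicator P? id

  module _ {v p} {P : Pred (Fin v) p} (P? : Decidable P) where

    sum-image : ∀ {k} (φ : Fin k → Fin v) → (∀ a b → φ a ≡ φ b → a ≡ b) → (∀ a → P (φ a)) →
                (∀ {j} → P j → ∃ λ a → φ a ≡ j) → ∑[ j < v ] indicator (P? j) ≡ + k
    sum-image {k} φ injective P-φ surjective = begin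
      ∑[ j < v ] indicator (P? j)             ≡⟨ sum-cong-≗ fibre ⟩
      ∑[ j < v ] ∑[ a < k ] 𝟙 (φ a) j         ≡⟨ ∑-comm (λ j a → 𝟙 (φ a) j) ⟩
      ∑[ a < k ] ∑[ j < v ] 𝟙 (φ a) j         ≡⟨ sum-cong-≗ (λ a → sum-δ (φ a)) ⟩
      ∑[ a < k ] 1ℤ                           ≡⟨ sum-const k 1ℤ ⟩
      + k * 1ℤ                                ≡⟨ *-identityʳ (+ k) ⟩
      + k                                     ∎
      where
      open ≡-Reasoning
      fibre : ∀ j → indicator (P? j) ≡ ∑[ a < k ] 𝟙 (φ a) j
      fibre j with P? j
      ... | no ¬Pj = sym (trans (sum-cong-≗ {k} (λ a → diagonal-≢ (λ _ → 1ℤ) λ { refl → ¬Pj (P-φ a) })) (sum-replicate-zero k))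
      ... | yes Pj with surjective Pj
      ...   | a , refl = sym (trans (sum-cong-≗ {k} 𝟙-φ) (sum-δ a))
        where
        𝟙-φ : ∀ b → 𝟙 (φ b) (φ a) ≡ 𝟙 a b
        𝟙-φ b with a ≟ᶠ b
        ... | yes refl = diagonal-refl (λ _ → 1ℤ) (φ a)
        ... | no a≢b   = diagonal-≢ (λ _ → 1ℤ) (λ eq → a≢b (sym (injective b a eq)))

    sum-unique : ∀ {j₀} → P j₀ → (∀ {j} → P j → j ≡ j₀) → ∑[ j < v ] indicator (P? j) ≡ 1ℤ
    sum-unique {j₀} Pj₀ unique = sum-image {1} (λ _ → j₀) (λ { zero zero _ → refl }) (λ _ → Pj₀)
      (λ Pj → zero , sym (unique Pj))

    sum-none : (∀ j → ¬ P j) → ∑[ j < v ] indicator (P? j) ≡ 0ℤ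
    sum-none ¬P = trans (sum-cong-≗ (λ j → indicator-no (P? j) (¬P j))) (sum-replicate-zero v)

    sum-all : (∀ j → P j) → ∑[ j < v ] indicator (P? j) ≡ + v
    sum-all all = trans (sum-cong-≗ (λ j → indicator-yes (P? j) (all j))) (trans (sum-const v 1ℤ) (*-identityʳ (+ v)))

  -- The order of a finite abelian group of given exponent

  sum-shift : ∀ m (h : ℕ → ℤ) → h m ≡ h 0 → ∑[ c < m ] h (suc (toℕ c)) ≡ ∑[ c < m ] h (toℕ c)
  sum-shift m h hm≡h0 = ∙-cancelˡ (h 0) _ _ (begin
    h 0 + ∑[ c < m ] h (suc (toℕ c))                   ≡⟨ sum-init-last (λ (c : Fin (suc m)) → h (toℕ c)) ⟩
    ∑[ c < m ] h (toℕ (inject₁ c)) + h (toℕ (fromℕ m)) ≡⟨ cong₂ _+_ (sum-cong-≗ {m} (λ c → cong h (Fin.toℕ-inject₁ c))) (trans (cong h (Fin.toℕ-fromℕ m)) hm≡h0) ⟩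
    ∑[ c < m ] h (toℕ c) + h 0                         ≡⟨ +-comm _ (h 0) ⟩
    h 0 + ∑[ c < m ] h (toℕ c)                         ∎)
    where
    open ≡-Reasoning
    open import Algebra.Properties.Group (AbelianGroup.group +-0-abelianGroup) using (∙-cancelˡ)

  -- Each element of G is a combination ∑ cᵢ gᵢ, 0 ≤ cᵢ < m, of the list of all
  -- elements in the same number of ways, as this number is invariant under
  -- translation.
  module _ {a b} (G : AbelianGroup a b) {κ : ℕ} (size : HasSize (AbelianGroup.setoid G) κ) {m : ℕ}
           (exponent : ∀ x → AbelianGroup._≈_ G (Mult._×_ (AbelianGroup.commutativeMonoid G) m x) (AbelianGroup.ε G)) where
    private
      module G = AbelianGroup G
      open G using (Carrier; _∙_; ε; _≈_; _⁻¹)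
      open Mult G.commutativeMonoid using () renaming (_×_ to _·_)
      open import Algebra.Properties.CommutativeSemigroup G.commutativeSemigroup using (xy∙z≈xz∙y)
      open Inverse size

      combinations : List Carrier → Carrier → ℤ
      combinations []       x = 𝟙 (from ε) (from x)
      combinations (g ∷ gs) x = ∑[ c < m ] combinations gs (x ∙ (toℕ c · g))

      combinations-resp : ∀ gs {x y} → x ≈ y → combinations gs x ≡ combinations gs y
      combinations-resp []       x≈y = cong (𝟙 (from ε)) (from-cong x≈y)
      combinations-resp (g ∷ gs) x≈y = sum-cong-≗ {m} (λ c → combinations-resp gs (G.∙-congʳ x≈y))

      -- Translation by a listed `g` only shifts its coefficient by one, cyclically modulo the
      -- exponent `m`.
      invariant : ∀ {g} gs → g ∈ gs → ∀ x → combinations gs (x ∙ g) ≡ combinations gs x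
      invariant {g} (g ∷ gs) (here refl) x = begin
        ∑[ c < m ] combinations gs (x ∙ g ∙ (toℕ c · g))    ≡⟨ sum-cong-≗ {m} (λ c → combinations-resp gs (G.assoc x g _)) ⟩
        ∑[ c < m ] combinations gs (x ∙ (suc (toℕ c) · g))  ≡⟨ sum-shift m (λ c → combinations gs (x ∙ (c · g))) (combinations-resp gs (G.∙-congˡ (exponent g))) ⟩
        ∑[ c < m ] combinations gs (x ∙ (toℕ c · g))        ∎
        where open ≡-Reasoning
      invariant {g} (h ∷ gs) (there g∈gs) x = sum-cong-≗ {m} (λ c →
        trans (combinations-resp gs (xy∙z≈xz∙y x g _)) (invariant gs g∈gs _))

      total : (Carrier → ℤ) → ℤ
      total f = ∑[ i < κ ] f (to i)

      translation : Carrier → Permutation κ κ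
      translation y = permutation (λ i → from (to i ∙ y)) (λ i → from (to i ∙ y ⁻¹))
        (λ i → cancel i (y ⁻¹) y (G.inverseˡ y)) (λ i → cancel i y (y ⁻¹) (G.inverseʳ y))
        where
        cancel : ∀ i y z → y ∙ z ≈ ε → from (to (from (to i ∙ y)) ∙ z) ≡ i
        cancel i y z yz≈ε = trans (from-cong (G.trans (G.∙-congʳ (strictlyInverseˡ _))
          (G.trans (G.assoc _ y z) (G.trans (G.∙-congˡ yz≈ε) (G.identityʳ _))))) (strictlyInverseʳ i)

      total-translate : ∀ gs y → total (λ x → combinations gs (x ∙ y)) ≡ total (combinations gs)
      total-translate gs y = sym (trans (sum-permute (λ i → combinations gs (to i)) (translation y))
        (sum-cong-≗ {κ} (λ i → combinations-resp gs (strictlyInverseˡ _))))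

      total-combinations : ∀ gs → total (combinations gs) ≡ + (m ^ length gs)
      total-combinations []       = trans (sum-cong-≗ (λ i → cong (𝟙 (from ε)) (strictlyInverseʳ i))) (sum-δ (from ε))
      total-combinations (g ∷ gs) = begin
        ∑[ i < κ ] ∑[ c < m ] combinations gs (to i ∙ (toℕ c · g))  ≡⟨ ∑-comm {κ} {m} (λ i c → combinations gs (to i ∙ (toℕ c · g))) ⟩
        ∑[ c < m ] total (λ x → combinations gs (x ∙ (toℕ c · g)))  ≡⟨ sum-cong-≗ {m} (λ c → total-translate gs (toℕ c · g)) ⟩
        ∑[ c < m ] total (combinations gs)                          ≡⟨ sum-const m _ ⟩
        + m * total (combinations gs)                               ≡⟨ cong (+ m *_) (total-combinations gs) ⟩
        + m * + (m ^ length gs)                                     ≡⟨ pos-* m (m ^ length gs) ⟨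
        + (m ^ length (g ∷ gs))                                     ∎
        where open ≡-Reasoning

      elements : List Carrier
      elements = List.tabulate to

      constant : ∀ x → combinations elements x ≡ combinations elements ε
      constant x = begin
        combinations elements x                  ≡⟨ combinations-resp elements (G.sym (G.trans (G.identityˡ _) (strictlyInverseˡ x))) ⟩
        combinations elements (ε ∙ to (from x))  ≡⟨ invariant elements (∈-tabulate⁺ (from x)) ε ⟩
        combinations elements ε                  ∎
        where open ≡-Reasoning

    size∣exponent^size : κ ℕ.∣ m ^ κ
    size∣exponent^size = subst (λ k → κ ℕ.∣ m ^ k) (List.length-tabulate to) (∣⇒∣ᵤ {+ κ} {+ (m ^ length elements)}
      (divides (combinations elements ε) (begin
        + (m ^ length elements)              ≡⟨ total-combinations elements ⟨
        total (combinations elements)        ≡⟨ sum-cong-≗ (λ i → constant (to i)) ⟩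
        ∑[ i < κ ] combinations elements ε   ≡⟨ sum-const κ _ ⟩
        + κ * combinations elements ε        ≡⟨ *-comm (+ κ) _ ⟩
        combinations elements ε * + κ        ∎)))
      where open ≡-Reasoning

  -- From rank bounds to multiplicities

  module Profile {e ρ : ℕ → ℕ} (e-zero : e 0 ≡ ρ 0) (e-suc : ∀ i → e (suc i) ℕ.+ ρ i ≡ ρ (suc i)) where
    open ℕ.≤-Reasoning

    ρ-mono : ∀ {i j} → i ≤ j → ρ i ≤ ρ j
    ρ-mono i≤j = go (ℕ.≤⇒≤′ i≤j)
      where
      go : ∀ {i j} → i ℕ.≤′ j → ρ i ≤ ρ j
      go ℕ.≤′-refl              = ℕ.≤-refl
      go {i} (ℕ.≤′-step {j} i≤j) = begin
        ρ i                  ≤⟨ go i≤j ⟩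
        ρ j                  ≤⟨ ℕ.m≤n+m (ρ j) (e (suc j)) ⟩
        e (suc j) ℕ.+ ρ j    ≡⟨ e-suc j ⟩
        ρ (suc j)            ∎

    jump : ∀ {i x y} → x ≤ ρ i → ρ i ≤ x → y ≤ ρ (suc i) → ρ (suc i) ≤ y → e (suc i) ℕ.+ x ≡ y
    jump {i} x≤ ≤x y≤ ≤y = trans (cong (e (suc i) ℕ.+_) (ℕ.≤-antisym x≤ ≤x)) (trans (e-suc i) (ℕ.≤-antisym ≤y y≤))

    flat : ∀ {i x} → x ≤ ρ i → ρ (suc i) ≤ x → e (suc i) ≡ 0
    flat {i} {x} x≤ ≤x = ℕ.n≤0⇒n≡0 (ℕ.+-cancelʳ-≤ (ρ i) (e (suc i)) 0 (begin
      e (suc i) ℕ.+ ρ i   ≡⟨ e-suc i ⟩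
      ρ (suc i)           ≤⟨ ≤x ⟩
      x                   ≤⟨ x≤ ⟩
      ρ i                 ∎))

    -- As `ρ` is monotone, a lower bound at the left end of a plateau and an upper bound at its
    -- right end fix it in between: `ρ` is `x` up to `a` and `y` from `suc a` on.
    two-steps : ∀ a {x y} → x ≤ ρ 0 → ρ a ≤ x → y ≤ ρ (suc a) → (∀ i → ρ i ≤ y) →
                e (suc a) ℕ.+ x ≡ y × e 0 ≡ x × e VanishesOff (suc a ∷ 0 ∷ [])
    two-steps a {x} {y} x≤ρ0 ρa≤x y≤ρ ρ≤y =
      jump (ℕ.≤-trans x≤ρ0 (ρ-mono ℕ.z≤n)) ρa≤x y≤ρ (ρ≤y _) ,
      trans e-zero (ℕ.≤-antisym (ℕ.≤-trans (ρ-mono ℕ.z≤n) ρa≤x) x≤ρ0) ,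
      vanishes
      where
      vanishes : e VanishesOff (suc a ∷ 0 ∷ [])
      vanishes zero    0∉ = contradiction (there (here refl)) 0∉
      vanishes (suc i) i∉ with ℕ.<-cmp i a
      ... | tri< i<a _ _ = flat (ℕ.≤-trans x≤ρ0 (ρ-mono ℕ.z≤n)) (ℕ.≤-trans (ρ-mono i<a) ρa≤x)
      ... | tri≈ _ refl _ = contradiction (here refl) i∉
      ... | tri> _ _ a<i = flat (ℕ.≤-trans y≤ρ (ρ-mono a<i)) (ρ≤y _)

    three-steps : ∀ a b {x y z} → a < b → x ≤ ρ 0 → ρ a ≤ x → y ≤ ρ (suc a) → ρ b ≤ y → z ≤ ρ (suc b) → (∀ i → ρ i ≤ z) →
                  e (suc b) ℕ.+ y ≡ z × e (suc a) ℕ.+ x ≡ y × e 0 ≡ x × e VanishesOff (suc b ∷ suc a ∷ 0 ∷ [])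
    three-steps a b {x} {y} {z} a<b x≤ρ0 ρa≤x y≤ρ ρb≤y z≤ρ ρ≤z =
      jump (ℕ.≤-trans y≤ρ (ρ-mono a<b)) ρb≤y z≤ρ (ρ≤z _) ,
      jump (ℕ.≤-trans x≤ρ0 (ρ-mono ℕ.z≤n)) ρa≤x y≤ρ (ℕ.≤-trans (ρ-mono a<b) ρb≤y) ,
      trans e-zero (ℕ.≤-antisym (ℕ.≤-trans (ρ-mono ℕ.z≤n) ρa≤x) x≤ρ0) ,
      vanishes
      where
      vanishes : e VanishesOff (suc b ∷ suc a ∷ 0 ∷ [])
      vanishes zero    0∉ = contradiction (there (there (here refl))) 0∉
      vanishes (suc i) i∉ with ℕ.<-cmp i a | ℕ.<-cmp i b
      ... | tri< i<a _ _  | _ = flat (ℕ.≤-trans x≤ρ0 (ρ-mono ℕ.z≤n)) (ℕ.≤-trans (ρ-mono i<a) ρa≤x)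
      ... | tri≈ _ refl _ | _ = contradiction (there (here refl)) i∉
      ... | tri> _ _ a<i  | tri< i<b _ _  = flat (ℕ.≤-trans y≤ρ (ρ-mono a<i)) (ℕ.≤-trans (ρ-mono i<b) ρb≤y)
      ... | tri> _ _ a<i  | tri≈ _ refl _ = contradiction (here refl) i∉
      ... | tri> _ _ a<i  | tri> _ _ b<i  = flat (ℕ.≤-trans z≤ρ (ρ-mono b<i)) (ρ≤z _)

  module _ {ℓ : ℕ} (ℓ-prime : Prime ℓ) where
    private
      instance
        ℓ≢0 = prime⇒nonZero ℓ-prime

    ∤⇒valuation : ∀ {x} → ℓ ℕ.∤ x → Valuation ℓ x 0
    ∤⇒valuation ℓ∤x = ℕ.1∣ _ , λ ℓ∣x → ℓ∤x (subst (ℕ._∣ _) (ℕ.*-identityʳ ℓ) ℓ∣x)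

    valuation-suc : ∀ {x} i → ℓ ℕ.∣ x → Valuation ℓ x i → ∃ λ j → i ≡ suc j
    valuation-suc zero    ℓ∣x (_ , ∤x) = contradiction (subst (ℕ._∣ _) (sym (ℕ.*-identityʳ ℓ)) ℓ∣x) ∤x
    valuation-suc (suc i) _   _        = i , refl

    valuation-* : ∀ {x y} i j → Valuation ℓ x i → Valuation ℓ y j → Valuation ℓ (x ℕ.* y) (i ℕ.+ j)
    valuation-* {x} {y} i j (ℕ.divides x′ refl , ∤x) (ℕ.divides y′ refl , ∤y) =
      ℕ.divides (x′ ℕ.* y′) product , λ ∣xy → not (ℕ.*-cancelʳ-∣ (ℓ ^ (i ℕ.+ j)) {{ℕ.m^n≢0 ℓ (i ℕ.+ j)}} (subst (ℓ ℕ.* ℓ ^ (i ℕ.+ j) ℕ.∣_) product ∣xy))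
      where
      product : x′ ℕ.* ℓ ^ i ℕ.* (y′ ℕ.* ℓ ^ j) ≡ x′ ℕ.* y′ ℕ.* ℓ ^ (i ℕ.+ j)
      product = trans (ℕ-interchange x′ (ℓ ^ i) y′ (ℓ ^ j)) (cong (x′ ℕ.* y′ ℕ.*_) (sym (ℕ.^-distribˡ-+-* ℓ i j)))
        where
        open import Algebra.Properties.CommutativeSemigroup ℕ.*-commutativeSemigroup renaming (interchange to ℕ-interchange)
      not : ℓ ℕ.∤ x′ ℕ.* y′
      not ℓ∣ with euclidsLemma x′ y′ ℓ-prime ℓ∣
      ... | inj₁ (ℕ.divides x″ refl) = ∤x (ℕ.divides x″ (ℕ.*-assoc x″ ℓ (ℓ ^ i)))
      ... | inj₂ (ℕ.divides y″ refl) = ∤y (ℕ.divides y″ (ℕ.*-assoc y″ ℓ (ℓ ^ j)))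

  prime∣^⇒∣ : ∀ {p} → Prime p → ∀ m k → p ℕ.∣ m ^ k → p ℕ.∣ m
  prime∣^⇒∣ p-prime m zero    p∣1 = contradiction (ℕ.∣1⇒≡1 p∣1) (ℕ.nonTrivial⇒≢1 {{prime⇒nonTrivial p-prime}})
  prime∣^⇒∣ p-prime m (suc k) p∣ with euclidsLemma m (m ^ k) p-prime p∣
  ... | inj₁ p∣m  = p∣m
  ... | inj₂ p∣mᵏ = prime∣^⇒∣ p-prime m k p∣mᵏ

  ^-monoʳ-∣ : ∀ ℓ {i j} → i ≤ j → ℓ ^ i ℕ.∣ ℓ ^ j
  ^-monoʳ-∣ ℓ {i} {j} i≤j = ℕ.divides (ℓ ^ (j ℕ.∸ i)) (begin
    ℓ ^ j                        ≡⟨ cong (ℓ ^_) (ℕ.m∸n+n≡m i≤j) ⟨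
    ℓ ^ (j ℕ.∸ i ℕ.+ i)          ≡⟨ ℕ.^-distribˡ-+-* ℓ (j ℕ.∸ i) i ⟩
    ℓ ^ (j ℕ.∸ i) ℕ.* ℓ ^ i      ∎)
    where open ≡-Reasoning

  ∤-* : ∀ {p} → Prime p → ∀ {x y} → p ℕ.∤ x → p ℕ.∤ y → p ℕ.∤ x ℕ.* y
  ∤-* p-prime p∤x p∤y p∣xy with euclidsLemma _ _ p-prime p∣xy
  ... | inj₁ p∣x = p∤x p∣x
  ... | inj₂ p∣y = p∤y p∣y

  -- Critical group and multiplicities, case by case

  module Multiplicities
    {N v′ : ℕ} {L : Matrix N N} {q C : ℕ} (incidence : Incidence (suc (suc v′)) L (+ q) (+ suc C))
    (V≡1+qM : suc (suc v′) ≡ 1 ℕ.+ q ℕ.* suc C) (q<M : q < suc C)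
    where

    private
      V M Q : ℕ
      V = suc (suc v′)
      M = suc C
      Q = suc q

    open Incidence incidence using (W; W-row; W-column)

    private
      G = N ℕ.∸ V

      double-count : N ℕ.* Q ≡ V ℕ.* M
      double-count = +-injective (begin
        + (N ℕ.* Q)                     ≡⟨ pos-* N Q ⟩
        + N * + Q                       ≡⟨ sum-const N (+ Q) ⟨
        ∑[ i < N ] (+ Q)                ≡⟨ sum-cong-≗ W-row ⟨
        ∑[ i < N ] ∑[ j < V ] W i j     ≡⟨ ∑-comm W ⟩
        ∑[ j < V ] ∑[ i < N ] W i j     ≡⟨ sum-cong-≗ W-column ⟩
        ∑[ j < V ] (+ M)                ≡⟨ sum-const V (+ M) ⟩
        + V * + M                       ≡⟨ pos-* V M ⟨
        + (V ℕ.* M)                     ∎)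
        where open ≡-Reasoning

      -- The double count with `Q ≤ M`. It makes the truncated subtraction in `G` exact.
      V≤N : V ≤ N
      V≤N = ℕ.*-cancelʳ-≤ V N Q (begin
        V ℕ.* Q   ≤⟨ ℕ.*-monoʳ-≤ V q<M ⟩
        V ℕ.* M   ≡⟨ double-count ⟨
        N ℕ.* Q   ∎)
        where open ℕ.≤-Reasoning

      N≡V+G : N ≡ V ℕ.+ G
      N≡V+G = sym (ℕ.m+[n∸m]≡n V≤N)

      i₀ : Fin N
      i₀ = subst Fin (sym N≡V+G) zero

      c+r≡s : + M - 1ℤ + + V ≡ (1ℤ + + q) * + M
      c+r≡s = trans (cong (λ x → + M - 1ℤ + x) (trans (cong +_ V≡1+qM) (cong (λ x → 1ℤ + x) (pos-* q M))))
        (lemma (+ M) (+ q))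
        where
        lemma : ∀ m q → m - 1ℤ + (1ℤ + q * m) ≡ (1ℤ + q) * m
        lemma = solve-∀

    open Laplacian i₀ incidence c+r≡s

    private
      up : ∀ {a b z} → + b ≡ z → a ℕ.∣ b → + a ∣ z
      up refl a∣b = ∣ᵤ⇒∣ a∣b

      down : ∀ {a b z} → + b ≡ z → ¬ (a ℕ.∣ b) → ¬ (+ a ∣ z)
      down refl a∤b a∣b = a∤b (∣⇒∣ᵤ a∣b)

      s : + (Q ℕ.* M) ≡ (1ℤ + + q) * + M
      s = pos-* Q M

      rs : + (V ℕ.* (Q ℕ.* M)) ≡ + V * ((1ℤ + + q) * + M)
      rs = trans (pos-* V (Q ℕ.* M)) (cong (+ V *_) s)

      c : + C ≡ + M - 1ℤ
      c = lemma (+ C)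
        where
        lemma : ∀ x → x ≡ 1ℤ + x - 1ℤ
        lemma = solve-∀

      cQ : + (C ℕ.* Q) ≡ (+ M - 1ℤ) * (1ℤ + + q)
      cQ = trans (pos-* C Q) (cong (_* + Q) c)

    private
      module Cok  = AbelianGroup (cokernel L)
      module Crit = AbelianGroup (criticalGroup L)
      module ×ᶜ = Mult Cok.commutativeMonoid
      module ×ᵗ = Mult Crit.commutativeMonoid

      multiple : ∀ k x i → (k ×ᶜ.× x) i ≡ + k * x i
      multiple zero    x i = sym (*-zeroˡ (x i))
      multiple (suc k) x i = trans (cong (λ y → x i + y) (multiple k x i)) (lemma (x i) (+ k))
        where
        lemma : ∀ x k → x + k * x ≡ (1ℤ + k) * x
        lemma = solve-∀

      multipleᵗ : ∀ k X i → proj₁ (k ×ᵗ.× X) i ≡ + k * proj₁ X i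
      multipleᵗ zero    X i = sym (*-zeroˡ (proj₁ X i))
      multipleᵗ (suc k) X i = trans (cong (λ y → proj₁ X i + y) (multipleᵗ k X i)) (lemma (proj₁ X i) (+ k))
        where
        lemma : ∀ x k → x + k * x ≡ (1ℤ + k) * x
        lemma = solve-∀

      -- The image of `L` has sum zero, and ℤ is torsion-free.
      torsion⇒sum≡0 : ((x , _) : Crit.Carrier) → sum x ≡ 0ℤ
      torsion⇒sum≡0 (x , k , k≢0 , z , kx≡Lz) = *-cancelˡ-≡ (+ k) (sum x) 0ℤ {{k≢0}} (begin
        + k * sum x              ≡⟨ *-distribˡ-sum (+ k) x ⟩
        ∑[ i < N ] (+ k * x i)   ≡⟨ sum-cong-≗ (λ i → trans (sym (multiple k x i)) (trans (kx≡Lz i) (+-identityˡ _))) ⟩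
        sum (apply L z)          ≡⟨ sum-L z ⟩
        0ℤ                       ≡⟨ *-zeroʳ (+ k) ⟨
        + k * 0ℤ                 ∎)
        where open ≡-Reasoning

    -- Torsion vectors have sum zero, so `L-quadratic` provides the preimage of `r s x` under `L`.
    criticalGroup-exponent : ∀ X → (V ℕ.* (Q ℕ.* M)) ×ᵗ.× X Crit.≈ Crit.ε
    criticalGroup-exponent X@(x , _) = (λ i → (+ V + (1ℤ + + q) * + M) * x i - apply L x i) , λ i →
      trans (multipleᵗ (V ℕ.* (Q ℕ.* M)) X i) (trans (cong (_* x i) rs)
        (trans (sym (L-quadratic x (torsion⇒sum≡0 X) i)) (sym (+-identityˡ _))))

    criticalGroup-order : ∀ {ℓ} → Prime ℓ → ℓ ℕ.∤ V → ℓ ℕ.∤ Q → ℓ ℕ.∤ M →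
                          ∀ κ → HasSize (AbelianGroup.setoid (criticalGroup L)) κ → ℓ ℕ.∤ κ
    criticalGroup-order ℓ-prime ℓ∤V ℓ∤Q ℓ∤M κ size ℓ∣κ =
      ∤-* ℓ-prime ℓ∤V (∤-* ℓ-prime ℓ∤Q ℓ∤M) (prime∣^⇒∣ ℓ-prime (V ℕ.* (Q ℕ.* M)) κ (ℕ.∣-trans ℓ∣κ
        (size∣exponent^size (criticalGroup L) {κ} size {V ℕ.* (Q ℕ.* M)} criticalGroup-exponent)))

    module _ (S : SmithNormalForm L) {ℓ : ℕ} (ℓ-prime : Prime ℓ) where
      open Ranks S ℓ-prime

      private
        e = multiplicity S ℓ
        open Profile {e} {rank} multiplicity-zero multiplicity-suc

        ∤^1 : ∀ {a b} → + b ≡ a → ℓ ℕ.∤ b → ¬ (+ (ℓ ^ 1) ∣ a)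
        ∤^1 eq ℓ∤b = down eq (λ ℓ^1∣b → ℓ∤b (subst (ℕ._∣ _) (ℕ.*-identityʳ ℓ) ℓ^1∣b))

        ∣^1 : ∀ {b} i → ℓ ^ suc i ℕ.∣ b → ℓ ℕ.∣ b
        ∣^1 i = ℕ.∣-trans (ℕ.m∣m*n (ℓ ^ i))

        ≤top : ∀ i → rank i ≤ suc (v′ ℕ.+ G)
        ≤top i = ℕ.≤-pred (subst (suc (rank i) ≤_) N≡V+G (rank<N i))

        top≤ : ∀ i → ℓ ^ suc i ℕ.∤ V ℕ.* (Q ℕ.* M) → suc (v′ ℕ.+ G) ≤ rank i
        top≤ i ∤rs = ℕ.≤-pred (subst₂ _≤_ N≡V+G (ℕ.+-comm (rank i) 1) (N≤rank+1 i (down rs ∤rs)))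

        G+1≤ : ∀ i → ℓ ^ suc i ℕ.∤ Q ℕ.* M → suc G ≤ rank i
        G+1≤ i ∤s = ℕ.+-cancelˡ-≤ V _ _ (subst₂ _≤_ (trans (cong suc N≡V+G) (sym (ℕ.+-suc V G))) (ℕ.+-comm (rank i) V)
          (N<rank+v i (down s ∤s)))

        ≤G+1 : ∀ i → rank i ℕ.+ V ≤ N ℕ.+ 1 → rank i ≤ suc G
        ≤G+1 i rank+V≤ = ℕ.+-cancelˡ-≤ V _ _ (subst₂ _≤_ (ℕ.+-comm (rank i) V)
          (trans (ℕ.+-comm N 1) (trans (cong suc N≡V+G) (sym (ℕ.+-suc V G)))) rank+V≤)

        ∤C : ℓ ℕ.∣ M → ℓ ℕ.∤ C
        ∤C ℓ∣M ℓ∣C = ℕ.nonTrivial⇒≢1 {{prime⇒nonTrivial ℓ-prime}} (ℕ.∣1⇒≡1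
          (ℕ.∣m+n∣m⇒∣n {m = C} (subst (ℓ ℕ.∣_) (ℕ.+-comm 1 C) ℓ∣M) ℓ∣C))

        ∤rs : ∀ a b → Valuation ℓ V a → Valuation ℓ (Q ℕ.* M) b → ∀ {i} → a ℕ.+ b ≡ i → ℓ ^ suc i ℕ.∤ V ℕ.* (Q ℕ.* M)
        ∤rs a b vV vs refl = proj₂ (valuation-* ℓ-prime a b vV vs)

        -- The equation amounts to `suc x ≡ G`, so nothing is truncated.
        G-1 : ∀ {x} → x ℕ.+ V ≡ suc (v′ ℕ.+ G) → x ≡ G ℕ.∸ 1
        G-1 {x} eq = cong (ℕ._∸ 1) (ℕ.+-cancelˡ-≡ (suc v′) (suc x) G (trans
          (trans (ℕ.+-suc (suc v′) x) (ℕ.+-comm V x)) eq))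

      -- In all cases the valuation is written `suc a`, so that `a` is the last index of the plateau
      -- before it. Here the plateaus are `suc G` and N - 1.
      case-A-i : ∀ a → Valuation ℓ V (suc a) → ℓ ℕ.∤ Q → ℓ ℕ.∤ M →
                 e (suc a) ≡ v′ × e 0 ≡ suc G × e VanishesOff (suc a ∷ 0 ∷ [])
      case-A-i a vV ℓ∤Q ℓ∤M =
        let eₐ , e₀ , off = two-steps a {suc G} {suc (v′ ℕ.+ G)}
              (G+1≤ 0 (λ ∣s → ℓ∤s (∣^1 0 ∣s)))
              (≤G+1 a (rank+v≤N+1 a (up refl (proj₁ vV)) (down s ℓ∤s)))
              (top≤ (suc a) (∤rs (suc a) 0 vV (∤⇒valuation ℓ-prime ℓ∤s) (ℕ.+-identityʳ (suc a)))) ≤top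
        in ℕ.+-cancelʳ-≡ (suc G) _ _ (trans eₐ (sym (ℕ.+-suc v′ G))) , e₀ , off
        where
        ℓ∤s : ℓ ℕ.∤ Q ℕ.* M
        ℓ∤s = ∤-* ℓ-prime ℓ∤Q ℓ∤M

      -- The plateaus are `V` and N - 1. The lower bound `v≤rank` holds already at level 0, because
      -- ℓ divides `M = suc C` and so neither `C` nor `Q`.
      case-A-ii : ∀ a → Valuation ℓ M (suc a) → ℓ ℕ.∤ Q → ℓ ℕ.∤ V →
                  e (suc a) ≡ G ℕ.∸ 1 × e 0 ≡ V × e VanishesOff (suc a ∷ 0 ∷ [])
      case-A-ii a vM ℓ∤Q ℓ∤V =
        let eₐ , e₀ , off = two-steps a {V} {suc (v′ ℕ.+ G)}
              (v≤rank 0 (up s (ℕ.∣-trans (ℕ.∣-reflexive (ℕ.*-identityʳ ℓ)) (∣^1 a (proj₁ vs))))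
                (∤^1 (trans (pos-* (C ℕ.* Q) (C ℕ.* Q)) (cong₂ _*_ cQ cQ)) (∤-* ℓ-prime ℓ∤CQ ℓ∤CQ)))
              (rank≤v a (up s (proj₁ vs)))
              (top≤ (suc a) (∤rs 0 (suc a) (∤⇒valuation ℓ-prime ℓ∤V) vs refl)) ≤top
        in G-1 eₐ , e₀ , off
        where
        vs : Valuation ℓ (Q ℕ.* M) (suc a)
        vs = valuation-* ℓ-prime 0 (suc a) (∤⇒valuation ℓ-prime ℓ∤Q) vM
        ℓ∤CQ : ℓ ℕ.∤ C ℕ.* Q
        ℓ∤CQ = ∤-* ℓ-prime (∤C (∣^1 a (proj₁ vM))) ℓ∤Q

      module _ (a : ℕ) (vQ : Valuation ℓ Q (suc a)) where
        private
          -- An odd number despite its name: twice the valuation `suc a`, minus one. The shape makes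
          -- `suc 2a` reduce to the same term as `2 * suc a`.
          2a = a ℕ.+ (suc a ℕ.+ 0)

          vQ² : ∀ {x} → Valuation ℓ x (suc a) → Valuation ℓ (Q ℕ.* x) (suc 2a)
          vQ² vx = valuation-* ℓ-prime (suc a) (suc a ℕ.+ 0) vQ (subst (Valuation ℓ _) (sym (ℕ.+-identityʳ (suc a))) vx)

          ℓ∣Q : ℓ ℕ.∣ Q
          ℓ∣Q = ∣^1 a (proj₁ vQ)

          ℓ∤q : ℓ ℕ.∤ q
          ℓ∤q ℓ∣q = ℕ.nonTrivial⇒≢1 {{prime⇒nonTrivial ℓ-prime}} (ℕ.∣1⇒≡1
            (ℕ.∣m+n∣m⇒∣n {m = q} (subst (ℓ ℕ.∣_) (ℕ.+-comm 1 q) ℓ∣Q) ℓ∣q))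

        module _ (ℓ∤V : ℓ ℕ.∤ V) where
          private
            lower₀ : ℓ ℕ.∣ M → suc v′ ≤ rank 0
            lower₀ ℓ∣M = ℕ.≤-pred (subst (V ≤_) (ℕ.+-comm (rank 0) 1)
              (v≤rank+1 (down refl ℓ∤V) (down c (∤C ℓ∣M))))

            upper₀ : ℓ ^ suc 2a ℕ.∣ Q ℕ.* M → rank 2a ≤ suc v′
            upper₀ ∣s = ℕ.≤-pred (rank<v 2a (up (pos-* Q Q) (proj₁ (vQ² vQ))) (up s ∣s) (down refl ℓ∤V))

          case-B-i : Valuation ℓ M (suc a) →
                     e (suc 2a) ≡ G × e 0 ≡ suc v′ × e VanishesOff (suc 2a ∷ 0 ∷ [])
          case-B-i vM =
            let e₂ₐ , e₀ , off = two-steps 2a {suc v′} {suc (v′ ℕ.+ G)} (lower₀ (∣^1 a (proj₁ vM))) (upper₀ (proj₁ vs))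
                  (top≤ (suc 2a) (∤rs 0 (suc 2a) (∤⇒valuation ℓ-prime ℓ∤V) vs refl)) ≤top
            in ℕ.+-cancelʳ-≡ (suc v′) _ _ (trans e₂ₐ (ℕ.+-comm (suc v′) G)) , e₀ , off
            where
            vs : Valuation ℓ (Q ℕ.* M) (suc 2a)
            vs = vQ² vM

          -- The plateau V - 1 ends where `Q * Q` ceases to be divisible. From there to the
          -- valuation of `Q * M` the rank is `V`, one more, which accounts for the isolated
          -- elementary divisor.
          case-B-ii : ∀ b → Valuation ℓ M (suc a ℕ.+ suc b) →
                      e (suc (2a ℕ.+ suc b)) ≡ G ℕ.∸ 1 × e (suc 2a) ≡ 1 × e 0 ≡ suc v′ ×
                      e VanishesOff (suc (2a ℕ.+ suc b) ∷ suc 2a ∷ 0 ∷ [])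
          case-B-ii b vM =
            let e₂ₐ₊ᵦ , e₂ₐ , e₀ , off = three-steps 2a (2a ℕ.+ suc b) {suc v′} {V} {suc (v′ ℕ.+ G)}
                  (ℕ.m<m+n 2a z<s)
                  (lower₀ (∣^1 (a ℕ.+ suc b) (proj₁ vM)))
                  (upper₀ (ℕ.∣-trans (^-monoʳ-∣ ℓ (ℕ.m≤m+n (suc 2a) (suc b))) (proj₁ vs)))
                  (v≤rank (suc 2a) (up s (ℕ.∣-trans (^-monoʳ-∣ ℓ (ℕ.s≤s (ℕ.m<m+n 2a z<s))) (proj₁ vs)))
                    (down (trans (pos-* (C ℕ.* Q) (C ℕ.* Q)) (cong₂ _*_ cQ cQ)) (proj₂ vCQ²)))
                  (rank≤v (2a ℕ.+ suc b) (up s (proj₁ vs)))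
                  (top≤ (suc (2a ℕ.+ suc b)) (∤rs 0 (suc (2a ℕ.+ suc b)) (∤⇒valuation ℓ-prime ℓ∤V) vs refl))
                  ≤top
            in G-1 e₂ₐ₊ᵦ , ℕ.+-cancelʳ-≡ (suc v′) _ 1 e₂ₐ , e₀ , off
            where
            vs : Valuation ℓ (Q ℕ.* M) (suc (2a ℕ.+ suc b))
            vs = subst (Valuation ℓ (Q ℕ.* M))
              (trans (sym (ℕ.+-assoc (suc a) (suc a) (suc b))) (cong (λ x → suc a ℕ.+ x ℕ.+ suc b) (sym (ℕ.+-identityʳ (suc a)))))
              (valuation-* ℓ-prime (suc a) (suc a ℕ.+ suc b) vQ vM)
            vCQ : Valuation ℓ (C ℕ.* Q) (suc a)
            vCQ = valuation-* ℓ-prime 0 (suc a) (∤⇒valuation ℓ-prime (∤C (∣^1 (a ℕ.+ suc b) (proj₁ vM)))) vQ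
            vCQ² : Valuation ℓ ((C ℕ.* Q) ℕ.* (C ℕ.* Q)) (suc 2a)
            vCQ² = subst (Valuation ℓ _) (cong (λ x → suc a ℕ.+ x) (sym (ℕ.+-identityʳ (suc a))))
              (valuation-* ℓ-prime (suc a) (suc a) vCQ vCQ)

        -- The plateaus are V - 2, `suc G` and N - 1, with steps at the valuations of `Q * M` and of
        -- `V * (Q * M)`. The value b = 0 is included.
        case-B-iii-v : ∀ b → Valuation ℓ V (suc a ℕ.+ b) → ℓ ℕ.∤ M →
                       e (suc (2a ℕ.+ b)) ≡ v′ × e (suc a) ≡ suc G ℕ.∸ v′ × e 0 ≡ v′ ×
                       e VanishesOff (suc (2a ℕ.+ b) ∷ suc a ∷ 0 ∷ [])
        case-B-iii-v b vV ℓ∤M =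
          let e₂ₐ₊ᵦ , eₐ , e₀ , off = three-steps a (2a ℕ.+ b) {v′} {suc G} {suc (v′ ℕ.+ G)}
                (ℕ.≤-trans (ℕ.m<m+n a z<s) (ℕ.m≤m+n 2a b))
                (ℕ.≤-pred (ℕ.≤-pred (subst (V ≤_) (ℕ.+-comm (rank 0) 2) (v≤rank+2 (up s (∣^1 a (proj₁ vs))) (down refl ℓ∤q)))))
                (ℕ.≤-pred (ℕ.≤-pred (subst (_≤ V) (ℕ.+-comm (rank a) 2)
                  (rank+2≤v a (up refl (proj₁ vQ)) (up s (proj₁ vs)) (up refl (ℕ.∣-trans (^-monoʳ-∣ ℓ (ℕ.m≤m+n (suc a) b)) (proj₁ vV)))))))
                (G+1≤ (suc a) (proj₂ vs))
                (≤G+1 (2a ℕ.+ b) (rank+v≤N+1′ (2a ℕ.+ b) (up rs (proj₁ vrs)) (up refl (∣^1 (a ℕ.+ b) (proj₁ vV))) (up refl ℓ∣Q) (down refl ℓ∤q)))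
                (top≤ (suc (2a ℕ.+ b)) (proj₂ vrs))
                ≤top
          in ℕ.+-cancelʳ-≡ (suc G) _ _ (trans e₂ₐ₊ᵦ (sym (ℕ.+-suc v′ G))) ,
             -- `eₐ` expresses `suc G` as a sum with summand `v′`, so the truncated difference is
             -- the true one.
             trans (sym (ℕ.m+n∸n≡m _ v′)) (cong (ℕ._∸ v′) eₐ) , e₀ , off
          where
          vs : Valuation ℓ (Q ℕ.* M) (suc a)
          vs = subst (Valuation ℓ _) (ℕ.+-identityʳ (suc a)) (valuation-* ℓ-prime (suc a) 0 vQ (∤⇒valuation ℓ-prime ℓ∤M))
          vrs : Valuation ℓ (V ℕ.* (Q ℕ.* M)) (suc (2a ℕ.+ b))
          vrs = subst (Valuation ℓ _) (begin
            suc a ℕ.+ b ℕ.+ suc a            ≡⟨ ℕ.+-assoc (suc a) b (suc a) ⟩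
            suc a ℕ.+ (b ℕ.+ suc a)          ≡⟨ cong (suc a ℕ.+_) (trans (ℕ.+-comm b (suc a)) (cong (ℕ._+ b) (sym (ℕ.+-identityʳ (suc a))))) ⟩
            suc a ℕ.+ (suc a ℕ.+ 0 ℕ.+ b)    ≡⟨ ℕ.+-assoc (suc a) (suc a ℕ.+ 0) b ⟨
            suc a ℕ.+ (suc a ℕ.+ 0) ℕ.+ b    ∎) (valuation-* ℓ-prime (suc a ℕ.+ b) (suc a) vV vs)
            where open ≡-Reasoning

-- Points, lines and pencils of a projective space over a finite field

module ProjectiveGeometry where

  open import Data.Fin.Base as Fin using (splitAt; _↑ˡ_; _↑ʳ_; finToFun; funToFin)
  open import Data.Fin.Properties using (splitAt-↑ˡ; splitAt-↑ʳ; splitAt⁻¹-↑ˡ; splitAt⁻¹-↑ʳ; funToFin-finToFin; finToFun-funToFin)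
  open import Data.Vec.Functional using (_∷_; []; head; tail)
  open import Level using (_⊔_)

  -- The q-number [n], as the recursion that sorts normalized vectors by their first coordinate: q^n
  -- of them start with 1, the others with 0.
  pointCount : ℕ → ℕ → ℕ
  pointCount q zero    = 0
  pointCount q (suc n) = q ^ n ℕ.+ pointCount q n

  module FiniteField {c r} (F : CommutativeRing c r) (F-field : IsField F)
    {q : ℕ} (size : HasSize (CommutativeRing.setoid F) q) where
    open CommutativeRing F hiding (zero) renaming (Carrier to K)
    open IsField F-field
    open LinearAlgebra F
    open Finite size
    open Inverse size using (to; from; from-cong; strictlyInverseˡ; strictlyInverseʳ)
    open import Relation.Binary.Reasoning.Setoid setoid

    open import Algebra.Solver.Ring.NaturalCoefficients.Default commutativeSemiring
      using (solve; con; _:=_; _:+_; _:*_)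

    infixr 8 _·_
    infixl 7 _⊞_

    _·_ : ∀ {n} → K → Vector K n → Vector K n
    (x · v) i = x * v i

    _⊞_ : ∀ {n} → Vector K n → Vector K n → Vector K n
    (v ⊞ w) i = v i + w i

    1≉0 : ¬ (1# ≈ 0#)
    1≉0 1≈0 = 0≉1 (sym 1≈0)

    cancelˡ : ∀ {n x} {v : Vector K n} → ¬ (x ≈ 0#) → x · v ≋ 𝟎 → v ≋ 𝟎
    cancelˡ {x = x} {v} x≉0 xv≋0 i = let y , xy≈1 = inverse x x≉0 in begin
      v i            ≈⟨ *-identityˡ (v i) ⟨
      1# * v i       ≈⟨ *-congʳ xy≈1 ⟨
      x * y * v i    ≈⟨ lemma x y (v i) ⟩
      y * (x * v i)  ≈⟨ *-congˡ (xv≋0 i) ⟩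
      y * 0#         ≈⟨ zeroʳ y ⟩
      0#             ∎
      where
      lemma : ∀ x y z → x * y * z ≈ y * (x * z)
      lemma = solve 3 (λ x y z → x :* y :* z := y :* (x :* z)) refl

    solve-scale : ∀ {n x} {v w : Vector K n} → ¬ (x ≈ 0#) → x · v ≋ w → ∃ λ y → v ≋ y · w
    solve-scale {x = x} {v} {w} x≉0 xv≋w = let y , xy≈1 = inverse x x≉0 in y , λ i → begin
      v i            ≈⟨ *-identityˡ (v i) ⟨
      1# * v i       ≈⟨ *-congʳ xy≈1 ⟨
      x * y * v i    ≈⟨ lemma x y (v i) ⟩
      y * (x * v i)  ≈⟨ *-congˡ (xv≋w i) ⟩
      y * w i        ∎
      where
      lemma : ∀ x y z → x * y * z ≈ y * (x * z)
      lemma = solve 3 (λ x y z → x :* y :* z := y :* (x :* z)) refl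

    private
      [_∷ᵖ_] : ∀ {m n k} → (Fin m → Vector K n) → (Fin k → Vector K n) → Fin m ⊎ Fin k → Vector K (suc n)
      [_∷ᵖ_] f g (inj₁ a) = 1# ∷ f a
      [_∷ᵖ_] f g (inj₂ b) = 0# ∷ g b

      coordinates : ∀ {n} → Fin (q ^ n) → Vector K n
      coordinates a = to ∘ finToFun a

      index : ∀ {n} → Vector K n → Fin (q ^ n)
      index v = funToFin (from ∘ v)

      coordinates-index : ∀ {n} (v : Vector K n) → coordinates (index v) ≋ v
      coordinates-index v i = trans (reflexive (cong to (finToFun-funToFin (from ∘ v) i))) (strictlyInverseˡ (v i))

      funToFin-cong : ∀ {m n} {f g : Fin m → Fin n} → f ≗ g → funToFin f ≡ funToFin g
      funToFin-cong {zero}  f≗g = ≡.refl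
      funToFin-cong {suc m} f≗g = cong₂ Fin.combine (f≗g zero) (funToFin-cong (f≗g ∘ suc))

      coordinates-injective : ∀ {n} (a b : Fin (q ^ n)) → coordinates {n} a ≋ coordinates b → a ≡ b
      coordinates-injective {n} a b eq = ≡.trans (≡.sym (funToFin-finToFin {n} {q} a)) (≡.trans
        (funToFin-cong {n} (λ i → ≡.trans (≡.sym (strictlyInverseʳ _)) (≡.trans (from-cong (eq i)) (strictlyInverseʳ _))))
        (funToFin-finToFin {n} {q} b))

    -- The points of the projective space are represented by the vectors whose
    -- first nonzero coordinate is 1.
    point : ∀ {n} → Fin (pointCount q n) → Vector K n
    point {suc n} j = [ coordinates {n} ∷ᵖ point {n} ] (splitAt (q ^ n) j)

    point≉𝟎 : ∀ {n} j → ¬ (point {n} j ≋ 𝟎)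
    point≉𝟎 {suc n} j eq with splitAt (q ^ n) j
    ... | inj₁ a = 1≉0 (eq zero)
    ... | inj₂ b = point≉𝟎 {n} b (λ i → eq (suc i))

    point-complete : ∀ {n} (v : Vector K n) → ¬ (v ≋ 𝟎) → ∃₂ λ j x → v ≋ x · point {n} j
    point-complete {zero}  v v≉0 = contradiction (λ ()) v≉0
    point-complete {suc n} v v≉0 with head v ≈? 0#
    ... | yes v₀≈0 with point-complete (tail v) (λ t≋0 → v≉0 λ { zero → v₀≈0 ; (suc i) → t≋0 i })
    ...   | j , x , eq = (q ^ n) ↑ʳ j , x , lemma
      where
      lemma : v ≋ x · point {suc n} ((q ^ n) ↑ʳ j)
      lemma i rewrite splitAt-↑ʳ (q ^ n) (pointCount q n) j with i
      ... | zero  = trans v₀≈0 (sym (zeroʳ x))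
      ... | suc i = eq i
    point-complete {suc n} v v≉0 | no v₀≉0 with inverse (head v) v₀≉0
    ... | y , v₀y≈1 = index (y · tail v) ↑ˡ pointCount q n , head v , lemma
      where
      lemma : v ≋ head v · point {suc n} (index (y · tail v) ↑ˡ pointCount q n)
      lemma i rewrite splitAt-↑ˡ (q ^ n) (index (y · tail v)) (pointCount q n) with i
      ... | zero  = sym (*-identityʳ _)
      ... | suc i = begin
        v (suc i)                                       ≈⟨ *-identityˡ _ ⟨
        1# * v (suc i)                                  ≈⟨ *-congʳ v₀y≈1 ⟨
        head v * y * v (suc i)                          ≈⟨ *-assoc _ _ _ ⟩
        head v * (y * v (suc i))                        ≈⟨ *-congˡ (coordinates-index (y · tail v) i) ⟨
        head v * coordinates (index (y · tail v)) i     ∎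

    point-injective : ∀ {n} (j k : Fin (pointCount q n)) x → point {n} j ≋ x · point {n} k → j ≡ k
    point-injective {suc n} j k x eq
      with splitAt (q ^ n) j in eqⱼ | splitAt (q ^ n) k in eqₖ
    ... | inj₁ a | inj₁ b = ≡.trans (≡.sym (splitAt⁻¹-↑ˡ eqⱼ)) (≡.trans
      (cong (_↑ˡ pointCount q n) (coordinates-injective {n} a b (λ i → trans (eq (suc i)) (trans (*-congʳ x≈1) (*-identityˡ _)))))
      (splitAt⁻¹-↑ˡ eqₖ))
      where
      x≈1 : x ≈ 1#
      x≈1 = trans (sym (*-identityʳ x)) (sym (eq zero))
    ... | inj₁ a | inj₂ b = contradiction (trans (eq zero) (zeroʳ x)) 1≉0
    ... | inj₂ a | inj₁ b = contradiction
      (λ i → trans (eq (suc i)) (trans (*-congʳ (trans (sym (*-identityʳ x)) (sym (eq zero)))) (zeroˡ _))) (point≉𝟎 {n} a)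
    ... | inj₂ a | inj₂ b = ≡.trans (≡.sym (splitAt⁻¹-↑ʳ eqⱼ)) (≡.trans
      (cong ((q ^ n) ↑ʳ_) (point-injective {n} a b x (λ i → eq (suc i)))) (splitAt⁻¹-↑ʳ eqₖ))

    module _ {n} (v : Vector K n) (v≉0 : ¬ (v ≋ 𝟎)) where
      toPoint : Fin (pointCount q n)
      toPoint = proj₁ (point-complete v v≉0)

      toPoint-scale : ∃ λ x → v ≋ x · point {n} toPoint
      toPoint-scale = proj₂ (point-complete v v≉0)

      toPoint-scale⁻¹ : ∃ λ x → point {n} toPoint ≋ x · v
      toPoint-scale⁻¹ = let x , v≋xp = toPoint-scale in
        solve-scale (λ x≈0 → v≉0 (λ i → trans (v≋xp i) (trans (*-congʳ x≈0) (zeroˡ _)))) (≋-sym v≋xp)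

      toPoint-unique : ∀ j x → point {n} j ≋ x · v → j ≡ toPoint
      toPoint-unique j x eq = let y , v≋yp = toPoint-scale in
        point-injective {n} j toPoint (x * y) (λ i → trans (eq i) (trans (*-congˡ (v≋yp i)) (sym (*-assoc x y _))))

    combination : ∀ {n} → Vector K n → Vector K n → K → K → Vector K n
    combination u v a b = a · u ⊞ b · v

    Independent₂ : ∀ {n} → Vector K n → Vector K n → Set (c ⊔ r)
    Independent₂ u v = ∀ a b → combination u v a b ≋ 𝟎 → a ≈ 0# × b ≈ 0#

    span₂ : ∀ {n} → Vector K n → Vector K n → Subspace n
    span₂ u v = record
      { Member   = λ w → ∃₂ λ a b → combination u v a b ≋ w
      ; resp     = λ w≋w′ (a , b , eq) → a , b , ≋-trans eq w≋w′
      ; 𝟎-closed = 0# , 0# , λ i → lemma₀ (u i) (v i)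
      ; +-closed = λ (a , b , eq) (a′ , b′ , eq′) → a + a′ , b + b′ , λ i →
          trans (lemma₊ a a′ b b′ (u i) (v i)) (+-cong (eq i) (eq′ i))
      ; *-closed = λ x (a , b , eq) → x * a , x * b , λ i →
          trans (lemmaₓ x a b (u i) (v i)) (*-congˡ (eq i))
      }
      where
      lemma₀ : ∀ u v → 0# * u + 0# * v ≈ 0#
      lemma₀ = solve 2 (λ u v → con 0 :* u :+ con 0 :* v := con 0) refl
      lemma₊ : ∀ a a′ b b′ u v → (a + a′) * u + (b + b′) * v ≈ (a * u + b * v) + (a′ * u + b′ * v)
      lemma₊ = solve 6 (λ a a′ b b′ u v →
        (a :+ a′) :* u :+ (b :+ b′) :* v := (a :* u :+ b :* v) :+ (a′ :* u :+ b′ :* v)) refl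
      lemmaₓ : ∀ x a b u v → x * a * u + x * b * v ≈ x * (a * u + b * v)
      lemmaₓ = solve 5 (λ x a b u v → x :* a :* u :+ x :* b :* v := x :* (a :* u :+ b :* v)) refl

    open import Algebra.Properties.Ring ring using (-‿distribˡ-*; -‿distribʳ-*; x∙y⁻¹≈ε⇒x≈y; +-cancelʳ; +-inverseˡ-unique)

    combination-injective : ∀ {n} {u v : Vector K n} → Independent₂ u v → ∀ {a b a′ b′} →
                            combination u v a b ≋ combination u v a′ b′ → a ≈ a′ × b ≈ b′
    combination-injective {u = u} {v} uv-indep {a} {b} {a′} {b′} eq =
      let a-a′≈0 , b-b′≈0 = uv-indep (a - a′) (b - b′) difference
      in x∙y⁻¹≈ε⇒x≈y a a′ a-a′≈0 , x∙y⁻¹≈ε⇒x≈y b b′ b-b′≈0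
      where
      difference : combination u v (a - a′) (b - b′) ≋ 𝟎
      difference i = +-cancelʳ (a * u i + b * v i) _ _ (begin
        (a - a′) * u i + (b - b′) * v i + (a * u i + b * v i)      ≈⟨ +-congˡ (eq i) ⟩
        -- The negatives enter the semiring identity as independent atoms, paired so that the next
        -- step cancels them.
        (a - a′) * u i + (b - b′) * v i + (a′ * u i + b′ * v i)    ≈⟨ solve 8 (λ a a′ ā b b′ b̄ u v →
          (a :+ ā) :* u :+ (b :+ b̄) :* v :+ (a′ :* u :+ b′ :* v) := (ā :+ a′) :* u :+ (b̄ :+ b′) :* v :+ (a :* u :+ b :* v))
          refl a a′ (- a′) b b′ (- b′) (u i) (v i) ⟩
        (- a′ + a′) * u i + (- b′ + b′) * v i + (a * u i + b * v i)  ≈⟨ +-congʳ (+-cong (trans (*-congʳ (-‿inverseˡ a′)) (zeroˡ _)) (trans (*-congʳ (-‿inverseˡ b′)) (zeroˡ _))) ⟩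
        0# + 0# + (a * u i + b * v i)                              ≈⟨ +-congʳ (+-identityˡ 0#) ⟩
        0# + (a * u i + b * v i)                                   ∎)

    Independent₃ : ∀ {n} → Vector K n → Vector K n → Vector K n → Set (c ⊔ r)
    Independent₃ u v w = ∀ a b d → combination u v a b ⊞ d · w ≋ 𝟎 → a ≈ 0# × b ≈ 0# × d ≈ 0#

    combination₃-injective : ∀ {n} {u v w : Vector K n} → Independent₃ u v w → ∀ {a b d a′ b′ d′} →
                             combination u v a b ⊞ d · w ≋ combination u v a′ b′ ⊞ d′ · w → a ≈ a′ × b ≈ b′ × d ≈ d′
    combination₃-injective {u = u} {v} {w} indep {a} {b} {d} {a′} {b′} {d′} eq =
      let a-a′≈0 , b-b′≈0 , d-d′≈0 = indep (a - a′) (b - b′) (d - d′) difference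
      in x∙y⁻¹≈ε⇒x≈y a a′ a-a′≈0 , x∙y⁻¹≈ε⇒x≈y b b′ b-b′≈0 , x∙y⁻¹≈ε⇒x≈y d d′ d-d′≈0
      where
      vanish : ∀ x y → (- x + x) * y ≈ 0#
      vanish x y = trans (*-congʳ (-‿inverseˡ x)) (zeroˡ y)
      difference : combination u v (a - a′) (b - b′) ⊞ (d - d′) · w ≋ 𝟎
      difference i = +-cancelʳ (a * u i + b * v i + d * w i) _ _ (begin
        (a - a′) * u i + (b - b′) * v i + (d - d′) * w i + (a * u i + b * v i + d * w i)      ≈⟨ +-congˡ (eq i) ⟩
        (a - a′) * u i + (b - b′) * v i + (d - d′) * w i + (a′ * u i + b′ * v i + d′ * w i)
          ≈⟨ solve 12 (λ a a′ ā b b′ b̄ d d′ d̄ u v w →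
               (a :+ ā) :* u :+ (b :+ b̄) :* v :+ (d :+ d̄) :* w :+ (a′ :* u :+ b′ :* v :+ d′ :* w) :=
               (ā :+ a′) :* u :+ (b̄ :+ b′) :* v :+ (d̄ :+ d′) :* w :+ (a :* u :+ b :* v :+ d :* w))
             refl a a′ (- a′) b b′ (- b′) d d′ (- d′) (u i) (v i) (w i) ⟩
        (- a′ + a′) * u i + (- b′ + b′) * v i + (- d′ + d′) * w i + (a * u i + b * v i + d * w i)
          ≈⟨ +-congʳ (+-cong (+-cong (vanish a′ (u i)) (vanish b′ (v i))) (vanish d′ (w i))) ⟩
        0# + 0# + 0# + (a * u i + b * v i + d * w i)          ≈⟨ +-congʳ (trans (+-identityʳ _) (+-identityˡ 0#)) ⟩
        0# + (a * u i + b * v i + d * w i)                    ∎)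

    independent₃-swap : ∀ {n} {u v w : Vector K n} → Independent₃ u v w → Independent₃ v u w
    independent₃-swap indep a b d eq =
      let b≈0 , a≈0 , d≈0 = indep b a d (λ i → trans (+-congʳ (+-comm _ _)) (eq i)) in a≈0 , b≈0 , d≈0

    points-independent : ∀ {n} {j k : Fin (pointCount q n)} → j ≢ k → Independent₂ (point {n} j) (point {n} k)
    points-independent {n} {j} {k} j≢k a b eq with a ≈? 0#
    ... | no a≉0 = contradiction
      (let x , pⱼ≋ = solve-scale {w = (- b) · point {n} k} a≉0 (λ i →
             trans (+-inverseˡ-unique _ _ (eq i)) (-‿distribˡ-* b _))
       in point-injective {n} j k (x * - b) (λ i → trans (pⱼ≋ i) (sym (*-assoc x (- b) _))))
      j≢k
    ... | yes a≈0 with b ≈? 0#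
    ...   | yes b≈0 = a≈0 , b≈0
    ...   | no b≉0  = contradiction
      (cancelˡ b≉0 (λ i → trans (sym (+-identityˡ _)) (trans (+-congʳ (sym (trans (*-congʳ a≈0) (zeroˡ _)))) (eq i))))
      (point≉𝟎 {n} k)

    module _ {n : ℕ} where

      Line : Set _
      Line = Σ (Subspace n) λ W → Basis W 2

      infix 4 _∋_
      _∋_ : Line → Vector K n → Set (c ⊔ r)
      (W , _) ∋ v = Member W v

      module LineBasis (W : Line) where
        open Basis (proj₂ W)
        b₁ b₂ : Vector K n
        b₁ = vectors zero
        b₂ = vectors (suc zero)

        b₁-b₂-independent : Independent₂ b₁ b₂
        b₁-b₂-independent x y eq = coefficients zero , coefficients (suc zero)
          where
          coefficients = independent (x ∷ y ∷ []) (λ i → trans (+-congˡ (+-identityʳ _)) (eq i))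

        coordinates₂ : ∀ {w} → W ∋ w → ∃₂ λ x y → combination b₁ b₂ x y ≋ w
        coordinates₂ w∈W = let x , eq = spanning w∈W in
          x zero , x (suc zero) , λ i → trans (+-congˡ (sym (+-identityʳ _))) (eq i)

      combination-member : (W : Subspace n) → ∀ {u v} → Member W u → Member W v → ∀ a b →
                           Member W (combination u v a b)
      combination-member W u∈W v∈W a b = +-closed W (*-closed W a u∈W) (*-closed W b v∈W)

      lineThrough : ∀ u v → Independent₂ u v → Line
      lineThrough u v uv-indep = span₂ u v , record
        { vectors     = u ∷ v ∷ []
        ; inside      = λ { zero → 1# , 0# , λ i → solve 2 (λ u v → con 1 :* u :+ con 0 :* v := u) refl (u i) (v i)
                          ; (suc zero) → 0# , 1# , λ i → solve 2 (λ u v → con 0 :* u :+ con 1 :* v := v) refl (u i) (v i) }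
        ; independent = λ x eq →
            let x₀≈0 , x₁≈0 = uv-indep (x zero) (x (suc zero)) (λ i → trans (+-congˡ (sym (+-identityʳ _))) (eq i))
            in λ { zero → x₀≈0 ; (suc zero) → x₁≈0 }
        ; spanning    = λ (a , b , eq) → (a ∷ b ∷ []) , λ i → trans (+-congˡ (+-identityʳ _)) (eq i)
        }

      lineThrough-∋ˡ : ∀ u v uv-indep → lineThrough u v uv-indep ∋ u
      lineThrough-∋ˡ u v uv-indep = Basis.inside (proj₂ (lineThrough u v uv-indep)) zero

      lineThrough-∋ʳ : ∀ u v uv-indep → lineThrough u v uv-indep ∋ v
      lineThrough-∋ʳ u v uv-indep = Basis.inside (proj₂ (lineThrough u v uv-indep)) (suc zero)

      -- Cramer's rule.
      line⊆span : ∀ (W : Line) {u v w} → Independent₂ u v → W ∋ u → W ∋ v → W ∋ w → Member (span₂ u v) w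
      line⊆span W {u} {v} {w} uv-indep u∈W v∈W w∈W = x * a , x * b , λ i → begin
          x * a * u i + x * b * v i                                          ≈⟨ solve 5 (λ x a b u v → x :* a :* u :+ x :* b :* v := x :* (a :* u :+ b :* v)) refl x a b (u i) (v i) ⟩
          x * (a * u i + b * v i)                                            ≈⟨ *-congˡ (cramer i) ⟩
          x * (D * w i)                                                      ≈⟨ solve 3 (λ x d w → x :* (d :* w) := d :* x :* w) refl x D (w i) ⟩
          D * x * w i                                                        ≈⟨ *-congʳ Dx≈1 ⟩
          1# * w i                                                           ≈⟨ *-identityˡ _ ⟩
          w i                                                                ∎
        where
        open LineBasis W
        u-coordinates = coordinates₂ u∈W
        v-coordinates = coordinates₂ v∈W
        w-coordinates = coordinates₂ w∈W
        α = proj₁ u-coordinates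
        β = proj₁ (proj₂ u-coordinates)
        u≋ = proj₂ (proj₂ u-coordinates)
        γ = proj₁ v-coordinates
        δ = proj₁ (proj₂ v-coordinates)
        v≋ = proj₂ (proj₂ v-coordinates)
        y = proj₁ w-coordinates
        z = proj₁ (proj₂ w-coordinates)
        w≋ = proj₂ (proj₂ w-coordinates)
        D = α * δ - β * γ
        a = y * δ - z * γ
        b = z * α - y * β
        -- If the determinant vanished, then δ u = β v and γ u = α v. Independence of `u` and `v`
        -- would give α = β = 0, that is, `u` = 0.
        D≉0 : ¬ (D ≈ 0#)
        D≉0 D≈0 = 1≉0 (proj₁ (uv-indep 1# 0# (λ i → trans
            (solve 2 (λ u v → con 1 :* u :+ con 0 :* v := u) refl (u i) (v i)) (u≋0 i))))
          where
          αδ≈βγ : α * δ ≈ β * γ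
          αδ≈βγ = x∙y⁻¹≈ε⇒x≈y _ _ D≈0
          δu≋βv : combination u v δ 0# ≋ combination u v 0# β
          δu≋βv i = begin
            δ * u i + 0# * v i                    ≈⟨ +-cong (*-congˡ (sym (u≋ i))) (zeroˡ _) ⟩
            δ * (α * b₁ i + β * b₂ i) + 0#        ≈⟨ solve 5 (λ δ α β b₁ b₂ → δ :* (α :* b₁ :+ β :* b₂) :+ con 0 := (α :* δ) :* b₁ :+ β :* δ :* b₂) refl δ α β (b₁ i) (b₂ i) ⟩
            α * δ * b₁ i + β * δ * b₂ i           ≈⟨ +-congʳ (*-congʳ αδ≈βγ) ⟩
            β * γ * b₁ i + β * δ * b₂ i           ≈⟨ solve 5 (λ δ β γ b₁ b₂ → β :* γ :* b₁ :+ β :* δ :* b₂ := con 0 :+ β :* (γ :* b₁ :+ δ :* b₂)) refl δ β γ (b₁ i) (b₂ i) ⟩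
            0# + β * (γ * b₁ i + δ * b₂ i)        ≈⟨ +-cong (sym (zeroˡ _)) (*-congˡ (v≋ i)) ⟩
            0# * u i + β * v i                    ∎
          γu≋αv : combination u v γ 0# ≋ combination u v 0# α
          γu≋αv i = begin
            γ * u i + 0# * v i                    ≈⟨ +-cong (*-congˡ (sym (u≋ i))) (zeroˡ _) ⟩
            γ * (α * b₁ i + β * b₂ i) + 0#        ≈⟨ solve 5 (λ γ α β b₁ b₂ → γ :* (α :* b₁ :+ β :* b₂) :+ con 0 := α :* γ :* b₁ :+ (β :* γ) :* b₂) refl γ α β (b₁ i) (b₂ i) ⟩
            α * γ * b₁ i + β * γ * b₂ i           ≈⟨ +-congˡ (*-congʳ αδ≈βγ) ⟨
            α * γ * b₁ i + α * δ * b₂ i           ≈⟨ solve 5 (λ δ α γ b₁ b₂ → α :* γ :* b₁ :+ α :* δ :* b₂ := con 0 :+ α :* (γ :* b₁ :+ δ :* b₂)) refl δ α γ (b₁ i) (b₂ i) ⟩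
            0# + α * (γ * b₁ i + δ * b₂ i)        ≈⟨ +-cong (sym (zeroˡ _)) (*-congˡ (v≋ i)) ⟩
            0# * u i + α * v i                    ∎
          β≈0 = sym (proj₂ (combination-injective uv-indep δu≋βv))
          α≈0 = sym (proj₂ (combination-injective uv-indep γu≋αv))
          u≋0 : u ≋ 𝟎
          u≋0 i = trans (sym (u≋ i)) (trans (+-cong (trans (*-congʳ α≈0) (zeroˡ _)) (trans (*-congʳ β≈0) (zeroˡ _))) (+-identityˡ 0#))
        x = proj₁ (inverse D D≉0)
        Dx≈1 = proj₂ (inverse D D≉0)
        cramer : ∀ i → a * u i + b * v i ≈ D * w i
        cramer i = begin
          a * u i + b * v i
            ≈⟨ +-cong (*-congˡ (u≋ i)) (*-congˡ (v≋ i)) ⟨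
          (y * δ + - (z * γ)) * (α * b₁ i + β * b₂ i) + (z * α + - (y * β)) * (γ * b₁ i + δ * b₂ i)
            ≈⟨ +-cong (*-congʳ (+-congˡ (-‿distribʳ-* z γ))) (*-congʳ (+-congˡ (-‿distribʳ-* y β))) ⟩
          (y * δ + z * - γ) * (α * b₁ i + β * b₂ i) + (z * α + y * - β) * (γ * b₁ i + δ * b₂ i)
            ≈⟨ solve 10 (λ y z α β γ δ β̄ γ̄ b₁ b₂ →
                 (y :* δ :+ z :* γ̄) :* (α :* b₁ :+ β :* b₂) :+ (z :* α :+ y :* β̄) :* (γ :* b₁ :+ δ :* b₂) :=
                 (α :* δ :+ β̄ :* γ) :* (y :* b₁) :+ (α :* δ :+ β :* γ̄) :* (z :* b₂)
                   :+ z :* α :* b₁ :* (γ̄ :+ γ) :+ y :* δ :* b₂ :* (β̄ :+ β))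
               refl y z α β γ δ (- β) (- γ) (b₁ i) (b₂ i) ⟩
          (α * δ + - β * γ) * (y * b₁ i) + (α * δ + β * - γ) * (z * b₂ i) + z * α * b₁ i * (- γ + γ) + y * δ * b₂ i * (- β + β)
            ≈⟨ +-cong (+-cong (+-cong (*-congʳ (+-congˡ (-‿distribˡ-* β γ))) (*-congʳ (+-congˡ (-‿distribʳ-* β γ))))
                  (sym (trans (*-congˡ (-‿inverseˡ γ)) (zeroʳ _)))) (sym (trans (*-congˡ (-‿inverseˡ β)) (zeroʳ _))) ⟨
          D * (y * b₁ i) + D * (z * b₂ i) + 0# + 0#
            ≈⟨ solve 3 (λ d x y → d :* x :+ d :* y :+ con 0 :+ con 0 := d :* (x :+ y)) refl D (y * b₁ i) (z * b₂ i) ⟩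
          D * (y * b₁ i + z * b₂ i)
            ≈⟨ *-congˡ (w≋ i) ⟩
          D * w i ∎

      line-unique : ∀ (U W : Line) {u v : Vector K n} → Independent₂ u v → U ∋ u → U ∋ v → W ∋ u → W ∋ v →
                    Setoid._≈_ (Subspaces 2 n) U W
      line-unique U W uv-indep u∈U v∈U u∈W v∈W = ⊆ U W u∈U v∈U u∈W v∈W , ⊆ W U u∈W v∈W u∈U v∈U
        where
        ⊆ : ∀ (U W : Line) → U ∋ _ → U ∋ _ → W ∋ _ → W ∋ _ → ∀ {w} → U ∋ w → W ∋ w
        ⊆ U W u∈U v∈U u∈W v∈W w∈U =
          let a , b , eq = line⊆span U uv-indep u∈U v∈U w∈U
          in resp (proj₁ W) eq (combination-member (proj₁ W) u∈W v∈W a b)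

      independent⇒≉𝟎 : ∀ {u v : Vector K n} → Independent₂ u v → ∀ a b → ¬ (a ≈ 0# × b ≈ 0#) → ¬ (combination u v a b ≋ 𝟎)
      independent⇒≉𝟎 uv-indep a b ¬ab eq = ¬ab (uv-indep a b eq)

      module LinePoints (W : Line) where
        open LineBasis W

        private
          -- Homogeneous coordinates on the projective line: (1 : 0), and (x : 1) for each scalar x.
          x₁ x₂ : Fin (suc q) → K
          x₁ zero    = 1#
          x₁ (suc x) = to x
          x₂ zero    = 0#
          x₂ (suc x) = 1#

          direction : Fin (suc q) → Vector K n
          direction a = combination b₁ b₂ (x₁ a) (x₂ a)

          direction≉𝟎 : ∀ a → ¬ (direction a ≋ 𝟎)
          direction≉𝟎 zero    = independent⇒≉𝟎 b₁-b₂-independent _ _ (1≉0 ∘ proj₁)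
          direction≉𝟎 (suc x) = independent⇒≉𝟎 b₁-b₂-independent _ _ (1≉0 ∘ proj₂)

        linePoint : Fin (suc q) → Fin (pointCount q n)
        linePoint a = toPoint (direction a) (direction≉𝟎 a)

        linePoint-∋ : ∀ a → W ∋ point {n} (linePoint a)
        linePoint-∋ a = let x , eq = toPoint-scale⁻¹ (direction a) (direction≉𝟎 a) in
          resp (proj₁ W) (≋-sym eq) (*-closed (proj₁ W) x
            (combination-member (proj₁ W) (inside₁ zero) (inside₁ (suc zero)) _ _))
          where inside₁ = Basis.inside (proj₂ W)

        linePoint-injective : ∀ a a′ → linePoint a ≡ linePoint a′ → a ≡ a′
        linePoint-injective a a′ eq =
          let x , a≋ = toPoint-scale (direction a) (direction≉𝟎 a)
              y , ≋a′ = toPoint-scale⁻¹ (direction a′) (direction≉𝟎 a′)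
              x₁≈ , x₂≈ = combination-injective b₁-b₂-independent {x₁ a} {x₂ a} {x * y * x₁ a′} {x * y * x₂ a′} (λ i → begin
                direction a i                                  ≈⟨ a≋ i ⟩
                x * point {n} (linePoint a) i                  ≈⟨ *-congˡ (reflexive (cong (λ j → point {n} j i) eq)) ⟩
                x * point {n} (linePoint a′) i                 ≈⟨ *-congˡ (≋a′ i) ⟩
                x * (y * (x₁ a′ * b₁ i + x₂ a′ * b₂ i))        ≈⟨ solve 6 (λ x y a b u v → x :* (y :* (a :* u :+ b :* v)) := x :* y :* a :* u :+ x :* y :* b :* v) refl x y (x₁ a′) (x₂ a′) (b₁ i) (b₂ i) ⟩
                x * y * x₁ a′ * b₁ i + x * y * x₂ a′ * b₂ i    ∎)
          in distinguish a a′ (x * y) x₁≈ x₂≈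
          where
          distinguish : ∀ a a′ z → x₁ a ≈ z * x₁ a′ → x₂ a ≈ z * x₂ a′ → a ≡ a′
          distinguish zero    zero     z _   _   = ≡.refl
          distinguish zero    (suc x′) z 1≈  0≈z = contradiction
            (trans 1≈ (trans (*-congʳ (sym (trans 0≈z (*-identityʳ z)))) (zeroˡ _))) 1≉0
          distinguish (suc x) zero     z _   1≈  = contradiction (trans 1≈ (zeroʳ z)) 1≉0
          distinguish (suc x) (suc x′) z x≈  1≈z = cong suc (≡.trans (≡.sym (strictlyInverseʳ x)) (≡.trans
            (from-cong (trans x≈ (trans (*-congʳ (sym (trans 1≈z (*-identityʳ z)))) (*-identityˡ _)))) (strictlyInverseʳ x′)))

        linePoint-complete : ∀ {j} → W ∋ point {n} j → ∃ λ a → linePoint a ≡ j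
        linePoint-complete {j} j∈W with coordinates₂ j∈W
        ... | x , y , eq with y ≈? 0#
        ...   | yes y≈0 = zero , ≡.sym (toPoint-unique _ _ j x (λ i → begin
          point {n} j i                     ≈⟨ eq i ⟨
          x * b₁ i + y * b₂ i               ≈⟨ +-congˡ (*-congʳ y≈0) ⟩
          x * b₁ i + 0# * b₂ i              ≈⟨ solve 3 (λ x u v → x :* u :+ con 0 :* v := x :* (con 1 :* u :+ con 0 :* v)) refl x (b₁ i) (b₂ i) ⟩
          x * (1# * b₁ i + 0# * b₂ i)       ∎))
        ...   | no y≉0 with inverse y y≉0
        ...     | z , yz≈1 = suc (from (z * x)) , ≡.sym (toPoint-unique _ _ j y (λ i → begin
          point {n} j i                                  ≈⟨ eq i ⟨
          x * b₁ i + y * b₂ i                            ≈⟨ +-congʳ (*-congʳ (trans (sym (*-identityˡ x)) (*-congʳ (sym yz≈1)))) ⟩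
          y * z * x * b₁ i + y * b₂ i                    ≈⟨ solve 5 (λ x y z u v → y :* z :* x :* u :+ y :* v := y :* ((z :* x) :* u :+ con 1 :* v)) refl x y z (b₁ i) (b₂ i) ⟩
          y * (z * x * b₁ i + 1# * b₂ i)                 ≈⟨ *-congˡ (+-congʳ (*-congʳ (strictlyInverseˡ (z * x)))) ⟨
          y * (to (from (z * x)) * b₁ i + 1# * b₂ i)     ∎))

      -- The lines through u in the plane spanned by u, w, t, except the line
      -- through u and w.
      module Pencil {u w t : Vector K n} (indep : Independent₃ u w t) where
        private
          regroup : ∀ a d x u w t → a * u + d * (t + x * w) ≈ a * u + d * x * w + d * t
          regroup = solve 6 (λ a d x u w t → a :* u :+ d :* (t :+ x :* w) := a :* u :+ d :* x :* w :+ d :* t) refl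

        pencil : Fin q → Line
        pencil x = lineThrough u (t ⊞ to x · w) λ a d eq →
          let a≈0 , _ , d≈0 = indep a (d * to x) d (λ i → trans (sym (regroup a d (to x) (u i) (w i) (t i))) (eq i))
          in a≈0 , d≈0

        pencil-∋⁻ : ∀ {x p} → pencil x ∋ p → ∃₂ λ a d → combination u w a (d * to x) ⊞ d · t ≋ p
        pencil-∋⁻ {x} (a , d , eq) = a , d , λ i → trans (sym (regroup a d (to x) (u i) (w i) (t i))) (eq i)

        pencil-∋⁺ : ∀ {x p} a d → combination u w a (d * to x) ⊞ d · t ≋ p → pencil x ∋ p
        pencil-∋⁺ {x} a d eq = a , d , λ i → trans (regroup a d (to x) (u i) (w i) (t i)) (eq i)

        pencil-∋-u : ∀ x → pencil x ∋ u
        pencil-∋-u x = 1# , 0# , λ i → solve 2 (λ u v → con 1 :* u :+ con 0 :* v := u) refl (u i) _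

        -- On a line of the pencil the coefficient of `w` is a multiple of that of `t`, so when the
        -- latter vanishes only `u` remains.
        pencil-center : ∀ {x p} → pencil x ∋ p →
                        (∀ a b d → combination u w a b ⊞ d · t ≋ p → d ≈ 0#) → ∃ λ a → p ≋ a · u
        pencil-center {x} x∋p d≈0 = let a , d , eq = pencil-∋⁻ {x} x∋p ; d≈ = d≈0 a (d * to x) d eq in
          a , λ i → begin
            _                                           ≈⟨ eq i ⟨
            a * u i + d * to x * w i + d * t i          ≈⟨ +-cong (+-congˡ (*-congʳ (*-congʳ d≈))) (*-congʳ d≈) ⟩
            a * u i + 0# * to x * w i + 0# * t i        ≈⟨ solve 5 (λ a x u w t → a :* u :+ con 0 :* x :* w :+ con 0 :* t := a :* u) refl a (to x) (u i) (w i) (t i) ⟩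
            a * u i                                     ∎

        -- The parameter of the line is the ratio `b / d` of the coefficients of `w` and `t`,
        -- whatever `a` is.
        pencil-unique : ∀ {p a b d} → combination u w a b ⊞ d · t ≋ p → ¬ (d ≈ 0#) →
                        ∃ λ x → pencil x ∋ p × (∀ {x′} → pencil x′ ∋ p → x′ ≡ x)
        pencil-unique {p} {a} {b} {d} eq d≉0 with inverse d d≉0
        ... | e , de≈1 = from (e * b) , pencil-∋⁺ a d (λ i → trans (+-congʳ (+-congˡ (*-congʳ d·x≈b))) (eq i)) , λ {x′} x′∋p →
          let a′ , d′ , eq′ = pencil-∋⁻ {x′} x′∋p
              _ , d′x′≈b , d′≈d = combination₃-injective indep (≋-trans eq′ (≋-sym eq))
          in ≡.trans (≡.sym (strictlyInverseʳ x′)) (from-cong (begin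
               to x′                ≈⟨ *-identityˡ _ ⟨
               1# * to x′           ≈⟨ *-congʳ de≈1 ⟨
               d * e * to x′        ≈⟨ solve 3 (λ d e x → d :* e :* x := e :* (d :* x)) refl d e (to x′) ⟩
               e * (d * to x′)      ≈⟨ *-congˡ (*-congʳ d′≈d) ⟨
               e * (d′ * to x′)     ≈⟨ *-congˡ d′x′≈b ⟩
               e * b                ∎))
          where
          d·x≈b : d * to (from (e * b)) ≈ b
          d·x≈b = begin
            d * to (from (e * b))   ≈⟨ *-congˡ (strictlyInverseˡ _) ⟩
            d * (e * b)             ≈⟨ *-assoc d e b ⟨
            d * e * b               ≈⟨ *-congʳ de≈1 ⟩
            1# * b                  ≈⟨ *-identityˡ b ⟩
            b                       ∎

      -- p lies in the plane spanned by u, w, t, but not on the line through u and w.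
      OffLine : (u w t p : Vector K n) → Set (c ⊔ r)
      OffLine u w t p = ∃ λ a → ∃ λ b → ∃ λ d → ¬ (d ≈ 0#) × combination u w a b ⊞ d · t ≋ p

      offLine? : ∀ u w t p → Dec (OffLine u w t p)
      offLine? u w t p =
        ∃-scalar? (λ a≈a′ (b , d , d≉0 , eq) → b , d , d≉0 , λ i → trans (+-congʳ (+-congʳ (*-congʳ (sym a≈a′)))) (eq i)) λ a →
        ∃-scalar? (λ b≈b′ (d , d≉0 , eq) → d , d≉0 , λ i → trans (+-congʳ (+-congˡ (*-congʳ (sym b≈b′)))) (eq i)) λ b →
        ∃-scalar? (λ d≈d′ (d≉0 , eq) → (λ d′≈0 → d≉0 (trans d≈d′ d′≈0)) , λ i → trans (+-congˡ (*-congʳ (sym d≈d′))) (eq i)) λ d →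
        ¬? (d ≈? 0#) ×-dec ((combination u w a b ⊞ d · t) ≋? p)

      offLine-swap : ∀ {u w t p} → OffLine u w t p → OffLine w u t p
      offLine-swap (a , b , d , d≉0 , eq) = b , a , d , d≉0 , λ i → trans (+-congʳ (+-comm _ _)) (eq i)

      ¬offLine : ∀ {u w t p} → ¬ OffLine u w t p → ∀ a b d → combination u w a b ⊞ d · t ≋ p → d ≈ 0#
      ¬offLine ¬off a b d eq with d ≈? 0#
      ... | yes d≈0 = d≈0
      ... | no d≉0  = contradiction (a , b , d , d≉0 , eq) ¬off

      independent-extend : ∀ {u w t} (uw-indep : Independent₂ u w) → ¬ (lineThrough u w uw-indep ∋ t) → Independent₃ u w t
      independent-extend {u} {w} {t} uw-indep t∉ a b d eq with d ≈? 0#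
      ... | yes d≈0 = let a≈0 , b≈0 = uw-indep a b (λ i → trans (sym (trans (+-congˡ (trans (*-congʳ d≈0) (zeroˡ _))) (+-identityʳ _))) (eq i))
                      in a≈0 , b≈0 , d≈0
      ... | no d≉0  = contradiction
        (let x , t≋ = solve-scale {w = λ i → - (combination u w a b i)} d≉0 (λ i →
               +-inverseˡ-unique _ _ (trans (+-comm _ _) (eq i)))
         in resp (span₂ u w) {combination u w (x * - 1# * a) (x * - 1# * b)} (λ i → begin
              x * - 1# * a * u i + x * - 1# * b * w i     ≈⟨ solve 6 (λ x m a b u w → x :* m :* a :* u :+ x :* m :* b :* w := x :* (m :* (a :* u :+ b :* w))) refl x (- 1#) a b (u i) (w i) ⟩
              x * (- 1# * combination u w a b i)          ≈⟨ *-congˡ (trans (sym (-‿distribˡ-* 1# _)) (-‿cong (*-identityˡ _))) ⟩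
              x * - combination u w a b i                 ≈⟨ t≋ i ⟨
              t i                                         ∎) (x * - 1# * a , x * - 1# * b , λ i → refl))
        t∉

      ¬offLine-u : ∀ {u w t} → Independent₃ u w t → ¬ OffLine u w t u
      ¬offLine-u {u} {w} {t} indep (a , b , d , d≉0 , eq) = d≉0 (proj₂ (proj₂ (combination₃-injective indep
        {a} {b} {d} {1#} {0#} {0#} (λ i → trans (eq i)
          (solve 3 (λ u w t → u := con 1 :* u :+ con 0 :* w :+ con 0 :* t) refl (u i) (w i) (t i))))))

-- The incidence matrix of lines and points

module GrassmannIncidences where

  open import Data.Integer.Base hiding (_≤_; _<_; _^_; suc)
  open import Data.Integer.Properties
  open import Data.Integer.Tactic.RingSolver using (solve-∀)
  open import Algebra.Properties.Semiring.Sum +-*-semiring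
    using (sum; sum-syntax; sum-cong-≗; ∑-distrib-+; *-distribˡ-sum; *-distribʳ-sum; ∑-comm; sum-replicate-zero)
  open import Data.List.Base using (length; filter; allFin)
  open import Relation.Binary.PropositionalEquality using (refl; sym; trans; module ≡-Reasoning)
  open IntegerMatrices
  open ProjectiveGeometry

  module GrassmannIncidence
    {c r} (F : CommutativeRing c r) (F-field : IsField F)
    {q : ℕ} (size : HasSize (CommutativeRing.setoid F) q)
    (n : ℕ) {N : ℕ} (vertices : HasSize (LinearAlgebra.Subspaces F 2 n) N)
    (k′ : ℕ) (valency : GrassmannGraph.IsValency F size n vertices k′)
    (m : ℕ) (v≡1+qm : + pointCount q n ≡ 1ℤ + + q * + m) (q≢0 : q ≢ 0) (m≢1 : m ≢ 1)
    where

    open LinearAlgebra F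
    open Finite size
    open FiniteField F F-field size hiding (_·_)
    open GrassmannGraph F size n vertices
    private
      module V = Inverse vertices
      module K = CommutativeRing F

    v : ℕ
    v = pointCount q n

    pt : Fin v → Vector K.Carrier n
    pt = point {n}

    line : Fin N → Line {n}
    line = V.to

    lineIndex : Line {n} → Fin N
    lineIndex = V.from

    lineIndex-∋⁺ : ∀ W {x} → W ∋ x → line (lineIndex W) ∋ x
    lineIndex-∋⁺ W = proj₂ (V.strictlyInverseˡ W)

    lineIndex-∋⁻ : ∀ W {x} → line (lineIndex W) ∋ x → W ∋ x
    lineIndex-∋⁻ W = proj₁ (V.strictlyInverseˡ W)

    line-injective : ∀ i k → Setoid._≈_ (Subspaces 2 n) (line i) (line k) → i ≡ k
    line-injective i k eq = trans (sym (V.strictlyInverseʳ i)) (trans (V.from-cong eq) (V.strictlyInverseʳ k))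

    On : Fin N → Fin v → Set _
    On i j = line i ∋ pt j

    on? : ∀ i j → Dec (On i j)
    on? i j = member? (line i) (pt j)

    two-points : ∀ {i k j l} → j ≢ l → On i j → On i l → On k j → On k l → i ≡ k
    two-points {i} {k} j≢l ij il kj kl =
      line-injective i k (line-unique (line i) (line k) (points-independent {n} j≢l) ij il kj kl)

    common-point : ∀ {i k j l} → i ≢ k → On i j → On k j → On i l → On k l → l ≡ j
    common-point {j = j} {l} i≢k ij kj il kl with l ≟ᶠ j
    ... | yes l≡j = l≡j
    ... | no l≢j  = contradiction (two-points l≢j il ij kl kj) i≢k

    W : Matrix N v
    W i j = indicator (on? i j)

    W-row : ∀ i → ∑[ j < v ] W i j ≡ 1ℤ + + q
    W-row i = sum-image (on? i) linePoint linePoint-injective linePoint-∋ linePoint-complete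
      where open LinePoints (line i)

    module _ {j k : Fin v} (j≢k : j ≢ k) where
      joinLine : Line {n}
      joinLine = lineThrough (pt j) (pt k) (points-independent {n} j≢k)

      join : Fin N
      join = lineIndex joinLine

      onˡ : On join j
      onˡ = lineIndex-∋⁺ joinLine {pt j} (lineThrough-∋ˡ (pt j) (pt k) (points-independent {n} j≢k))

      onʳ : On join k
      onʳ = lineIndex-∋⁺ joinLine {pt k} (lineThrough-∋ʳ (pt j) (pt k) (points-independent {n} j≢k))

    WᵀW-off : ∀ {j k} → j ≢ k → (transpose W ⊗ W) j k ≡ 1ℤ
    WᵀW-off {j} {k} j≢k = trans (sum-cong-≗ (λ i → indicator-× (on? i j) (on? i k)))
      (sum-unique (λ i → on? i j ×-dec on? i k) (onˡ j≢k , onʳ j≢k)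
        (λ (ij , ik) → two-points j≢k ij ik (onˡ j≢k) (onʳ j≢k)))

    degree : Fin v → ℤ
    degree j = ∑[ i < N ] W i j

    private
      WᵀW-degree : ∀ j k → (transpose W ⊗ W) j k ≡ (degree j - 1ℤ) * 𝟙 j k + 1ℤ
      WᵀW-degree j k = go (j ≟ᶠ k)
        where
        lemma : ∀ d → 1ℤ ≡ (d - 1ℤ) * 0ℤ + 1ℤ
        lemma = solve-∀
        lemma′ : ∀ d → d ≡ (d - 1ℤ) * 1ℤ + 1ℤ
        lemma′ = solve-∀
        go : Dec (j ≡ k) → (transpose W ⊗ W) j k ≡ (degree j - 1ℤ) * 𝟙 j k + 1ℤ
        go (no j≢k)   = trans (WᵀW-off j≢k) (trans (lemma (degree j))
          (cong (λ x → (degree j - 1ℤ) * x + 1ℤ) (sym (diagonal-≢ _ j≢k))))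
        go (yes refl) = trans (sum-cong-≗ (λ i → indicator-idem (on? i j))) (trans (lemma′ (degree j))
          (cong (λ x → (degree j - 1ℤ) * x + 1ℤ) (sym (diagonal-refl _ j))))

      -- Counts pairs of a line through `j` and a point on it, in both orders; any other point is
      -- joined to `j` by exactly one line. The resulting linear equation determines the degree, so
      -- the lines through a point need not be enumerated.
      row-sum : ∀ j → (1ℤ + + q) * degree j ≡ degree j - 1ℤ + + v
      row-sum j = begin
        (1ℤ + + q) * degree j                                        ≡⟨ *-comm (1ℤ + + q) (degree j) ⟩
        degree j * (1ℤ + + q)                                        ≡⟨ *-distribʳ-sum (1ℤ + + q) (λ i → W i j) ⟩
        ∑[ i < N ] (W i j * (1ℤ + + q))                              ≡⟨ sum-cong-≗ (λ i → trans (cong (W i j *_) (sym (W-row i))) (*-distribˡ-sum (W i j) (W i))) ⟩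
        ∑[ i < N ] ∑[ k < v ] (W i j * W i k)                        ≡⟨ ∑-comm (λ i k → W i j * W i k) ⟩
        ∑[ k < v ] (transpose W ⊗ W) j k                             ≡⟨ sum-cong-≗ (WᵀW-degree j) ⟩
        ∑[ k < v ] ((degree j - 1ℤ) * 𝟙 j k + 1ℤ)                    ≡⟨ ∑-distrib-+ (λ k → (degree j - 1ℤ) * 𝟙 j k) (λ _ → 1ℤ) ⟩
        ∑[ k < v ] ((degree j - 1ℤ) * 𝟙 j k) + ∑[ k < v ] 1ℤ         ≡⟨ cong₂ _+_ (sym (*-distribˡ-sum (degree j - 1ℤ) (𝟙 j))) (sum-const v 1ℤ) ⟩
        (degree j - 1ℤ) * sum (𝟙 j) + + v * 1ℤ                       ≡⟨ cong₂ (λ a b → (degree j - 1ℤ) * a + b) (sum-δ j) (*-identityʳ (+ v)) ⟩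
        (degree j - 1ℤ) * 1ℤ + + v                                   ≡⟨ cong (λ a → a + + v) (*-identityʳ (degree j - 1ℤ)) ⟩
        degree j - 1ℤ + + v                                          ∎
        where open ≡-Reasoning

    W-column : ∀ j → degree j ≡ + m
    W-column j = *-cancelˡ-≡ (+ q) _ _ {{ℕ.≢-nonZero q≢0}} (begin
      + q * degree j                                ≡⟨ lemma (+ q) (degree j) ⟩
      (1ℤ + + q) * degree j - degree j              ≡⟨ cong (λ a → a - degree j) (row-sum j) ⟩
      degree j - 1ℤ + + v - degree j                ≡⟨ cong (λ a → degree j - 1ℤ + a - degree j) v≡1+qm ⟩
      degree j - 1ℤ + (1ℤ + + q * + m) - degree j   ≡⟨ lemma′ (degree j) (+ q) (+ m) ⟩
      + q * + m                                     ∎)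
      where
      open ≡-Reasoning
      lemma : ∀ q d → q * d ≡ (1ℤ + q) * d - d
      lemma = solve-∀
      lemma′ : ∀ d q m → d - 1ℤ + (1ℤ + q * m) - d ≡ q * m
      lemma′ = solve-∀

    WᵀW : ∀ j k → (transpose W ⊗ W) j k ≡ (+ m - 1ℤ) * 𝟙 j k + 1ℤ
    WᵀW j k = trans (WᵀW-degree j k) (cong (λ d → (d - 1ℤ) * 𝟙 j k + 1ℤ) (W-column j))

    -- A nonzero common vector is a common projective point up to scaling, and distinct lines share
    -- at most one point.
    WWᵀ-off : ∀ {i k} → i ≢ k → (W ⊗ transpose W) i k ≡ adjacencyMatrix i k
    WWᵀ-off {i} {k} i≢k = trans (sum-cong-≗ (λ j → indicator-× (on? i j) (on? k j))) (count (adj? i k))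
      where
      count : (d : Dec (Adj i k)) → ∑[ j < v ] indicator (on? i j ×-dec on? k j) ≡ indicator d
      count (yes (_ , x , (x∈i , x∈k) , x≉𝟎)) =
        let a , eq = toPoint-scale⁻¹ x x≉𝟎
            ij = Subspace.resp (proj₁ (line i)) (≋-sym eq) (Subspace.*-closed (proj₁ (line i)) a x∈i)
            kj = Subspace.resp (proj₁ (line k)) (≋-sym eq) (Subspace.*-closed (proj₁ (line k)) a x∈k)
        in sum-unique (λ j → on? i j ×-dec on? k j) (ij , kj) (λ (il , kl) → common-point i≢k ij kj il kl)
      count (no ¬adj) = sum-none (λ j → on? i j ×-dec on? k j) λ j (ij , kj) →
        ¬adj ((λ eq → i≢k (line-injective i k eq)) , pt j , (ij , kj) , point≉𝟎 {n} j)

    private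
      A-diagonal : ∀ i → adjacencyMatrix i i ≡ 0ℤ
      A-diagonal i = indicator-no (adj? i i) (λ (i≉i , _) → i≉i (id , id))

      WWᵀ-A : ∀ i k → (W ⊗ transpose W) i k ≡ (1ℤ + + q) * 𝟙 i k + adjacencyMatrix i k
      WWᵀ-A i k = go (i ≟ᶠ k)
        where
        lemma : ∀ q a → a ≡ (1ℤ + q) * 0ℤ + a
        lemma = solve-∀
        lemma′ : ∀ q → 1ℤ + q ≡ (1ℤ + q) * 1ℤ + 0ℤ
        lemma′ = solve-∀
        go : Dec (i ≡ k) → (W ⊗ transpose W) i k ≡ (1ℤ + + q) * 𝟙 i k + adjacencyMatrix i k
        go (no i≢k)   = trans (WWᵀ-off i≢k) (trans (lemma (+ q) (adjacencyMatrix i k))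
          (cong (λ x → (1ℤ + + q) * x + adjacencyMatrix i k) (sym (diagonal-≢ _ i≢k))))
        go (yes refl) = trans (sum-cong-≗ (λ j → indicator-idem (on? i j))) (trans (W-row i) (trans (lemma′ (+ q))
          (cong₂ (λ x a → (1ℤ + + q) * x + a) (sym (diagonal-refl _ i)) (sym (A-diagonal i)))))

      valencyᶻ : ∀ i → + length (filter (adj? i) (allFin N)) ≡ + k′
      valencyᶻ i = cong +_ (valency i)

      adjacency-length : ∀ i → ∑[ k < N ] indicator (adj? i k) ≡ + length (filter (adj? i) (allFin N))
      adjacency-length i = sum-indicator-allFin (adj? i)

      adjacency-sum : ∀ i → ∑[ k < N ] adjacencyMatrix i k ≡ + k′
      adjacency-sum i = trans (adjacency-length i) (valencyᶻ i)

    -- The valency is given only as a number of neighbours; summing row `i` of `W Wᵀ` in two ways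
    -- identifies it. The argument supplies a row.
    s≡1+q+k′ : Fin N → (1ℤ + + q) * + m ≡ 1ℤ + + q + + k′
    s≡1+q+k′ i = begin
      (1ℤ + + q) * + m                                                    ≡⟨ cong (_* + m) (W-row i) ⟨
      (∑[ j < v ] W i j) * + m                                            ≡⟨ *-distribʳ-sum (+ m) (W i) ⟩
      ∑[ j < v ] (W i j * + m)                                            ≡⟨ sum-cong-≗ (λ j → trans (cong (W i j *_) (sym (W-column j))) (*-distribˡ-sum (W i j) (λ k → W k j))) ⟩
      ∑[ j < v ] ∑[ k < N ] (W i j * W k j)                               ≡⟨ ∑-comm (λ j k → W i j * W k j) ⟩
      ∑[ k < N ] (W ⊗ transpose W) i k                                    ≡⟨ sum-cong-≗ (WWᵀ-A i) ⟩
      ∑[ k < N ] ((1ℤ + + q) * 𝟙 i k + adjacencyMatrix i k)               ≡⟨ ∑-distrib-+ (λ k → (1ℤ + + q) * 𝟙 i k) (adjacencyMatrix i) ⟩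
      ∑[ k < N ] ((1ℤ + + q) * 𝟙 i k) + ∑[ k < N ] adjacencyMatrix i k    ≡⟨ cong₂ _+_ (sym (*-distribˡ-sum (1ℤ + + q) (𝟙 i))) (adjacency-sum i) ⟩
      (1ℤ + + q) * sum (𝟙 i) + + k′                                       ≡⟨ cong (λ a → (1ℤ + + q) * a + + k′) (sum-δ i) ⟩
      (1ℤ + + q) * 1ℤ + + k′                                              ≡⟨ cong (λ a → a + + k′) (*-identityʳ (1ℤ + + q)) ⟩
      1ℤ + + q + + k′                                                     ∎
      where open ≡-Reasoning

    WWᵀ : ∀ i k → (W ⊗ transpose W) i k ≡ (1ℤ + + q) * + m * 𝟙 i k - laplacian k′ i k
    WWᵀ i k = begin
      (W ⊗ transpose W) i k                                                            ≡⟨ WWᵀ-A i k ⟩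
      (1ℤ + + q) * 𝟙 i k + adjacencyMatrix i k                                         ≡⟨ lemma (+ q) (+ k′) (𝟙 i k) (adjacencyMatrix i k) ⟩
      (1ℤ + + q + + k′) * 𝟙 i k - (+ k′ * 𝟙 i k - adjacencyMatrix i k)                 ≡⟨ cong (λ s → s * 𝟙 i k - laplacian k′ i k) (s≡1+q+k′ i) ⟨
      (1ℤ + + q) * + m * 𝟙 i k - laplacian k′ i k                                      ∎
      where
      open ≡-Reasoning
      lemma : ∀ q k d a → (1ℤ + q) * d + a ≡ (1ℤ + q + k) * d - (k * d - a)
      lemma = solve-∀

  -- Differences of pencils, and the matrix `X`

  sum-rows : ∀ {k m n} (M : Matrix m n) (f : Fin k → Fin m) j →
             ∑[ i < m ] ((∑[ x < k ] 𝟙 (f x) i) * M i j) ≡ ∑[ x < k ] M (f x) j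
  sum-rows {k} {m} M f j = begin
    ∑[ i < m ] ((∑[ x < k ] 𝟙 (f x) i) * M i j)   ≡⟨ sum-cong-≗ (λ i → *-distribʳ-sum (M i j) (λ x → 𝟙 (f x) i)) ⟩
    ∑[ i < m ] ∑[ x < k ] (𝟙 (f x) i * M i j)     ≡⟨ ∑-comm (λ i x → 𝟙 (f x) i * M i j) ⟩
    ∑[ x < k ] apply 𝟙 (λ i → M i j) (f x)        ≡⟨ sum-cong-≗ (λ x → apply-𝟙 (λ i → M i j) (f x)) ⟩
    ∑[ x < k ] M (f x) j                          ∎
    where open ≡-Reasoning

  ∑-distrib-minus : ∀ {n} (f g : Vector ℤ n) → ∑[ i < n ] (f i - g i) ≡ sum f - sum g
  ∑-distrib-minus f g = trans (∑-distrib-+ f (λ i → - g i)) (cong (λ x → sum f + x)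
    (trans (sum-cong-≗ (λ i → sym (-1*i≡-i (g i)))) (trans (sym (*-distribˡ-sum (- 1ℤ) g)) (-1*i≡-i (sum g)))))

  module GrassmannInverse
    {c r} (F : CommutativeRing c r) (F-field : IsField F)
    {q : ℕ} (size : HasSize (CommutativeRing.setoid F) q)
    (n : ℕ) {N : ℕ} (vertices : HasSize (LinearAlgebra.Subspaces F 2 n) N)
    (k′ : ℕ) (valency : GrassmannGraph.IsValency F size n vertices k′)
    (m : ℕ) (v≡1+qm : + pointCount q n ≡ 1ℤ + + q * + m) (q≢0 : q ≢ 0) (m≢1 : m ≢ 1)
    where

    open GrassmannIncidence F F-field size n vertices k′ valency m v≡1+qm q≢0 m≢1
    open LinearAlgebra F
    open FiniteField F F-field size hiding (_·_)
    private module K = CommutativeRing F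

    -- Otherwise v = 1 + q, while v = 1 + q m with m different from 1.
    point-off : ∀ i → ∃ λ j → ¬ On i j
    point-off i = ¬∀⟶∃¬ v (On i) (on? i) λ all →
      m≢1 (+-injective (*-cancelˡ-≡ (+ q) (+ m) 1ℤ {{ℕ.≢-nonZero q≢0}} (∙-cancelˡ 1ℤ _ _
        (trans (sym v≡1+qm) (trans (sym (sum-all (on? i) all)) (trans (W-row i) (cong (λ x → 1ℤ + x) (sym (*-identityʳ (+ q))))))))))
      where open import Algebra.Properties.Group (AbelianGroup.group +-0-abelianGroup) using (∙-cancelˡ)

    module PencilCount {j : Fin v} {w t : Vector K.Carrier n} (indep : Independent₃ (pt j) w t) where
      open Pencil indep

      lines : Fin q → Fin N
      lines x = lineIndex (pencil x)

      off⇒≢ : ∀ {k} → OffLine (pt j) w t (pt k) → j ≢ k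
      off⇒≢ off refl = ¬offLine-u indep off

      count-off : ∀ {k} → OffLine (pt j) w t (pt k) → ∑[ x < q ] W (lines x) k ≡ 1ℤ
      count-off {k} (a , b , d , d≉0 , eq) =
        let x , x∋k , unique = pencil-unique {pt k} {a} {b} {d} eq d≉0
        in sum-unique (λ x → on? (lines x) k) {x} (lineIndex-∋⁺ (pencil x) {pt k} x∋k)
             (λ {x′} x′∋k → unique (lineIndex-∋⁻ (pencil x′) {pt k} x′∋k))

      -- The point `k` lies outside the plane or on the line through the centre `j` and `w`. The
      -- lines of the pencil stay in the plane and meet that line in the centre only, where all q of
      -- them pass.
      count-on : ∀ {k} → ¬ OffLine (pt j) w t (pt k) → ∑[ x < q ] W (lines x) k ≡ + q * 𝟙 j k
      count-on {k} ¬off = go (j ≟ᶠ k)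
        where
        no-line : j ≢ k → ∀ x → ¬ On (lines x) k
        no-line j≢k x x∋k =
          let a , k≋ = pencil-center {x} {pt k} (lineIndex-∋⁻ (pencil x) {pt k} x∋k) (¬offLine ¬off)
          in j≢k (sym (point-injective {n} k j a k≋))
        go : Dec (j ≡ k) → ∑[ x < q ] W (lines x) k ≡ + q * 𝟙 j k
        go (yes refl) = trans (sum-all (λ x → on? (lines x) j) (λ x → lineIndex-∋⁺ (pencil x) {pt j} (pencil-∋-u x)))
          (trans (sym (*-identityʳ (+ q))) (cong (+ q *_) (sym (diagonal-refl _ j))))
        go (no j≢k) = trans (sum-none (λ x → on? (lines x) k) (no-line j≢k))
          (trans (sym (*-zeroʳ (+ q))) (cong (+ q *_) (sym (diagonal-≢ _ j≢k))))

    module _ {j₀ j : Fin v} (j≢j₀ : j ≢ j₀) where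
      private
        off = point-off (join j≢j₀)
        t = pt (proj₁ off)

        indep : Independent₃ (pt j) (pt j₀) t
        indep = independent-extend (points-independent {n} j≢j₀) (λ t∈ → proj₂ off (lineIndex-∋⁺ (joinLine j≢j₀) {t} t∈))

        module U = PencilCount indep
        module U₀ = PencilCount (independent₃-swap indep)

      difference : Vector ℤ N
      difference i = ∑[ x < q ] 𝟙 (U.lines x) i - ∑[ x < q ] 𝟙 (U₀.lines x) i

      sum-difference : sum difference ≡ 0ℤ
      sum-difference = trans (∑-distrib-minus (λ i → ∑[ x < q ] 𝟙 (U.lines x) i) (λ i → ∑[ x < q ] 𝟙 (U₀.lines x) i))
        (i≡j⇒i-j≡0 (trans (total U.lines) (sym (total U₀.lines))))
        where
        total : ∀ (f : Fin q → Fin N) → ∑[ i < N ] ∑[ x < q ] 𝟙 (f x) i ≡ + q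
        total f = trans (∑-comm (λ i x → 𝟙 (f x) i)) (trans (sum-cong-≗ {q} (λ x → sum-δ (f x)))
          (trans (sum-const q 1ℤ) (*-identityʳ (+ q))))

      -- A point of the plane off the line joining the centres is on one line of each pencil and
      -- cancels. Both pencils omit the joining line, so only the centres remain, each counted q
      -- times.
      difference-W : ∀ k → ∑[ i < N ] (difference i * W i k) ≡ + q * (𝟙 j k - 𝟙 j₀ k)
      difference-W k = begin
        ∑[ i < N ] (difference i * W i k)
          ≡⟨ sum-cong-≗ (λ i → *-distribʳ-- (W i k) (∑[ x < q ] 𝟙 (U.lines x) i) (∑[ x < q ] 𝟙 (U₀.lines x) i)) ⟩
        ∑[ i < N ] ((∑[ x < q ] 𝟙 (U.lines x) i) * W i k - (∑[ x < q ] 𝟙 (U₀.lines x) i) * W i k)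
          ≡⟨ ∑-distrib-minus (λ i → (∑[ x < q ] 𝟙 (U.lines x) i) * W i k) (λ i → (∑[ x < q ] 𝟙 (U₀.lines x) i) * W i k) ⟩
        _ ≡⟨ cong₂ _-_ (sum-rows W U.lines k) (sum-rows W U₀.lines k) ⟩
        ∑[ x < q ] W (U.lines x) k - ∑[ x < q ] W (U₀.lines x) k
          ≡⟨ count (offLine? (pt j) (pt j₀) t (pt k)) ⟩
        + q * (𝟙 j k - 𝟙 j₀ k) ∎
        where
        open ≡-Reasoning
        *-distribʳ-- : ∀ a b c → (b - c) * a ≡ b * a - c * a
        *-distribʳ-- = solve-∀
        *-distribˡ-- : ∀ a b c → a * b - a * c ≡ a * (b - c)
        *-distribˡ-- = solve-∀
        count : Dec (OffLine (pt j) (pt j₀) t (pt k)) →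
                ∑[ x < q ] W (U.lines x) k - ∑[ x < q ] W (U₀.lines x) k ≡ + q * (𝟙 j k - 𝟙 j₀ k)
        count (no ¬off) = trans (cong₂ _-_ (U.count-on ¬off) (U₀.count-on (λ off → ¬off (offLine-swap off))))
          (*-distribˡ-- (+ q) (𝟙 j k) (𝟙 j₀ k))
        count (yes off) = trans (i≡j⇒i-j≡0 (trans (U.count-off off) (sym (U₀.count-off (offLine-swap off)))))
          (sym (trans (cong₂ (λ a b → + q * (a - b)) (diagonal-≢ _ (U.off⇒≢ off)) (diagonal-≢ _ (U₀.off⇒≢ (offLine-swap off))))
            (*-zeroʳ (+ q))))

    private
      inverseRow : ∀ {j₀ j} → Dec (j ≡ j₀) → Vector ℤ N
      inverseRow (yes _)   = λ _ → 0ℤ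
      inverseRow (no j≢j₀) = difference j≢j₀

      inverseRow-W : ∀ {j₀ j} (d : Dec (j ≡ j₀)) k → ∑[ i < N ] (inverseRow d i * W i k) ≡ + q * (𝟙 j k - 𝟙 j₀ k)
      inverseRow-W (no j≢j₀) k = difference-W j≢j₀ k
      inverseRow-W {j} (yes refl) k = trans (sum-replicate-zero N)
        (sym (trans (cong (+ q *_) (+-inverseʳ (𝟙 j k))) (*-zeroʳ (+ q))))

      inverseRow-sum : ∀ {j₀ j} (d : Dec (j ≡ j₀)) → sum (inverseRow d) ≡ 0ℤ
      inverseRow-sum (no j≢j₀)  = sum-difference j≢j₀
      inverseRow-sum (yes refl) = sum-replicate-zero N

    incidence : Incidence v (GrassmannGraph.laplacian F size n vertices k′) (+ q) (+ m)
    incidence = record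
      { W = W ; WWᵀ = WWᵀ ; WᵀW = WᵀW ; W-row = W-row ; W-column = W-column
      ; X = λ j₀ j → inverseRow (j ≟ᶠ j₀)
      ; XW = λ j₀ j → inverseRow-W (j ≟ᶠ j₀) ; X-row = λ j₀ j → inverseRow-sum (j ≟ᶠ j₀) }

open import Data.List.Base using ([]; _∷_)
open import Data.Nat using (_+_; _*_; _∸_; _≥_; ⌊_/2⌋)
open import Data.Nat.Divisibility using (_∣_; _∤_; divides; ∣-trans; m∣m*n; ∣1⇒≡1; ∣m+n∣m⇒∣n)
open import Data.Nat.DivMod using (m*n/n≡m)
open import Data.Nat.Properties
open import Data.Nat.Tactic.RingSolver using (solve-∀)
import Data.Integer.Base as ℤ
import Data.Integer.Properties as ℤ
open import Relation.Binary.PropositionalEquality using (refl; sym; trans; module ≡-Reasoning)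
open IntegerMatrices using (Incidence; valuation-suc; valuation-*; ∤⇒valuation; module Multiplicities)
open ProjectiveGeometry using (pointCount)
open GrassmannIncidences using (module GrassmannInverse)

-- Arithmetic of q-numbers

pointCount-suc : ∀ q n → pointCount q (suc n) ≡ 1 + q * pointCount q n
pointCount-suc q zero    = cong suc (sym (*-zeroʳ q))
pointCount-suc q (suc n) = begin
  q * q ^ n + pointCount q (suc n)        ≡⟨ cong (q * q ^ n +_) (pointCount-suc q n) ⟩
  q * q ^ n + (1 + q * pointCount q n)    ≡⟨ lemma q (q ^ n) (pointCount q n) ⟩
  1 + q * (q ^ n + pointCount q n)        ∎
  where
  open ≡-Reasoning
  lemma : ∀ q x y → q * x + (1 + q * y) ≡ 1 + q * (x + y)
  lemma = solve-∀

-- Consecutive powers pair up as q^(2k+1) + q^(2k) = (q + 1) (q²)^k. This splits the valuation of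
-- [n] or [n-1] into the parts a and b of the theorem.
pointCount-double : ∀ q k → pointCount q (k * 2) ≡ suc q * pointCount (q ^ 2) k
pointCount-double q zero    = sym (*-zeroʳ (suc q))
pointCount-double q (suc k) = begin
  q * q ^ (k * 2) + (q ^ (k * 2) + pointCount q (k * 2))                 ≡⟨ cong₂ (λ x y → q * x + (x + y)) power (pointCount-double q k) ⟩
  q * (q ^ 2) ^ k + ((q ^ 2) ^ k + suc q * pointCount (q ^ 2) k)         ≡⟨ lemma q ((q ^ 2) ^ k) (pointCount (q ^ 2) k) ⟩
  suc q * ((q ^ 2) ^ k + pointCount (q ^ 2) k)                           ∎
  where
  open ≡-Reasoning
  power : q ^ (k * 2) ≡ (q ^ 2) ^ k
  power = trans (cong (q ^_) (*-comm k 2)) (sym (^-*-assoc q 2 k))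
  lemma : ∀ q x y → q * x + (x + (1 + q) * y) ≡ (1 + q) * (x + y)
  lemma = solve-∀

qNumber≡pointCount : ∀ {q} → 2 ≤ q → ∀ n → qNumber q n ≡ pointCount q n
qNumber≡pointCount {suc (suc s)} (ℕ.s≤s (ℕ.s≤s _)) n =
  trans (cong (λ x → (x ∸ 1) ℕ./ suc s) (sym (geometric n))) (m*n/n≡m (pointCount (2 + s) n) (suc s))
  where
  open ≡-Reasoning
  geometric : ∀ n → suc (pointCount (2 + s) n * suc s) ≡ (2 + s) ^ n
  geometric zero    = refl
  geometric (suc n) = begin
    suc (((2 + s) ^ n + pointCount (2 + s) n) * suc s)               ≡⟨ lemma ((2 + s) ^ n) (pointCount (2 + s) n) s ⟩
    (2 + s) ^ n * suc s + suc (pointCount (2 + s) n * suc s)         ≡⟨ cong ((2 + s) ^ n * suc s +_) (geometric n) ⟩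
    (2 + s) ^ n * suc s + (2 + s) ^ n                                ≡⟨ lemma′ ((2 + s) ^ n) s ⟩
    (2 + s) * (2 + s) ^ n                                            ∎
    where
    lemma : ∀ x y s → 1 + (x + y) * (1 + s) ≡ x * (1 + s) + (1 + y * (1 + s))
    lemma = solve-∀
    lemma′ : ∀ x s → x * (1 + s) + x ≡ (2 + s) * x
    lemma′ = solve-∀

parity : ∀ n → n ≡ ⌊ n /2⌋ * 2 ⊎ n ≡ suc (⌊ n /2⌋ * 2)
parity zero          = inj₁ refl
parity (suc zero)    = inj₂ refl
parity (suc (suc n)) with parity n
... | inj₁ even = inj₁ (cong (λ x → suc (suc x)) even)
... | inj₂ odd  = inj₂ (cong (λ x → suc (suc x)) odd)

-- The four q-numbers are variables, so that qNumber can be replaced by pointCount.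
Conclusion : ∀ {N} {L : Matrix N N} → SmithNormalForm L → (ℓ q n [n] [n-1] [n/2]q² [n-1/2]q² : ℕ) → Set
Conclusion {N} {L} S ℓ q n [n] [n-1] [n/2]q² [n-1/2]q² =
  let e = multiplicity S ℓ
      f = [n] ∸ 1
      g = N ∸ [n]
  in
  (ℓ ∤ q + 1 →
    (ℓ ∤ [n] → ℓ ∤ [n-1] →
      ∀ κ → HasSize (AbelianGroup.setoid (criticalGroup L)) κ → ℓ ∤ κ)
    × (ℓ ∣ [n] ⊎ ℓ ∣ [n-1] → (ℓ ∣ [n] × ℓ ∤ [n-1]) ⊎ (ℓ ∤ [n] × ℓ ∣ [n-1]))
    × (ℓ ∣ [n] → ℓ ∤ [n-1] → ∀ a → Valuation ℓ [n] a →
        e a ≡ f ∸ 1 × e 0 ≡ g + 1 × e VanishesOff (a ∷ 0 ∷ []))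
    × (ℓ ∤ [n] → ℓ ∣ [n-1] → ∀ a → Valuation ℓ [n-1] a →
        e a ≡ g ∸ 1 × e 0 ≡ f + 1 × e VanishesOff (a ∷ 0 ∷ [])))
  ×
  (ℓ ∣ q + 1 → ∀ a → Valuation ℓ (q + 1) a →
    (ℓ ∤ [n] → ℓ ∣ [n-1] →
      2 ∤ n
      × (ℓ ∤ [n-1/2]q² →
          e (2 * a) ≡ g × e 0 ≡ f × e VanishesOff (2 * a ∷ 0 ∷ []))
      × (ℓ ∣ [n-1/2]q² → ∀ b → Valuation ℓ [n-1/2]q² b →
          e (2 * a + b) ≡ g ∸ 1 × e (2 * a) ≡ 1 × e 0 ≡ f
          × e VanishesOff (2 * a + b ∷ 2 * a ∷ 0 ∷ [])))
    × (ℓ ∣ [n] → ℓ ∤ [n-1] →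
      2 ∣ n
      × (ℓ ∤ [n/2]q² → ℓ ∤ ⌊ n ∸ 1 /2⌋ →
          e (2 * a) ≡ f ∸ 1 × e a ≡ (g + 2) ∸ f × e 0 ≡ f ∸ 1
          × e VanishesOff (2 * a ∷ a ∷ 0 ∷ []))
      × (ℓ ∣ [n/2]q² → ∀ b → Valuation ℓ [n/2]q² b →
          e (2 * a + b) ≡ f ∸ 1 × e a ≡ (g + 2) ∸ f × e 0 ≡ f ∸ 1
          × e VanishesOff (2 * a + b ∷ a ∷ 0 ∷ []))
      × (ℓ ∤ [n/2]q² → ℓ ∣ ⌊ n ∸ 1 /2⌋ →
          e (2 * a) ≡ f ∸ 1 × e a ≡ (g + 2) ∸ f × e 0 ≡ f ∸ 1
          × e VanishesOff (2 * a ∷ a ∷ 0 ∷ []))))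

-- Parity of n and assembly of the cases

module _ {N v′ : ℕ} {L : Matrix N N} {q C n′ : ℕ} (incidence : Incidence (suc (suc v′)) L (ℤ.+ q) (ℤ.+ suc C))
  (V≡1+qM : suc (suc v′) ≡ 1 + q * suc C) (q<M : q < suc C)
  (V≡ : suc (suc v′) ≡ pointCount q (suc n′)) (M≡ : suc C ≡ pointCount q n′)
  (S : SmithNormalForm L) {ℓ : ℕ} (ℓ-prime : Prime ℓ) where

  open Multiplicities incidence V≡1+qM q<M

  private
    V M n : ℕ
    V = suc (suc v′)
    M = suc C
    n = suc n′
    e = multiplicity S ℓ
    G = N ∸ V
    β  = pointCount (q ^ 2) ⌊ n /2⌋
    β′ = pointCount (q ^ 2) ⌊ n′ /2⌋

    coprime : ℓ ∣ V → ℓ ∤ M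
    coprime ℓ∣V ℓ∣M = ℕ.nonTrivial⇒≢1 {{prime⇒nonTrivial ℓ-prime}} (∣1⇒≡1
      (∣m+n∣m⇒∣n {m = q * M} (subst (ℓ ∣_) (trans V≡1+qM (+-comm 1 (q * M))) ℓ∣V) (∣-trans ℓ∣M (divides q refl))))

    conclusion-A : ℓ ∤ suc q →
      (ℓ ∤ V → ℓ ∤ M → ∀ κ → HasSize (AbelianGroup.setoid (criticalGroup L)) κ → ℓ ∤ κ)
      × (ℓ ∣ V ⊎ ℓ ∣ M → (ℓ ∣ V × ℓ ∤ M) ⊎ (ℓ ∤ V × ℓ ∣ M))
      × (ℓ ∣ V → ℓ ∤ M → ∀ a → Valuation ℓ V a → e a ≡ v′ × e 0 ≡ G + 1 × e VanishesOff (a ∷ 0 ∷ []))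
      × (ℓ ∤ V → ℓ ∣ M → ∀ a → Valuation ℓ M a → e a ≡ G ∸ 1 × e 0 ≡ suc v′ + 1 × e VanishesOff (a ∷ 0 ∷ []))
    conclusion-A ℓ∤Q =
      (λ ℓ∤V ℓ∤M → criticalGroup-order ℓ-prime ℓ∤V ℓ∤Q ℓ∤M) ,
      (λ { (inj₁ ℓ∣V) → inj₁ (ℓ∣V , coprime ℓ∣V) ; (inj₂ ℓ∣M) → inj₂ ((λ ℓ∣V → coprime ℓ∣V ℓ∣M) , ℓ∣M) }) ,
      A-i , A-ii
      where
      A-i : ℓ ∣ V → ℓ ∤ M → ∀ a → Valuation ℓ V a → e a ≡ v′ × e 0 ≡ G + 1 × e VanishesOff (a ∷ 0 ∷ [])
      A-i ℓ∣V ℓ∤M a vV with valuation-suc ℓ-prime a ℓ∣V vV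
      ... | a′ , refl = let eₐ , e₀ , off = case-A-i S ℓ-prime a′ vV ℓ∤Q ℓ∤M in eₐ , trans e₀ (+-comm 1 G) , off
      A-ii : ℓ ∤ V → ℓ ∣ M → ∀ a → Valuation ℓ M a → e a ≡ G ∸ 1 × e 0 ≡ suc v′ + 1 × e VanishesOff (a ∷ 0 ∷ [])
      A-ii ℓ∤V ℓ∣M a vM with valuation-suc ℓ-prime a ℓ∣M vM
      ... | a′ , refl = let eₐ , e₀ , off = case-A-ii S ℓ-prime a′ vM ℓ∤Q ℓ∤V in eₐ , trans e₀ (+-comm 1 (suc v′)) , off

    even⇒ : ∀ {m} k → m ≡ k * 2 → pointCount q m ≡ suc q * pointCount (q ^ 2) k
    even⇒ k refl = pointCount-double q k

    module _ (a : ℕ) (vQ : Valuation ℓ (suc q) (suc a)) where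

      ℓ∣Q : ℓ ∣ suc q
      ℓ∣Q = ∣-trans (m∣m*n (ℓ ^ a)) (proj₁ vQ)

      ℓ∣even : ∀ {m} k → m ≡ k * 2 → ℓ ∣ pointCount q m
      ℓ∣even k eq = subst (ℓ ∣_) (sym (even⇒ k eq)) (∣-trans ℓ∣Q (m∣m*n (pointCount (q ^ 2) k)))

      valuation-even : ∀ {x m} k → x ≡ pointCount q m → m ≡ k * 2 → ∀ b → Valuation ℓ (pointCount (q ^ 2) k) b →
                       Valuation ℓ x (suc a + b)
      valuation-even k x≡ eq b vβ = subst (λ x → Valuation ℓ x (suc a + b)) (sym (trans x≡ (even⇒ k eq)))
        (valuation-* ℓ-prime (suc a) b vQ vβ)

      -- For even n, q + 1 divides [n], so ℓ would divide `V`. The even case below is the same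
      -- argument with [n-1].
      odd-case : ℓ ∤ V → ℓ ∣ M → 2 ∤ n × n′ ≡ ⌊ n′ /2⌋ * 2
      odd-case ℓ∤V ℓ∣M = 2∤n , even
        where
        2∤n : 2 ∤ n
        2∤n (divides k n≡k*2) = ℓ∤V (subst (ℓ ∣_) (sym V≡) (ℓ∣even k n≡k*2))
        even : n′ ≡ ⌊ n′ /2⌋ * 2
        even with parity n′
        ... | inj₁ n′-even = n′-even
        ... | inj₂ n′-odd  = contradiction (divides (suc ⌊ n′ /2⌋) (cong suc n′-odd)) 2∤n

      even-case : ℓ ∣ V → ℓ ∤ M → n ≡ ⌊ n /2⌋ * 2
      even-case ℓ∣V ℓ∤M with parity n
      ... | inj₁ n-even = n-even
      ... | inj₂ n-odd  = contradiction (subst (ℓ ∣_) (sym M≡) (ℓ∣even ⌊ n /2⌋ (suc-injective n-odd))) ℓ∤M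

      conclusion-B-odd : ℓ ∤ V → ℓ ∣ M →
        2 ∤ n
        × (ℓ ∤ β′ → e (2 * suc a) ≡ G × e 0 ≡ suc v′ × e VanishesOff (2 * suc a ∷ 0 ∷ []))
        × (ℓ ∣ β′ → ∀ b → Valuation ℓ β′ b →
            e (2 * suc a + b) ≡ G ∸ 1 × e (2 * suc a) ≡ 1 × e 0 ≡ suc v′
            × e VanishesOff (2 * suc a + b ∷ 2 * suc a ∷ 0 ∷ []))
      conclusion-B-odd ℓ∤V ℓ∣M = proj₁ odd , i , ii
        where
        odd = odd-case ℓ∤V ℓ∣M
        i : ℓ ∤ β′ → e (2 * suc a) ≡ G × e 0 ≡ suc v′ × e VanishesOff (2 * suc a ∷ 0 ∷ [])
        i ℓ∤β′ = case-B-i S ℓ-prime a vQ ℓ∤V (subst (Valuation ℓ M) (+-identityʳ (suc a))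
          (valuation-even ⌊ n′ /2⌋ M≡ (proj₂ odd) 0 (∤⇒valuation ℓ-prime ℓ∤β′)))
        ii : ℓ ∣ β′ → ∀ b → Valuation ℓ β′ b →
             e (2 * suc a + b) ≡ G ∸ 1 × e (2 * suc a) ≡ 1 × e 0 ≡ suc v′
             × e VanishesOff (2 * suc a + b ∷ 2 * suc a ∷ 0 ∷ [])
        ii ℓ∣β′ b vβ′ with valuation-suc ℓ-prime b ℓ∣β′ vβ′
        ... | b′ , refl = case-B-ii S ℓ-prime a vQ ℓ∤V b′ (valuation-even ⌊ n′ /2⌋ M≡ (proj₂ odd) (suc b′) vβ′)

      conclusion-B-even : ℓ ∣ V → ℓ ∤ M → ∀ b → Valuation ℓ β b →
        e (2 * suc a + b) ≡ v′ × e (suc a) ≡ (G + 2) ∸ suc v′ × e 0 ≡ v′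
        × e VanishesOff (2 * suc a + b ∷ suc a ∷ 0 ∷ [])
      conclusion-B-even ℓ∣V ℓ∤M b vβ =
        let e₂ₐ₊ᵦ , eₐ , e₀ , off = case-B-iii-v S ℓ-prime a vQ b (valuation-even ⌊ n /2⌋ V≡ (even-case ℓ∣V ℓ∤M) b vβ) ℓ∤M
        in e₂ₐ₊ᵦ , trans eₐ (cong (_∸ suc v′) (+-comm 2 G)) , e₀ , off

      -- The instance b = 0; the transport removes the summand 0 from the index, both in the value
      -- and in the list of exceptions.
      conclusion-B-even₀ : ℓ ∣ V → ℓ ∤ M → ℓ ∤ β →
        e (2 * suc a) ≡ v′ × e (suc a) ≡ (G + 2) ∸ suc v′ × e 0 ≡ v′
        × e VanishesOff (2 * suc a ∷ suc a ∷ 0 ∷ [])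
      conclusion-B-even₀ ℓ∣V ℓ∤M ℓ∤β = subst
        (λ k → e k ≡ v′ × e (suc a) ≡ (G + 2) ∸ suc v′ × e 0 ≡ v′ × e VanishesOff (k ∷ suc a ∷ 0 ∷ []))
        (+-identityʳ (2 * suc a)) (conclusion-B-even ℓ∣V ℓ∤M 0 (∤⇒valuation ℓ-prime ℓ∤β))

  conclusion : Conclusion S ℓ q n V M β β′
  conclusion = (λ ℓ∤q+1 → conclusion-A (λ ℓ∣Q → ℓ∤q+1 (subst (ℓ ∣_) (+-comm 1 q) ℓ∣Q))) , B
    where
    B : ℓ ∣ q + 1 → ∀ a → Valuation ℓ (q + 1) a → _
    B ℓ∣q+1 a vq+1 with valuation-suc ℓ-prime a ℓ∣q+1 vq+1
    ... | a′ , refl = conclusion-B-odd a′ vQ , λ ℓ∣V ℓ∤M →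
      divides ⌊ n /2⌋ (even-case a′ vQ ℓ∣V ℓ∤M) ,
      (λ ℓ∤β _ → conclusion-B-even₀ a′ vQ ℓ∣V ℓ∤M ℓ∤β) ,
      (λ _ → conclusion-B-even a′ vQ ℓ∣V ℓ∤M) ,
      (λ ℓ∤β _ → conclusion-B-even₀ a′ vQ ℓ∣V ℓ∤M ℓ∤β)
      where
      vQ : Valuation ℓ (suc q) (suc a′)
      vQ = subst (λ x → Valuation ℓ x (suc a′)) (+-comm q 1) vq+1

grassmann-conclusion :
  ∀ {N v m q n′ : ℕ} {L : Matrix N N} → Incidence v L (ℤ.+ q) (ℤ.+ m) → q ≢ 0 →
  v ≡ 1 + q * m → q < m → v ≡ pointCount q (suc n′) → m ≡ pointCount q n′ →
  (S : SmithNormalForm L) {ℓ : ℕ} → Prime ℓ →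
  Conclusion S ℓ q (suc n′) v m (pointCount (q ^ 2) ⌊ suc n′ /2⌋) (pointCount (q ^ 2) ⌊ n′ /2⌋)
grassmann-conclusion {v = suc (suc v′)} {suc C} I _ v≡1+qm q<m v≡ m≡ S ℓ-prime =
  conclusion I v≡1+qm q<m v≡ m≡ S ℓ-prime
-- From v = 1 + q m and q < m it follows that m is positive and that v is at least 2, unless q = 0.
grassmann-conclusion {v = suc zero} {suc C} {zero} I q≢0 _ _ _ _ _ _ = contradiction refl q≢0

mainTheorem5 :
  ∀ {c r} (p t n ℓ : ℕ) → Prime p → t ≥ 1 → n ≥ 4 → Prime ℓ → ℓ ≢ p →
  (F : CommutativeRing c r) → IsField F →
  (size : HasSize (CommutativeRing.setoid F) (p ^ t)) →
  (N : ℕ) (vertices : HasSize (LinearAlgebra.Subspaces F 2 n) N) →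
  (k′ : ℕ) → GrassmannGraph.IsValency F size n vertices k′ →
  let L′ = GrassmannGraph.laplacian F size n vertices k′ in
  (S : SmithNormalForm L′) →
  let q = p ^ t
      e = multiplicity S ℓ
      [n] = qNumber q n
      [n-1] = qNumber q (n ∸ 1)
      [n/2]q² = qNumber (q ^ 2) ⌊ n /2⌋
      [n-1/2]q² = qNumber (q ^ 2) ⌊ n ∸ 1 /2⌋
      f = [n] ∸ 1
      g = N ∸ [n]
  in
  -- (A)
  (ℓ ∤ q + 1 →
    (ℓ ∤ [n] → ℓ ∤ [n-1] →
      ∀ κ → HasSize (AbelianGroup.setoid (criticalGroup L′)) κ → ℓ ∤ κ)
    × (ℓ ∣ [n] ⊎ ℓ ∣ [n-1] → (ℓ ∣ [n] × ℓ ∤ [n-1]) ⊎ (ℓ ∤ [n] × ℓ ∣ [n-1]))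
    -- (i)
    × (ℓ ∣ [n] → ℓ ∤ [n-1] → ∀ a → Valuation ℓ [n] a →
        e a ≡ f ∸ 1 × e 0 ≡ g + 1 × e VanishesOff (a ∷ 0 ∷ []))
    -- (ii)
    × (ℓ ∤ [n] → ℓ ∣ [n-1] → ∀ a → Valuation ℓ [n-1] a →
        e a ≡ g ∸ 1 × e 0 ≡ f + 1 × e VanishesOff (a ∷ 0 ∷ [])))
  ×
  -- (B)
  (ℓ ∣ q + 1 → ∀ a → Valuation ℓ (q + 1) a →
    (ℓ ∤ [n] → ℓ ∣ [n-1] →
      2 ∤ n
      -- (i)
      × (ℓ ∤ [n-1/2]q² →
          e (2 * a) ≡ g × e 0 ≡ f × e VanishesOff (2 * a ∷ 0 ∷ []))
      -- (ii)
      × (ℓ ∣ [n-1/2]q² → ∀ b → Valuation ℓ [n-1/2]q² b →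
          e (2 * a + b) ≡ g ∸ 1 × e (2 * a) ≡ 1 × e 0 ≡ f
          × e VanishesOff (2 * a + b ∷ 2 * a ∷ 0 ∷ [])))
    × (ℓ ∣ [n] → ℓ ∤ [n-1] →
      2 ∣ n
      -- (iii)
      × (ℓ ∤ [n/2]q² → ℓ ∤ ⌊ n ∸ 1 /2⌋ →
          e (2 * a) ≡ f ∸ 1 × e a ≡ (g + 2) ∸ f × e 0 ≡ f ∸ 1
          × e VanishesOff (2 * a ∷ a ∷ 0 ∷ []))
      -- (iv)
      × (ℓ ∣ [n/2]q² → ∀ b → Valuation ℓ [n/2]q² b →
          e (2 * a + b) ≡ f ∸ 1 × e a ≡ (g + 2) ∸ f × e 0 ≡ f ∸ 1
          × e VanishesOff (2 * a + b ∷ a ∷ 0 ∷ []))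
      -- (v)
      × (ℓ ∤ [n/2]q² → ℓ ∣ ⌊ n ∸ 1 /2⌋ →
          e (2 * a) ≡ f ∸ 1 × e a ≡ (g + 2) ∸ f × e 0 ≡ f ∸ 1
          × e VanishesOff (2 * a ∷ a ∷ 0 ∷ []))))
mainTheorem5 p t n@(suc n′@(suc n″@(suc n‴))) ℓ p-prime t≥1 (ℕ.s≤s (ℕ.s≤s (ℕ.s≤s _))) ℓ-prime _ F F-field size N vertices k′ valency S =
  subst₂ (λ [n/2] [n-1/2] → Conclusion S ℓ q n (qNumber q n) (qNumber q n′) [n/2] [n-1/2])
    (sym (qNumber≡pointCount 2≤q² ⌊ n /2⌋)) (sym (qNumber≡pointCount 2≤q² ⌊ n′ /2⌋))
    (subst₂ (λ [n] [n-1] → Conclusion S ℓ q n [n] [n-1] (pointCount (q ^ 2) ⌊ n /2⌋) (pointCount (q ^ 2) ⌊ n′ /2⌋))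
      (sym (qNumber≡pointCount 2≤q n)) (sym (qNumber≡pointCount 2≤q n′))
      (grassmann-conclusion incidence q≢0 v≡1+qm q<m refl refl S ℓ-prime))
  where
  open ≤-Reasoning
  q = p ^ t
  m = pointCount q n′
  2≤q : 2 ≤ q
  2≤q = begin
    2      ≤⟨ ℕ.nonTrivial⇒n>1 p {{prime⇒nonTrivial p-prime}} ⟩
    p      ≡⟨ ^-identityʳ p ⟨
    p ^ 1  ≤⟨ ^-monoʳ-≤ p {{prime⇒nonZero p-prime}} t≥1 ⟩
    p ^ t  ∎
  q≢0 : q ≢ 0
  q≢0 q≡0 = n≮0 (subst (2 ≤_) q≡0 2≤q)
  2≤q² : 2 ≤ q ^ 2
  2≤q² = begin
    2          ≤⟨ 2≤q ⟩
    q          ≤⟨ m≤m*n q q {{ℕ.≢-nonZero q≢0}} ⟩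
    q * q      ≡⟨ cong (q *_) (*-identityʳ q) ⟨
    q ^ 2      ∎
  v≡1+qm : pointCount q n ≡ 1 + q * m
  v≡1+qm = pointCount-suc q n′
  -- m = 1 + q [n-2] with [n-2] positive. The inequality also gives `m≢1`, and thereby a point off
  -- every line.
  q<m : q < m
  q<m = begin-strict
    q                                ≡⟨ *-identityʳ q ⟨
    q * 1                            ≤⟨ *-monoʳ-≤ q (subst (1 ≤_) (sym (pointCount-suc q n‴)) (ℕ.s≤s ℕ.z≤n)) ⟩
    q * pointCount q n″              <⟨ n<1+n _ ⟩
    1 + q * pointCount q n″          ≡⟨ pointCount-suc q n″ ⟨
    m                                ∎
  m≢1 : m ≢ 1
  m≢1 m≡1 = n≮n 1 (subst (2 ≤_) m≡1 (≤-trans 2≤q (<⇒≤ q<m)))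
  open GrassmannInverse F F-field size n vertices k′ valency m
    (trans (cong ℤ.+_ v≡1+qm) (cong (λ x → ℤ.1ℤ ℤ.+ x) (ℤ.pos-* q m))) q≢0 m≢1 using (incidence)
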